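{- For any integer $w > 0$ and finite field $\mathbb{F}_q$, the class $\mathcal{P}_{w,q}$ has finitely many excluded minors. Consequently, the code family $\mathfrak{C}(\mathcal{P}_{w,q}) = \{\mathcal{C} : \mathcal{C} \text{ is a linear code over } \mathbb{F}_q \text{ with } \mathrm{tw}(\mathcal{C}) \le w\}$ also has finitely many excluded minors.
   Context: $\mathcal{P}_{w,q}$ is the class of $\mathbb{F}_q$-representable matroids of pathwidth at most $w$, where for a matroid $M$, $\lambda_M(X) = r_M(X)+r_M(E(M)-X)-r_M(E(M))$, the width of an ordering $(e_1,\ldots,e_n)$ of $E(M)$ is $\max_i\lambda_M(\{e_1,\ldots,e_i\})$, and $\mathrm{pw}(M)$ is the minimum width over orderings. An excluded minor for $\mathcal{P}_{w,q}$ is an $\mathbb{F}_q$-representable matroid not in the class all of whose proper minors are in it. For a linear code $\mathcal{C}$ over $\mathbb{F}_q$, $M(\mathcal{C})$ is the vector matroid of a generator matrix, and $\mathrm{tw}(\mathcal{C}) = \mathrm{pw}(M(\mathcal{C}))$. Code minors are codes obtained by puncturing (deleting coordinates; corresponds to matroid deletion) and shortening (corresponds to matroid contraction); two codes are equivalent if one is obtained from the other by multiplying coordinates by nonzero scalars and permuting coordinates. A code family is minor-closed if it contains every code equivalent to a minor of any of its members; an excluded minor of such a family is a code not in the family all of whose proper minors are in it. -}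

module Defs where

open import Level using (Level; _⊔_) renaming (suc to lsuc)
open import Algebra.Bundles using (CommutativeRing)
open import Data.Nat as ℕ using (ℕ; zero; suc; _≤_; _<_; _∸_)
open import Data.Nat.Properties using (_<?_)
open import Data.Bool using (Bool; true; false; if_then_else_)
open import Data.Fin using (Fin; toℕ)
open import Data.Fin.Properties using (any?) renaming (_≟_ to _≟ᶠ_)
open import Data.Fin.Subset using (Subset; _∈_; _⊆_; _∪_; _∩_; ∁; ⊥; ⊤; ∣_∣)
open import Data.Fin.Subset.Properties using (_∈?_)
open import Data.Vec using (tabulate; lookup)
open import Data.List using (List; map; foldr; upTo)
open import Data.Product using (Σ; ∃; ∃-syntax; _×_; _,_)
open import Data.Empty using () renaming (⊥ to Empty)
open import Relation.Nullary using (¬_; does)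
open import Relation.Nullary.Decidable using (_×-dec_)
open import Relation.Binary.PropositionalEquality using (_≡_)
open import Relation.Binary using (Decidable)
open import Function.Bundles using (_⇔_)
open import Function.Definitions using (Injective; Bijective)

record FiniteField (c ℓ : Level) : Set (lsuc (c ⊔ ℓ)) where
  field
    commutativeRing : CommutativeRing c ℓ
  open CommutativeRing commutativeRing public
  field
    1≉0      : ¬ (1# ≈ 0#)
    inverse  : ∀ x → ¬ (x ≈ 0#) → ∃[ y ] (x * y ≈ 1#)
    _≟_      : Decidable _≈_
    size     : ℕ
    enum     : Fin size → Carrier
    enum-onto : ∀ x → ∃[ i ] (enum i ≈ x)

image : ∀ {k n} → (Fin k → Fin n) → Subset k → Subset n
image {k} f X = tabulate λ j → does (any? λ i → (i ∈? X) ×-dec (f i ≟ᶠ j))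

initial : ∀ {n} → ℕ → Subset n
initial i = tabulate λ k → does (toℕ k <? i)

record Matroid (n : ℕ) : Set where
  field
    rank       : Subset n → ℕ
    rank-bound : ∀ X → rank X ≤ ∣ X ∣
    rank-mono  : ∀ {X Y} → X ⊆ Y → rank X ≤ rank Y
    rank-submod : ∀ X Y → rank (X ∪ Y) ℕ.+ rank (X ∩ Y) ≤ rank X ℕ.+ rank Y
open Matroid public

conn : ∀ {n} → Matroid n → Subset n → ℕ
conn M X = rank M X ℕ.+ rank M (∁ X) ∸ rank M ⊤

prefix : ∀ {n} → (Fin n → Fin n) → ℕ → Subset n
prefix e i = image e (initial i)

width : ∀ {n} → Matroid n → (Fin n → Fin n) → ℕ
width {n} M e = foldr ℕ._⊔_ 0 (map (λ i → conn M (prefix e i)) (upTo (suc n)))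

PwAtMost : ∀ {n} → Matroid n → ℕ → Set
PwAtMost {n} M w = Σ (Fin n → Fin n) λ e → Bijective _≡_ _≡_ e × width M e ≤ w

-- N (on Fin k) is (isomorphic to) a minor M / C \ D of M (on Fin n):
-- ι embeds E(N) into E(M), C is the contracted set (disjoint from the
-- image of ι), everything else is deleted; r_N(X) = r_M(ι X ∪ C) - r_M(C).
IsMinor : ∀ {k n} → Matroid k → Matroid n → Set
IsMinor {k} {n} N M =
  Σ (Fin k → Fin n) λ ι → Injective _≡_ _≡_ ι ×
  Σ (Subset n) λ C → (C ∩ image ι ⊤ ≡ ⊥) ×
  (∀ X → rank N X ≡ rank M (image ι X ∪ C) ∸ rank M C)

Iso : ∀ {n k} → Matroid n → Matroid k → Set
Iso {n} {k} M N = Σ (Fin n → Fin k) λ f → Bijective _≡_ _≡_ f ×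
  (∀ X → rank N (image f X) ≡ rank M X)

module _ {c ℓ} (F : FiniteField c ℓ) where
  open FiniteField F

  ∑ : ∀ {k} → (Fin k → Carrier) → Carrier
  ∑ {zero} f = 0#
  ∑ {suc k} f = f Fin.zero + ∑ (λ i → f (Fin.suc i))

  Independent : ∀ {m n} → (Fin m → Fin n → Carrier) → Subset n → Set (c ⊔ ℓ)
  Independent {m} {n} A Y =
    ∀ (a : Fin n → Carrier) →
    (∀ i → ∑ (λ j → if lookup Y j then a j * A i j else 0#) ≈ 0#) →
    ∀ j → j ∈ Y → a j ≈ 0#

  IsColumnRank : ∀ {m n} → (Fin m → Fin n → Carrier) → Subset n → ℕ → Set (c ⊔ ℓ)
  IsColumnRank A X r =
    (∃[ Y ] (Y ⊆ X × Independent A Y × ∣ Y ∣ ≡ r)) ×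
    (∀ Y → Y ⊆ X → Independent A Y → ∣ Y ∣ ≤ r)

  Represents : ∀ {m n} → (Fin m → Fin n → Carrier) → Matroid n → Set (c ⊔ ℓ)
  Represents A M = ∀ X → IsColumnRank A X (rank M X)

  Representable : ∀ {n} → Matroid n → Set (c ⊔ ℓ)
  Representable {n} M = ∃[ m ] Σ (Fin m → Fin n → Carrier) λ A → Represents A M

  InP : ℕ → ∀ {n} → Matroid n → Set (c ⊔ ℓ)
  InP w M = Representable M × PwAtMost M w

  ExcludedMinorP : ℕ → ∀ {n} → Matroid n → Set (c ⊔ ℓ)
  ExcludedMinorP w {n} M =
    Representable M × ¬ InP w M ×
    (∀ {k} (N : Matroid k) → IsMinor N M → k < n → InP w N)

  -- Linear codes of length n over F, presented by a matrix whose rows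
  -- span the code (a generator matrix).

  record Code (n : ℕ) : Set c where
    field
      dim : ℕ
      gen : Fin dim → Fin n → Carrier

  Codeword : ∀ {n} → Code n → (Fin n → Carrier) → Set (c ⊔ ℓ)
  Codeword C x = Σ (Fin (Code.dim C) → Carrier) λ a → ∀ j → x j ≈ ∑ (λ i → a i * Code.gen C i j)

  -- tw(C) ≤ w, with tw(C) = pw(M(C)), M(C) the vector matroid of a generator matrix
  TwAtMost : ℕ → ∀ {n} → Code n → Set (c ⊔ ℓ)
  TwAtMost w {n} C = ∃[ M ] (Represents (Code.gen C) M × PwAtMost {n} M w)

  -- D (length m) is equivalent to a minor of C (length n): shorten C on S,
  -- puncture all coordinates outside S ∪ image ι, then permute (ι) and
  -- scale coordinates by nonzero scalars s.
  IsCodeMinor : ∀ {m n} → Code m → Code n → Set (c ⊔ ℓ)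
  IsCodeMinor {m} {n} D C =
    Σ (Fin m → Fin n) λ ι → Injective _≡_ _≡_ ι ×
    Σ (Subset n) λ S → (S ∩ image ι ⊤ ≡ ⊥) ×
    Σ (Fin m → Carrier) λ s → (∀ j → ¬ (s j ≈ 0#)) ×
    (∀ y → Codeword D y ⇔
       (∃[ x ] (Codeword C x × (∀ j → j ∈ S → x j ≈ 0#) ×
                 (∀ j → y j ≈ s j * x (ι j)))))

  ExcludedMinorCode : ℕ → ∀ {n} → Code n → Set (c ⊔ ℓ)
  ExcludedMinorCode w {n} C =
    ¬ TwAtMost w C ×
    (∀ {m} (D : Code m) → IsCodeMinor D C → m < n → TwAtMost w D)

  SameCode : ∀ {m} → Code m → Σ ℕ Code → Set (c ⊔ ℓ)
  SameCode {m} D (n , C) =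
    Σ (n ≡ m) λ { _≡_.refl → ∀ y → Codeword D y ⇔ Codeword C y }

{-# OPTIONS --safe #-}

-- Deleting one element of an excluded minor M leaves width at most w, so M has a long chain of
-- sets of connectivity at most w + 1.  Thinning it gives a long chain A₀ ⊂ A₁ ⊂ … with constant
-- connectivity k such that every set between consecutive members has connectivity at least k;
-- Tutte's linking theorem then identifies the boundaries span Aᵢ ∩ span (∁ Aᵢ) of all members by
-- contracting suitable elements, so all of them get coordinates in one space F^(w+1).
-- A layout of Aᵢ is a word of states (P , Q , n): the traces P, Q on the boundary of the span of
-- the elements already seen and still to come, and a connectivity n.  Which continuations outside
-- Aᵢ keep the width at most w depends only on this word, and collapsing typical sequences turns it
-- into an equivalent word of bounded length.  If the chain is longer than the number of sets of
-- short words, two members A ⊂ A′ realise the same short words.  The proper minor in which A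
-- replaces A′ has width at most w, hence so does M: the size of M is bounded explicitly, and the
-- excluded minors are found in a finite enumeration.  For codes, shortening is matroid contraction
-- because a functional vanishing on the kernel of others is a combination of them.

module Submission where

open import Defs
open import Level using (Level; _⊔_)
open import Data.Nat using (ℕ; _<_)
open import Data.Nat as ℕ using (zero; suc; _≤_; z≤n; s≤s)
import Data.Nat.Properties as ℕₚ
open import Data.Nat.Solver using (module +-*-Solver)
open import Data.Bool using (Bool; true; false; T; _∧_; _∨_; not; if_then_else_)
import Data.Bool.Properties as Boolₚ
open import Data.Unit using (tt) renaming (⊤ to Unit₀)
open import Data.Unit.Polymorphic using () renaming (⊤ to Unit)
open import Data.Empty using () renaming (⊥ to Empty; ⊥-elim to Empty-elim)
open import Data.Product using (Σ; ∃-syntax; _×_; _,_; proj₁; proj₂)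
import Data.Product.Properties as Productₚ
open import Data.Sum using (_⊎_; inj₁; inj₂)
open import Data.Fin as Fin using (Fin; zero; suc; #_; toℕ; fromℕ<; funToFin; finToFun)
import Data.Fin.Properties as Finₚ
open import Data.Fin.Subset using (Subset; _∈_; _∉_; _⊆_; _⊂_; ∣_∣; _∪_; _∩_; ⊥; ⊤; ∁; ⁅_⁆)
import Data.Fin.Subset.Properties as Subₚ
open import Data.Vec as Vec using (Vec; []; _∷_; here; there; tabulate)
import Data.Vec.Functional as Fun
import Data.Vec.Properties as Vecₚ
open import Data.List as List using (List; []; _∷_; _++_; [_]; map; length; foldr; upTo; cartesianProduct; cartesianProductWith)
open import Data.List.Properties using (map-++; length-++; length-map; ++-assoc)
import Data.List.Membership.Propositional as Mem
import Data.List.Membership.Propositional.Properties as Memₚ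
open import Data.List.Relation.Unary.All as All using (All; []; _∷_)
import Data.List.Relation.Unary.All.Properties as Allₚ
open import Data.List.Relation.Unary.AllPairs as AllPairs using (AllPairs; []; _∷_)
import Data.List.Relation.Unary.AllPairs.Properties as AllPairsₚ
open import Data.List.Relation.Unary.Any as Any using (Any; here; there)
import Data.List.Relation.Unary.Any.Properties as Anyₚ
open import Data.List.Relation.Unary.Linked using (Linked; []; [-]; _∷_)
open import Data.List.Relation.Unary.Linked.Properties using (Linked⇒AllPairs)
open import Data.List.Relation.Binary.Permutation.Propositional using (_↭_; ↭-sym)
open import Data.List.Relation.Binary.Permutation.Propositional.Properties using (∈-resp-↭; ++-comm)
open import Function.Base using (_∘_)
open import Function.Bundles using (mk⇔)
open import Function.Definitions using (Injective)
open import Relation.Nullary using (¬_; yes; no; Dec; does)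
open import Relation.Nullary.Decidable using (dec-true; decidable-stable; ¬¬-excluded-middle; _×-dec_; _→-dec_; ¬?)
open import Relation.Unary using (Decidable)
open import Relation.Binary using (DecidableEquality)
open import Relation.Binary.PropositionalEquality as ≡ using (_≡_; cong; cong₂; subst)

-- A layout of M may interleave the elements of Aᵢ with those outside arbitrarily, so an arrangement
-- of Aᵢ cannot be exchanged as one block. Staircase walks record the interleaving: one axis is the
-- word of Aᵢ, the other the sets built up outside, and two words are identified when no sequence of
-- outside sets tells them apart. Constant connectivity with nothing smaller in between matters
-- because the contraction that links two members then keeps the whole of both boundaries and is
-- skew to the smaller member, so ranks inside that member do not change. The exchange runs from the
-- smaller member to the larger, hence only one inclusion between their sets of realised words is
-- used. The bound is w + 1 rather than w because restoring the deleted element can raise a rank by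
-- one. Realising a word refers to all environments and all continuations and is not decided; the
-- pigeonhole argument therefore runs under a double negation, which is harmless since it ends in a
-- contradiction.

-- Words of states, their equivalence, and typical sequences

module WordsOver (Color : Set) (_≟ᶜ_ : DecidableEquality Color) where
  open ≡ using (refl; sym; trans)
  open import Data.Nat using (_+_; _*_)

  State : Set
  State = Color × ℕ

  _⊑_ : State → State → Set
  (c , m) ⊑ (d , n) = c ≡ d × m ≤ n

  -- An environment stands for a set of outside elements and holds the states compatible with it. It
  -- is closed downwards because lower connectivity inside never hurts.
  Env : Set₁
  Env = Σ (State → Set) λ e → ∀ {s t} → s ⊑ t → e t → e s

  -- Monotone staircase walks in the grid (word × environments): at each
  -- environment e the walk may move on in the word or in the environments.
  Stay : State → (List Env → Set) → List Env → Set
  Stay s K []       = Empty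
  Stay s K (e ∷ es) = proj₁ e s × (K (e ∷ es) ⊎ Stay s K es)

  Run : List State → (List Env → Set) → List Env → Set
  Run []      K = K
  Run (s ∷ σ) K = Stay s (Run σ K)

  stay-map : ∀ {s K L} → (∀ e es → proj₁ e s → K (e ∷ es) → L (e ∷ es)) → ∀ es → Stay s K es → Stay s L es
  stay-map f (e ∷ es) (p , inj₁ k) = p , inj₁ (f e es p k)
  stay-map f (e ∷ es) (p , inj₂ r) = p , inj₂ (stay-map f es r)

  run-map : ∀ σ {K L} → (∀ es → K es → L es) → ∀ es → Run σ K es → Run σ L es
  run-map []      f = f
  run-map (s ∷ σ) f = stay-map λ e es _ → run-map σ f (e ∷ es)

  run-++ : ∀ σ τ K → Run (σ ++ τ) K ≡ Run σ (Run τ K)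
  run-++ []      τ K = refl
  run-++ (s ∷ σ) τ K = cong (Stay s) (run-++ σ τ K)

  infix 4 _≃_

  -- Quantifying over every continuation `K`, and not only over the end of the walk, is what makes
  -- this a congruence for concatenation.
  record _≃_ (σ τ : List State) : Set₁ where
    constructor equiv
    field
      to   : ∀ K es → Run σ K es → Run τ K es
      from : ∀ K es → Run τ K es → Run σ K es
  open _≃_ public

  ≃-refl : ∀ {σ} → σ ≃ σ
  ≃-refl = equiv (λ _ _ r → r) (λ _ _ r → r)

  ≃-trans : ∀ {σ τ υ} → σ ≃ τ → τ ≃ υ → σ ≃ υ
  ≃-trans p q = equiv (λ K es r → to q K es (to p K es r)) (λ K es r → from p K es (from q K es r))

  ≃-++ : ∀ {σ σ′ τ τ′} → σ ≃ σ′ → τ ≃ τ′ → σ ++ τ ≃ σ′ ++ τ′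
  ≃-++ {σ} {σ′} {τ} {τ′} p q = equiv
    (λ K es r → subst (λ P → P es) (sym (run-++ σ′ τ′ K))
      (to p _ es (run-map σ (to q K) es (subst (λ P → P es) (run-++ σ τ K) r))))
    (λ K es r → subst (λ P → P es) (sym (run-++ σ τ K))
      (from p _ es (run-map σ′ (from q K) es (subst (λ P → P es) (run-++ σ′ τ′ K) r))))

  ≃-resp : ∀ {σ σ′ τ τ′} → σ ≡ σ′ → τ ≡ τ′ → σ′ ≃ τ′ → σ ≃ τ
  ≃-resp refl refl p = p

  stay-merge : ∀ {s K} es → Stay s (Stay s K) es → Stay s K es
  stay-merge (e ∷ es) (p , inj₁ r) = r
  stay-merge (e ∷ es) (p , inj₂ r) = p , inj₂ (stay-merge es r)

  stay-swap : ∀ {s t K} → s ⊑ t → ∀ es → Stay t K es → Stay s K es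
  stay-swap s⊑t (e ∷ es) (p , inj₁ k) = proj₂ e s⊑t p , inj₁ k
  stay-swap s⊑t (e ∷ es) (p , inj₂ r) = proj₂ e s⊑t p , inj₂ (stay-swap s⊑t es r)

  run-through : ∀ {a} μ {K} e es → All (_⊑ a) μ → proj₁ e a → K (e ∷ es) → Run μ K (e ∷ es)
  run-through []      e es _         p k = k
  run-through (m ∷ μ) e es (q ∷ qs) p k = proj₂ e q p , inj₁ (run-through μ e es qs p k)

  absorb-low : ∀ {a b} μ {K} → a ⊑ b → All (a ⊑_) μ → ∀ es → Run μ (Stay b K) es → Stay a (Stay b K) es
  absorb-low []      a⊑b _ (e ∷ es) r = proj₂ e a⊑b (proj₁ r) , inj₁ r
  absorb-low (m ∷ μ) a⊑b (q ∷ qs) es r =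
    stay-merge es (stay-map (λ e es _ → absorb-low μ a⊑b qs (e ∷ es)) es (stay-swap q es r))

  absorb-high : ∀ {b} μ {K} → All (b ⊑_) μ → ∀ es → Run μ (Stay b K) es → Stay b K es
  absorb-high []      _ es r = r
  absorb-high (m ∷ μ) (q ∷ qs) es r =
    stay-merge es (stay-map (λ e es _ → absorb-high μ qs (e ∷ es)) es (stay-swap q es r))

  -- One way, every environment met at a letter of `μ` also accepts the smaller `a`, so the walk
  -- waits at `a` instead. Back, the environment in which the walk enters `b` accepts all of `μ`,
  -- which is passed there in one go.
  collapse-up : ∀ {a b} μ → a ⊑ b → All (a ⊑_) μ → All (_⊑ b) μ → (a ∷ μ ++ [ b ]) ≃ (a ∷ b ∷ [])
  collapse-up {a} {b} μ a⊑b lo hi = equiv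
    (λ K es r → stay-merge es (stay-map (λ e es _ r → absorb-low μ a⊑b lo (e ∷ es) (subst (λ P → P (e ∷ es)) (run-++ μ [ b ] K) r)) es r))
    (λ K es r → stay-map (λ e es _ r → subst (λ P → P (e ∷ es)) (sym (run-++ μ [ b ] K)) (run-through μ e es hi (proj₁ r) r)) es r)

  -- The mirror image: the waiting moves to the final letter `b`, the smallest one, and `μ` is
  -- passed in the last environment spent at `a`.
  collapse-down : ∀ {a b} μ → All (b ⊑_) μ → All (_⊑ a) μ → (a ∷ μ ++ [ b ]) ≃ (a ∷ b ∷ [])
  collapse-down {a} {b} μ lo hi = equiv
    (λ K es r → stay-map (λ e es _ r → absorb-high μ lo (e ∷ es) (subst (λ P → P (e ∷ es)) (run-++ μ [ b ] K) r)) es r)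
    (λ K es r → stay-map (λ e es p r → subst (λ P → P (e ∷ es)) (sym (run-++ μ [ b ] K)) (run-through μ e es hi p r)) es r)

  split-first : ∀ h ns → All (_< suc h) ns →
    All (_< h) ns ⊎ (∃[ xs ] ∃[ ys ] (ns ≡ xs ++ h ∷ ys × All (_< h) xs × All (_< suc h) ys))
  split-first h [] [] = inj₁ []
  split-first h (n ∷ ns) (s≤s n≤h ∷ ps) with n ℕ.≟ h
  ... | yes refl = inj₂ ([] , ns , refl , [] , ps)
  ... | no n≢h with split-first h ns ps
  ...   | inj₁ qs = inj₁ (ℕₚ.≤∧≢⇒< n≤h n≢h ∷ qs)
  ...   | inj₂ (xs , ys , refl , qs , rs) = inj₂ (n ∷ xs , ys , refl , ℕₚ.≤∧≢⇒< n≤h n≢h ∷ qs , rs)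

  split-last : ∀ h ns → All (_< suc h) ns →
    All (_< h) ns ⊎ (∃[ xs ] ∃[ ys ] (ns ≡ xs ++ h ∷ ys × All (_< suc h) xs × All (_< h) ys))
  split-last h [] [] = inj₁ []
  split-last h (n ∷ ns) (s≤s n≤h ∷ ps) with split-last h ns ps
  ... | inj₂ (xs , ys , refl , qs , rs) = inj₂ (n ∷ xs , ys , refl , s≤s n≤h ∷ qs , rs)
  ... | inj₁ qs with n ℕ.≟ h
  ...   | yes refl = inj₂ ([] , ns , refl , [] , qs)
  ...   | no n≢h = inj₁ (ℕₚ.≤∧≢⇒< n≤h n≢h ∷ qs)

  split-min : ∀ n ns → ∃[ xs ] ∃[ m ] ∃[ ys ] (n ∷ ns ≡ xs ++ m ∷ ys × All (m ≤_) xs × All (m ≤_) ys)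
  split-min n [] = [] , n , [] , refl , [] , []
  split-min n (n′ ∷ ns) with split-min n′ ns
  ... | xs , m , ys , eq , ps , qs with ℕₚ.≤-total m n
  ...   | inj₁ m≤n = n ∷ xs , m , ys , cong (n ∷_) eq , m≤n ∷ ps , qs
  ...   | inj₂ n≤m = [] , n , n′ ∷ ns , refl , [] ,
          subst (All (n ≤_)) (sym eq) (Allₚ.++⁺ (All.map (ℕₚ.≤-trans n≤m) ps) (n≤m ∷ All.map (ℕₚ.≤-trans n≤m) qs))

  block : Color → List ℕ → List State
  block c = map (c ,_)

  block-All : ∀ {c} {P : State → Set} {Q : ℕ → Set} → (∀ {n} → Q n → P (c , n)) → ∀ {ns} → All Q ns → All P (block c ns)
  block-All f []       = []
  block-All f (q ∷ qs) = f q ∷ block-All f qs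

  -- Two outer parts below the maximum surround a core of at most three letters.
  blockBound : ℕ → ℕ
  blockBound zero    = 0
  blockBound (suc h) = 3 + (blockBound h + blockBound h)

  -- A word h z₁ m z₂ h with minimum m collapses to h m h, first down to m and then up again.
  core-shorten : ∀ c h zs → All (_< suc h) zs →
    ∃[ ms ] (length ms ≤ 1 × All (_< suc h) ms × (block c (h ∷ zs ++ [ h ])) ≃ block c (h ∷ ms ++ [ h ]))
  core-shorten c h [] [] = [] , z≤n , [] , ≃-refl
  core-shorten c h (z ∷ zs) ps with split-min z zs
  ... | xs , m , ys , eq , lo₁ , lo₂ = [ m ] , s≤s z≤n , (m<h ∷ []) ,
      subst (λ l → block c (h ∷ l ++ [ h ]) ≃ block c (h ∷ m ∷ h ∷ [])) (sym eq)
        (subst (_≃ block c (h ∷ m ∷ h ∷ [])) rearr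
          (≃-trans
            (≃-++ down (≃-refl))
            (≃-++ {block c [ h ]} {block c [ h ]} (≃-refl) up)))
    where
    ps′ : All (_< suc h) (xs ++ m ∷ ys)
    ps′ = subst (All (_< suc h)) eq ps
    m<h : m < suc h
    m<h = All.head (Allₚ.++⁻ʳ xs ps′)
    rearr : block c (h ∷ xs ++ [ m ]) ++ block c (ys ++ [ h ]) ≡ block c (h ∷ (xs ++ m ∷ ys) ++ [ h ])
    rearr = trans (sym (map-++ (c ,_) (h ∷ xs ++ [ m ]) (ys ++ [ h ])))
              (cong (λ l → block c (h ∷ l))
                (trans (++-assoc xs [ m ] (ys ++ [ h ])) (sym (++-assoc xs (m ∷ ys) [ h ]))))
    high : ∀ {ns} → All (_< suc h) ns → All (_⊑ (c , h)) (block c ns)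
    high = block-All λ { (s≤s p) → refl , p }
    low : ∀ {ns} → All (m ≤_) ns → All ((c , m) ⊑_) (block c ns)
    low = block-All λ p → refl , p
    down : block c (h ∷ xs ++ [ m ]) ≃ block c (h ∷ m ∷ [])
    down = subst (λ l → ((c , h) ∷ l) ≃ block c (h ∷ m ∷ [])) (sym (map-++ (c ,_) xs [ m ]))
             (collapse-down (block c xs) (low lo₁) (high (Allₚ.++⁻ˡ xs ps′)))
    up : block c (m ∷ ys ++ [ h ]) ≃ block c (m ∷ h ∷ [])
    up = subst (λ l → ((c , m) ∷ l) ≃ block c (m ∷ h ∷ [])) (sym (map-++ (c ,_) ys [ h ]))
           (collapse-up (block c ys) (refl , ℕ.s≤s⁻¹ m<h) (low lo₂) (high (All.tail (Allₚ.++⁻ʳ xs ps′))))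

  -- Cut at the first and the last occurrence of the largest value `h`. The outer parts stay below
  -- `h` and fall to the induction; the part between the two occurrences is the core.
  block-shorten : ∀ c h ns → All (_< h) ns →
    ∃[ ms ] (length ms ≤ blockBound h × All (_< h) ms × block c ns ≃ block c ms)
  block-shorten c zero [] ps = [] , z≤n , [] , ≃-refl
  block-shorten c zero (_ ∷ _) (() ∷ _)
  block-shorten c (suc h) ns ps with split-first h ns ps
  ... | inj₁ qs = let ms , l , rs , eq = block-shorten c h ns qs in
        ms , ℕₚ.≤-trans l (ℕₚ.≤-trans (ℕₚ.m≤m+n _ _) (ℕₚ.m≤n+m _ 3)) , All.map ℕₚ.m<n⇒m<1+n rs , eq
  ... | inj₂ (xs , ys , refl , qs , rs) with split-last h ys rs | block-shorten c h xs qs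
  ...   | inj₁ us | xs′ , l₁ , ps₁ , eq₁ = let ys′ , l₂ , ps₂ , eq₂ = block-shorten c h ys us in
          xs′ ++ h ∷ ys′ ,
          ℕₚ.≤-trans (ℕₚ.≤-reflexive (trans (length-++ xs′) (ℕₚ.+-suc _ _)))
            (ℕₚ.≤-trans (s≤s (ℕₚ.+-mono-≤ l₁ l₂)) (ℕₚ.m≤n+m _ 2)) ,
          Allₚ.++⁺ (All.map ℕₚ.m<n⇒m<1+n ps₁) (ℕₚ.≤-refl ∷ All.map ℕₚ.m<n⇒m<1+n ps₂) ,
          ≃-resp (map-++ (c ,_) xs (h ∷ ys)) (map-++ (c ,_) xs′ (h ∷ ys′))
            (≃-++ eq₁
              (≃-++ (≃-refl) eq₂))
  ...   | inj₂ (zs , vs , refl , us , ws) | xs′ , l₁ , ps₁ , eq₁ =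
          let vs′ , l₂ , ps₂ , eq₂ = block-shorten c h vs ws
              ms , l₃ , ps₃ , eq₃ = core-shorten c h zs us in
          xs′ ++ (h ∷ ms ++ [ h ]) ++ vs′ ,
          (begin
            length (xs′ ++ (h ∷ ms ++ [ h ]) ++ vs′) ≡⟨ length-++ xs′ ⟩
            length xs′ + length ((h ∷ ms ++ [ h ]) ++ vs′) ≡⟨ cong (length xs′ +_) (length-++ (h ∷ ms ++ [ h ])) ⟩
            length xs′ + (suc (length (ms ++ [ h ])) + length vs′) ≡⟨ cong (λ k → length xs′ + (suc k + length vs′)) (length-++ ms) ⟩
            length xs′ + (suc (length ms + 1) + length vs′) ≤⟨ ℕₚ.+-mono-≤ l₁ (ℕₚ.+-mono-≤ (s≤s (ℕₚ.+-monoˡ-≤ 1 l₃)) l₂) ⟩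
            blockBound h + (3 + blockBound h) ≡⟨ ℕₚ.+-comm (blockBound h) _ ⟩
            3 + (blockBound h + blockBound h) ∎) ,
          Allₚ.++⁺ (All.map ℕₚ.m<n⇒m<1+n ps₁)
            (Allₚ.++⁺ {xs = h ∷ ms ++ [ h ]} (ℕₚ.≤-refl ∷ Allₚ.++⁺ ps₃ (ℕₚ.≤-refl ∷ [])) (All.map ℕₚ.m<n⇒m<1+n ps₂)) ,
          ≃-resp (trans (cong (block c) (cong (xs ++_) (sym (cong (h ∷_) (++-assoc zs [ h ] vs)))))
                    (trans (map-++ (c ,_) xs ((h ∷ zs ++ [ h ]) ++ vs)) (cong (block c xs ++_) (map-++ (c ,_) (h ∷ zs ++ [ h ]) vs))))
                  (trans (map-++ (c ,_) xs′ ((h ∷ ms ++ [ h ]) ++ vs′)) (cong (block c xs′ ++_) (map-++ (c ,_) (h ∷ ms ++ [ h ]) vs′)))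
            (≃-++ eq₁
              (≃-++ eq₃ eq₂))
    where
    open ℕₚ.≤-Reasoning

  module Chains (μ : Color → ℕ) where

    _⊲_ : State → State → Set
    (c , _) ⊲ (d , _) = c ≡ d ⊎ μ c < μ d

    split-color : ∀ c σ → AllPairs _⊲_ σ → All ((c , 0) ⊲_) σ →
      ∃[ ns ] ∃[ τ ] (σ ≡ block c ns ++ τ × AllPairs _⊲_ τ × All (λ s → μ c < μ (proj₁ s)) τ)
    split-color c [] [] [] = [] , [] , refl , [] , []
    split-color c ((d , n) ∷ σ) (p ∷ ps) (q ∷ qs) with c ≟ᶜ d
    ... | yes refl = let ns , τ , eq , rs , ts = split-color c σ ps qs in n ∷ ns , τ , cong ((c , n) ∷_) eq , rs , ts
    ... | no c≢d = [] , (d , n) ∷ σ , refl , (p ∷ ps) , lt {n} q ∷ All.map (λ {s} → after {s}) p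
      where
      lt : ∀ {n} → (c , 0) ⊲ (d , n) → μ c < μ d
      lt (inj₁ c≡d) = Empty-elim (c≢d c≡d)
      lt (inj₂ l)   = l
      after : ∀ {s} → (d , n) ⊲ s → μ c < μ (proj₁ s)
      after (inj₁ refl) = lt {n} q
      after (inj₂ l)    = ℕₚ.<-trans (lt {n} q) l

    Small : ℕ → State → Set
    Small h (_ , n) = n < h

    -- `k` counts the values of `μ` still available below `top`. Each leading block of one colour is
    -- shortened on its own and uses up at least one value, since `μ` increases strictly at every
    -- change of colour.
    shorten-above : ∀ k h top σ → AllPairs _⊲_ σ → All (λ s → μ (proj₁ s) < top × top ≤ μ (proj₁ s) + k) σ → All (Small h) σ →
      ∃[ τ ] (length τ ≤ k * blockBound h × All (Small h) τ × σ ≃ τ)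
    shorten-above k h top [] _ _ _ = [] , z≤n , [] , ≃-refl
    shorten-above zero h top ((c , n) ∷ σ) _ ((p , q) ∷ _) _ =
      Empty-elim (ℕₚ.<⇒≱ p (ℕₚ.≤-trans q (ℕₚ.≤-reflexive (ℕₚ.+-identityʳ _))))
    shorten-above (suc k) h top ((c , n) ∷ σ) (r ∷ rs) ((p , q) ∷ qs) small
      with split-color c ((c , n) ∷ σ) (r ∷ rs) (inj₁ refl ∷ All.map (λ x → x) r)
    ... | ns , τ , eq , ts , us =
      let small′ = subst (All (Small h)) eq small
          ms , l₁ , ps₁ , eq₁ = block-shorten c h ns (unblock (Allₚ.++⁻ˡ (block c ns) small′))
          υ , l₂ , ps₂ , eq₂ = shorten-above k h top τ ts
             (All.zipWith (λ (x , (y , _)) → y ,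
                ℕₚ.≤-trans q (ℕₚ.≤-trans (ℕₚ.≤-reflexive (ℕₚ.+-suc _ k)) (ℕₚ.+-monoˡ-≤ k x)))
               (us , Allₚ.++⁻ʳ (block c ns) (subst (All _) eq ((p , q) ∷ qs))))
             (Allₚ.++⁻ʳ (block c ns) small′) in
      block c ms ++ υ ,
      ℕₚ.≤-trans (ℕₚ.≤-reflexive (trans (length-++ (block c ms)) (cong (_+ length υ) (length-map (c ,_) ms)))) (ℕₚ.+-mono-≤ l₁ l₂) ,
      Allₚ.++⁺ (block-All (λ x → x) ps₁) ps₂ ,
      subst (_≃ (block c ms ++ υ)) (sym eq) (≃-++ eq₁ eq₂)
      where
      unblock : ∀ {ns} → All (Small h) (block c ns) → All (_< h) ns
      unblock {[]} [] = []
      unblock {_ ∷ _} (p ∷ ps) = p ∷ unblock ps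

    shorten : ∀ h top σ → AllPairs _⊲_ σ → All (λ s → μ (proj₁ s) < top) σ → All (Small h) σ →
      ∃[ τ ] (length τ ≤ top * blockBound h × All (Small h) τ × σ ≃ τ)
    shorten h top σ rs ps = shorten-above top h top σ rs (All.map (λ p → p , ℕₚ.m≤n+m top _) ps)

-- Linear algebra over a finite field: spans, ranks, quotients, intersections

module LinearAlgebra {c ℓ} (F : FiniteField c ℓ) where

  module Identities where
    open FiniteField F
    open import Algebra.Solver.Ring.NaturalCoefficients.Default commutativeSemiring

    comb-comb : ∀ a c x u d v → a * (c * x + u) + (d * x + v) ≈ (a * c + d) * x + (a * u + v)
    comb-comb = solve 6 (λ a c x u d v → a :* (c :* x :+ u) :+ (d :* x :+ v) := (a :* c :+ d) :* x :+ (a :* u :+ v)) refl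

    collect : ∀ d c x u → d * x + (c * x + u) ≈ (d + c) * x + u
    collect = solve 4 (λ d c x u → d :* x :+ (c :* x :+ u) := (d :+ c) :* x :+ u) refl

    expand : ∀ d c x u e → d * (c * x + u) + e * u ≈ (c * d) * x + (d + e) * u
    expand = solve 5 (λ d c x u e → d :* (c :* x :+ u) :+ e :* u := (c :* d) :* x :+ (d :+ e) :* u) refl

    dist-prod : ∀ a u x v → (a * u + v) * x ≈ a * (u * x) + v * x
    dist-prod = solve 4 (λ a u x v → (a :* u :+ v) :* x := a :* (u :* x) :+ v :* x) refl

    prod-dist : ∀ a u x v → x * (a * u + v) ≈ a * (x * u) + x * v
    prod-dist = solve 4 (λ a u x v → x :* (a :* u :+ v) := a :* (x :* u) :+ x :* v) refl

    interchange : ∀ a x y X Y → (a * x + y) + (a * X + Y) ≈ a * (x + X) + (y + Y)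
    interchange = solve 5 (λ a x y X Y → (a :* x :+ y) :+ (a :* X :+ Y) := a :* (x :+ X) :+ (y :+ Y)) refl

    rotate : ∀ a b c → a * b * c ≈ c * b * a
    rotate = solve 3 (λ a b c → a :* b :* c := c :* b :* a) refl

  open FiniteField F hiding (zero)
  open import Algebra.Properties.Ring ring using (-‿distribˡ-*; -‿involutive; -0#≈0#)
  import Relation.Binary.Reasoning.Setoid as SetoidReasoning
  module ≈R = SetoidReasoning setoid
  open Identities

  V : ℕ → Set c
  V m = Fin m → Carrier

  private variable
    m n : ℕ
    x y v u : V m
    xs ys zs us : List (V m)

  ∑-cong : ∀ {k} {f g : Fin k → Carrier} → (∀ i → f i ≈ g i) → ∑ F f ≈ ∑ F g
  ∑-cong {zero}  h = refl
  ∑-cong {suc k} h = +-cong (h zero) (∑-cong λ i → h (suc i))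

  ∑-zero : ∀ {k} {f : Fin k → Carrier} → (∀ i → f i ≈ 0#) → ∑ F f ≈ 0#
  ∑-zero {zero}  h = refl
  ∑-zero {suc k} h = trans (+-cong (h zero) (∑-zero λ i → h (suc i))) (+-identityˡ 0#)

  ∑-comb : ∀ {k} a {f g h : Fin k → Carrier} → (∀ i → h i ≈ a * f i + g i) → ∑ F h ≈ a * ∑ F f + ∑ F g
  ∑-comb {zero}  a e = sym (trans (+-identityʳ _) (zeroʳ a))
  ∑-comb {suc k} a e = trans (+-cong (e zero) (∑-comb a λ i → e (suc i))) (interchange a _ _ _ _)

  δ : ∀ {k} → Fin k → Fin k → Carrier
  δ zero    zero    = 1#
  δ zero    (suc j) = 0#
  δ (suc i) zero    = 0#
  δ (suc i) (suc j) = δ i j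

  ∑-δ : ∀ {k} (i : Fin k) (f : Fin k → Carrier) → ∑ F (λ j → δ i j * f j) ≈ f i
  ∑-δ zero    f = trans (+-cong (*-identityˡ _) (∑-zero λ j → zeroˡ (f (suc j)))) (+-identityʳ _)
  ∑-δ (suc i) f = trans (+-cong (zeroˡ _) (∑-δ i λ j → f (suc j))) (+-identityˡ _)

  data Span {m} : List (V m) → V m → Set (c ⊔ ℓ) where
    nil  : ∀ {v} → (∀ i → v i ≈ 0#) → Span [] v
    cons : ∀ {x xs u v} a → Span xs u → (∀ i → v i ≈ a * x i + u i) → Span (x ∷ xs) v

  span-resp : (∀ i → u i ≈ v i) → Span xs u → Span xs v
  span-resp e (nil h)      = nil λ i → trans (sym (e i)) (h i)
  span-resp e (cons a p h) = cons a p λ i → trans (sym (e i)) (h i)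

  span-weaken : Span xs v → Span (x ∷ xs) v
  span-weaken p = cons 0# p λ i → sym (trans (+-congʳ (zeroˡ _)) (+-identityˡ _))

  span-zero : ∀ xs → (∀ i → v i ≈ 0#) → Span xs v
  span-zero []       h = nil h
  span-zero (x ∷ xs) h = span-weaken (span-zero xs h)

  span-comb : ∀ a → Span xs u → Span xs v → (∀ i → y i ≈ a * u i + v i) → Span xs y
  span-comb a (nil p) (nil q) e =
    nil λ i → trans (e i) (trans (+-cong (trans (*-congˡ (p i)) (zeroʳ a)) (q i)) (+-identityˡ 0#))
  span-comb a (cons b p g) (cons d q h) e = cons (a * b + d) (span-comb a p q λ i → refl)
    λ i → trans (e i) (trans (+-cong (*-congˡ (g i)) (h i)) (comb-comb a b _ _ d _))

  span-scale : ∀ a → Span xs u → (∀ i → y i ≈ a * u i) → Span xs y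
  span-scale {xs = xs} a p e = span-comb {v = λ _ → 0#} a p (span-zero xs λ i → refl) λ i → trans (e i) (sym (+-identityʳ _))

  span-head : ∀ (x : V m) xs → Span (x ∷ xs) x
  span-head x xs = cons {u = λ _ → 0#} 1# (span-zero xs λ i → refl) λ i → sym (trans (+-identityʳ _) (*-identityˡ _))

  span-elem : x Mem.∈ xs → Span xs x
  span-elem {xs = x ∷ xs} (here ≡.refl) = span-head x xs
  span-elem {xs = x ∷ xs} (there p)     = span-weaken (span-elem p)

  span-trans : All (Span ys) xs → Span xs v → Span ys v
  span-trans {ys = ys} [] (nil h)          = span-zero ys h
  span-trans (p ∷ ps)     (cons a q h) = span-comb a p (span-trans ps q) h

  span-all : (∀ {x} → x Mem.∈ xs → x Mem.∈ ys) → All (Span ys) xs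
  span-all f = All.tabulate λ p → span-elem (f p)

  span-refl : ∀ (xs : List (V m)) → All (Span xs) xs
  span-refl xs = span-all λ p → p

  span-mono : (∀ {x} → x Mem.∈ xs → x Mem.∈ ys) → Span xs v → Span ys v
  span-mono f = span-trans (span-all f)

  move : ∀ {a p q r} → p ≈ a * q + r → r ≈ - a * q + p
  move {a} {p} {q} {r} e = sym (begin
    - a * q + p             ≈⟨ +-congˡ e ⟩
    - a * q + (a * q + r)   ≈⟨ collect (- a) a q r ⟩
    (- a + a) * q + r       ≈⟨ +-congʳ (trans (*-congʳ (-‿inverseˡ a)) (zeroˡ q)) ⟩
    0# + r                  ≈⟨ +-identityˡ r ⟩
    r                       ∎)
    where open ≈R

  exchange : Span (y ∷ xs) x → ¬ Span xs x → Span (x ∷ xs) y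
  exchange {y = y} {x = x} (cons {u = u} a p h) ¬p with a ≟ 0#
  ... | yes a≈0 = Empty-elim (¬p (span-resp (λ i → sym (trans (h i) (trans (+-congʳ (trans (*-congʳ a≈0) (zeroˡ _))) (+-identityˡ _)))) p))
  ... | no a≉0 = cons d (span-scale (- d) p λ i → refl) λ i → sym (begin
          d * x i + - d * u i               ≈⟨ +-congʳ (*-congˡ (h i)) ⟩
          d * (a * y i + u i) + - d * u i   ≈⟨ expand d a (y i) (u i) (- d) ⟩
          (a * d) * y i + (d + - d) * u i   ≈⟨ +-cong (*-congʳ ad≈1) (trans (*-congʳ (-‿inverseʳ d)) (zeroˡ _)) ⟩
          1# * y i + 0#                     ≈⟨ trans (+-identityʳ _) (*-identityˡ _) ⟩
          y i                               ∎)
    where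
    open ≈R
    d : Carrier
    d = proj₁ (inverse a a≉0)
    ad≈1 : a * d ≈ 1#
    ad≈1 = proj₂ (inverse a a≉0)

  dot : V m → V m → Carrier
  dot u v = ∑ F λ i → u i * v i

  dot-combˡ : ∀ a (u v x : V m) {w} → (∀ i → w i ≈ a * u i + v i) → dot w x ≈ a * dot u x + dot v x
  dot-combˡ a u v x e = ∑-comb a λ i → trans (*-congʳ (e i)) (dist-prod a (u i) (x i) (v i))

  dot-combʳ : ∀ a (u v x : V m) {w} → (∀ i → w i ≈ a * u i + v i) → dot x w ≈ a * dot x u + dot x v
  dot-combʳ a u v x e = ∑-comb a λ i → trans (*-congˡ (e i)) (prod-dist a (u i) (x i) (v i))

  a*0+0 : ∀ {a p q} → p ≈ 0# → q ≈ 0# → a * p + q ≈ 0#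
  a*0+0 p≈0 q≈0 = trans (+-cong (trans (*-congˡ p≈0) (zeroʳ _)) q≈0) (+-identityˡ 0#)

  dot-span : All (λ x → dot u x ≈ 0#) xs → Span xs v → dot u v ≈ 0#
  dot-span []       (nil h)      = ∑-zero λ i → trans (*-congˡ (h i)) (zeroʳ _)
  dot-span {u = u} (p ∷ ps) (cons a q h) = trans (dot-combʳ a _ _ u h) (a*0+0 p (dot-span ps q))

  -- Duality in constructive form: failure to lie in the span is witnessed by a functional. It
  -- decides `Span`, and later shows that shortening a code contracts its matroid.
  separate : ∀ xs (v : V m) → Span xs v ⊎ (∃[ u ] (All (λ x → dot u x ≈ 0#) xs × ¬ (dot u v ≈ 0#)))
  separate [] v with Finₚ.all? (λ i → v i ≟ 0#)
  ... | yes h = inj₁ (nil h)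
  ... | no ¬h = let i , vi≉0 = Finₚ.¬∀⟶∃¬ _ _ (λ i → v i ≟ 0#) ¬h in
                inj₂ (δ i , [] , λ e → vi≉0 (trans (sym (∑-δ i v)) e))
  separate (x ∷ xs) v with separate xs v
  ... | inj₁ p = inj₁ (span-weaken p)
  ... | inj₂ (u , u⊥ , uv≉0) with dot u x ≟ 0#
  ...   | yes ux≈0 = inj₂ (u , ux≈0 ∷ u⊥ , uv≉0)
  ...   | no ux≉0 with inverse (dot u x) ux≉0
  -- The multiple of `x` added to `v` makes `u` vanish on the result, so a functional `u′`
  -- separating this vector from `xs` can be corrected by a multiple of `u` to kill `x` without
  -- changing its nonzero value.
  ...     | t , uxt≈1 with separate xs (λ i → - (dot u v * t) * x i + v i)
  ...       | inj₁ p = inj₁ (cons (dot u v * t) p λ i → trans (move refl) (+-congʳ (*-congʳ (-‿involutive _))))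
  ...       | inj₂ (u′ , u′⊥ , u′v′≉0) =
              inj₂ (u″ , u″x≈0 ∷ All.zipWith (λ { {z} (p , q) → trans (dot-combˡ (- β) u u′ z λ i → refl) (a*0+0 p q) }) (u⊥ , u′⊥) ,
                λ e → u′v′≉0 (trans (trans (dot-combʳ (- α) x v u′ λ i → refl)
                                (trans (+-congʳ α≈β) (sym (dot-combˡ (- β) u u′ v λ i → refl)))) e))
    where
    α β : Carrier
    α = dot u v * t
    β = dot u′ x * t
    u″ : V _
    u″ i = - β * u i + u′ i
    u″x≈0 : dot u″ x ≈ 0#
    u″x≈0 = let open ≈R in begin
      dot u″ x                                  ≈⟨ dot-combˡ (- β) u u′ x (λ i → refl) ⟩
      - β * dot u x + dot u′ x                  ≈⟨ +-congʳ (sym (-‿distribˡ-* β _)) ⟩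
      - (dot u′ x * t * dot u x) + dot u′ x     ≈⟨ +-congʳ (-‿cong (trans (*-assoc _ _ _) (trans (*-congˡ (trans (*-comm _ _) uxt≈1)) (*-identityʳ _)))) ⟩
      - dot u′ x + dot u′ x                     ≈⟨ -‿inverseˡ _ ⟩
      0#                                        ∎
    α≈β : - α * dot u′ x ≈ - β * dot u v
    α≈β = let open ≈R in begin
      - α * dot u′ x              ≈⟨ sym (-‿distribˡ-* α _) ⟩
      - (dot u v * t * dot u′ x)  ≈⟨ -‿cong (rotate (dot u v) t (dot u′ x)) ⟩
      - (dot u′ x * t * dot u v)  ≈⟨ -‿distribˡ-* β _ ⟩
      - β * dot u v               ∎

  Span? : ∀ xs (v : V m) → Dec (Span xs v)
  Span? xs v with separate xs v
  ... | inj₁ p              = yes p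
  ... | inj₂ (u , u⊥ , uv≉0) = no λ p → uv≉0 (dot-span u⊥ p)

  gain : List (V m) → V m → ℕ
  gain xs x = if does (Span? xs x) then 0 else 1

  -- Greedy rank: an entry counts when it is new to the span of the entries after it. Independence
  -- of the order is `rk-↭`, which rests on Steinitz exchange through `rk-swap`.
  rk : List (V m) → ℕ
  rk []       = 0
  rk (x ∷ xs) = gain xs x ℕ.+ rk xs

  gain-in : Span xs x → gain xs x ≡ 0
  gain-in {xs = xs} {x} p with Span? xs x
  ... | yes _ = ≡.refl
  ... | no ¬p = Empty-elim (¬p p)

  gain-out : ¬ Span xs x → gain xs x ≡ 1
  gain-out {xs = xs} {x} ¬p with Span? xs x
  ... | yes p = Empty-elim (¬p p)
  ... | no _  = ≡.refl

  gain-≤ : ∀ {xs : List (V m)} {x} {ys : List (V n)} {y} → (Span xs x → Span ys y) → gain ys y ≤ gain xs x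
  gain-≤ {xs = xs} {x} {ys} {y} f with Span? xs x | Span? ys y
  ... | yes p | yes q = z≤n
  ... | yes p | no ¬q = Empty-elim (¬q (f p))
  ... | no ¬p | yes q = z≤n
  ... | no ¬p | no ¬q = s≤s z≤n

  gain-≡ : ∀ {xs : List (V m)} {x} {ys : List (V n)} {y} → (Span xs x → Span ys y) → (Span ys y → Span xs x) → gain xs x ≡ gain ys y
  gain-≡ {xs = xs} {x} {ys} {y} f g = ℕₚ.≤-antisym (gain-≤ {xs = ys} {y} {xs} {x} g) (gain-≤ {xs = xs} {x} {ys} {y} f)

  rk-swap : ∀ x y (xs : List (V m)) → rk (x ∷ y ∷ xs) ≡ rk (y ∷ x ∷ xs)
  rk-swap x y xs with Span? xs x | Span? xs y
  ... | yes p | yes q = cong (ℕ._+ rk xs) (≡.trans (gain-in {xs = y ∷ xs} (span-weaken p)) (≡.sym (gain-in {xs = x ∷ xs} (span-weaken q))))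
  ... | yes p | no ¬q = ≡.trans (cong (ℕ._+ suc (rk xs)) (gain-in {xs = y ∷ xs} (span-weaken p)))
                          (cong (ℕ._+ rk xs) (≡.sym (gain-out {xs = x ∷ xs} λ q → ¬q (span-trans (p ∷ span-refl xs) q))))
  ... | no ¬p | yes q = ≡.trans (cong (ℕ._+ rk xs) (gain-out {xs = y ∷ xs} λ p → ¬p (span-trans (q ∷ span-refl xs) p)))
                          (cong (ℕ._+ suc (rk xs)) (≡.sym (gain-in {xs = x ∷ xs} (span-weaken q))))
  ... | no ¬p | no ¬q = cong (ℕ._+ suc (rk xs)) (gain-≡ {xs = y ∷ xs} {x} {x ∷ xs} {y} (λ p → exchange p ¬p) (λ q → exchange q ¬q))

  rk-cons-↭ : ∀ x → xs ↭ ys → rk xs ≡ rk ys → rk (x ∷ xs) ≡ rk (x ∷ ys)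
  rk-cons-↭ {xs = xs} {ys} x p e = cong₂ ℕ._+_ (gain-≡ {xs = xs} {x} {ys} {x} (span-mono (∈-resp-↭ p)) (span-mono (∈-resp-↭ (↭-sym p)))) e

  rk-↭ : xs ↭ ys → rk xs ≡ rk ys
  rk-↭ _↭_.refl = ≡.refl
  rk-↭ (_↭_.prep x p) = rk-cons-↭ x p (rk-↭ p)
  rk-↭ (_↭_.swap {xs} x y p) = ≡.trans (rk-swap x y xs) (rk-cons-↭ y (_↭_.prep x p) (rk-cons-↭ x p (rk-↭ p)))
  rk-↭ (_↭_.trans p q) = ≡.trans (rk-↭ p) (rk-↭ q)

  rk-++-≤ : ∀ (xs ys : List (V m)) → rk ys ≤ rk (xs ++ ys)
  rk-++-≤ []       ys = ℕₚ.≤-refl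
  rk-++-≤ (x ∷ xs) ys = ℕₚ.≤-trans (rk-++-≤ xs ys) (ℕₚ.m≤n+m _ _)

  rk-absorb : ∀ xs → All (Span ys) xs → rk (xs ++ ys) ≡ rk ys
  rk-absorb []       []       = ≡.refl
  rk-absorb {ys = ys} (x ∷ xs) (p ∷ ps) = cong₂ ℕ._+_ (gain-in {xs = xs ++ ys} (span-mono (Memₚ.∈-++⁺ʳ xs) p)) (rk-absorb xs ps)

  rk-mono : All (Span ys) xs → rk xs ≤ rk ys
  rk-mono {ys = ys} {xs} ps = ℕₚ.≤-trans (rk-++-≤ ys xs)
    (ℕₚ.≤-reflexive (≡.trans (rk-↭ (++-comm ys xs)) (rk-absorb xs ps)))

  rk-≡ : All (Span ys) xs → All (Span xs) ys → rk xs ≡ rk ys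
  rk-≡ ps qs = ℕₚ.≤-antisym (rk-mono ps) (rk-mono qs)

  -- Submodularity as diminishing returns: each vector of `us` that is new over the larger span is
  -- also new over the smaller one.
  rk-gain-mono : ∀ us → All (Span ys) zs → rk (us ++ ys) ℕ.+ rk zs ≤ rk (us ++ zs) ℕ.+ rk ys
  rk-gain-mono {ys = ys} {zs} [] _ = ℕₚ.≤-reflexive (ℕₚ.+-comm (rk ys) (rk zs))
  rk-gain-mono {ys = ys} {zs} (u ∷ us) ps = ℕₚ.≤-trans (ℕₚ.≤-reflexive (ℕₚ.+-assoc (gain (us ++ ys) u) _ _))
    (ℕₚ.≤-trans (ℕₚ.+-mono-≤ (gain-≤ {xs = us ++ zs} {u} {us ++ ys} {u} (span-trans (Allₚ.++⁺ (span-all (Memₚ.∈-++⁺ˡ)) (All.map (span-mono (Memₚ.∈-++⁺ʳ us)) ps)))) (rk-gain-mono us ps))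
      (ℕₚ.≤-reflexive (≡.sym (ℕₚ.+-assoc (gain (us ++ zs) u) _ _))))

  rk-submod : ∀ us zs (xs ys : List (V m)) → All (Span (xs ++ ys)) us → All (Span xs) zs → All (Span ys) zs →
    rk us ℕ.+ rk zs ≤ rk xs ℕ.+ rk ys
  rk-submod us zs xs ys ps qs rs = ℕₚ.≤-trans (ℕₚ.+-monoˡ-≤ (rk zs) (rk-mono ps))
    (ℕₚ.≤-trans (rk-gain-mono xs rs) (ℕₚ.+-monoˡ-≤ (rk ys) (rk-mono (Allₚ.++⁺ (span-refl xs) qs))))

  -- If every entry of `us` is new over `xs` exactly when it is new over `ys`, then `us` adds the
  -- same rank to both; the equation is written without subtraction.
  rk-same-gain : ∀ {xs ys : List (V m)} us →
    (∀ ws w → (∀ {x} → x Mem.∈ (w ∷ ws) → x Mem.∈ us) → (Span (ws ++ xs) w → Span (ws ++ ys) w) × (Span (ws ++ ys) w → Span (ws ++ xs) w)) →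
    rk (us ++ xs) ℕ.+ rk ys ≡ rk (us ++ ys) ℕ.+ rk xs
  rk-same-gain {xs = xs} {ys} [] f = ℕₚ.+-comm (rk xs) _
  rk-same-gain {xs = xs} {ys} (u ∷ us) f = begin
    gain (us ++ xs) u ℕ.+ rk (us ++ xs) ℕ.+ rk ys   ≡⟨ ℕₚ.+-assoc (gain (us ++ xs) u) _ _ ⟩
    gain (us ++ xs) u ℕ.+ (rk (us ++ xs) ℕ.+ rk ys) ≡⟨ cong₂ ℕ._+_ (gain-≡ {xs = us ++ xs} {u} {us ++ ys} {u} (proj₁ (f us u λ p → p)) (proj₂ (f us u λ p → p)))
                                                      (rk-same-gain us λ ws w g → f ws w λ p → there (g p)) ⟩
    gain (us ++ ys) u ℕ.+ (rk (us ++ ys) ℕ.+ rk xs) ≡⟨ ≡.sym (ℕₚ.+-assoc (gain (us ++ ys) u) _ _) ⟩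
    gain (us ++ ys) u ℕ.+ rk (us ++ ys) ℕ.+ rk xs   ∎
    where open ≡.≡-Reasoning

  LI : List (V m) → Set (c ⊔ ℓ)
  LI []       = Unit
  LI (x ∷ xs) = ¬ Span xs x × LI xs

  rk-LI : ∀ xs → LI {m} xs → rk xs ≡ length xs
  rk-LI []       _        = ≡.refl
  rk-LI (x ∷ xs) (p , ps) = cong₂ ℕ._+_ (gain-out {xs = xs} p) (rk-LI xs ps)

  rk-≤-length : ∀ (xs : List (V m)) → rk xs ≤ length xs
  rk-≤-length [] = z≤n
  rk-≤-length (x ∷ xs) with Span? xs x
  ... | yes _ = ℕₚ.m≤n⇒m≤1+n (rk-≤-length xs)
  ... | no _  = s≤s (rk-≤-length xs)

  cols : (Fin n → V m) → Subset n → List (V m)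
  cols v []          = []
  cols v (true ∷ X)  = v zero ∷ cols (λ j → v (suc j)) X
  cols v (false ∷ X) = cols (λ j → v (suc j)) X

  cols-∈ : ∀ (v : Fin n → V m) {X j} → j ∈ X → v j Mem.∈ cols v X
  cols-∈ v {X = true ∷ X} here      = here ≡.refl
  cols-∈ v {X = true ∷ X} (there p) = there (cols-∈ (λ j → v (suc j)) p)
  cols-∈ v {X = false ∷ X} (there p) = cols-∈ (λ j → v (suc j)) p

  cols-All : ∀ {p} (v : Fin n → V m) X {P : V m → Set p} → (∀ j → j ∈ X → P (v j)) → All P (cols v X)
  cols-All v []          f = []
  cols-All v (true ∷ X)  f = f zero here ∷ cols-All (λ j → v (suc j)) X λ j p → f (suc j) (there p)
  cols-All v (false ∷ X) f = cols-All (λ j → v (suc j)) X λ j p → f (suc j) (there p)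

  cols-⊆ : ∀ (v : Fin n → V m) X Y → X ⊆ Y → All (Span (cols v Y)) (cols v X)
  cols-⊆ v X Y X⊆Y = cols-All v X λ j p → span-elem (cols-∈ v (X⊆Y p))

  span-⊆ : ∀ (v : Fin n → V m) X Y {u} → X ⊆ Y → Span (cols v X) u → Span (cols v Y) u
  span-⊆ v X Y X⊆Y = span-trans (cols-⊆ v X Y X⊆Y)

  length-cols : ∀ (v : Fin n → V m) X → length (cols v X) ≡ ∣ X ∣
  length-cols v []          = ≡.refl
  length-cols v (true ∷ X)  = cong suc (length-cols (λ j → v (suc j)) X)
  length-cols v (false ∷ X) = length-cols (λ j → v (suc j)) X

  sub∑ : (Fin n → V m) → Subset n → (Fin n → Carrier) → V m
  sub∑ v X a i = ∑ F λ j → if Vec.lookup X j then a j * v j i else 0#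

  Free : (Fin n → V m) → Subset n → Set _
  Free v Y = ∀ a → (∀ i → sub∑ v Y a i ≈ 0#) → ∀ j → j ∈ Y → a j ≈ 0#

  span⇒sub∑ : ∀ (v : Fin n → V m) X {u} → Span (cols v X) u → ∃[ a ] (∀ i → u i ≈ sub∑ v X a i)
  span⇒sub∑ v []          (nil h)      = (λ ()) , h
  span⇒sub∑ v (true ∷ X)  (cons b p h) = let a , e = span⇒sub∑ _ X p in
    (b Fun.∷ a) , λ i → trans (h i) (+-congˡ (e i))
  span⇒sub∑ v (false ∷ X) p            = let a , e = span⇒sub∑ _ X p in
    (0# Fun.∷ a) , λ i → trans (e i) (sym (+-identityˡ _))

  sub∑⇒span : ∀ (v : Fin n → V m) X a → Span (cols v X) (sub∑ v X a)
  sub∑⇒span v []          a = nil λ i → refl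
  sub∑⇒span v (true ∷ X)  a = cons (a zero) (sub∑⇒span _ X λ j → a (suc j)) λ i → refl
  sub∑⇒span v (false ∷ X) a = span-resp (λ i → sym (+-identityˡ _)) (sub∑⇒span _ X λ j → a (suc j))

  0*+ : ∀ {p} q → p ≈ 0# → 0# * q + p ≈ 0#
  0*+ q p≈0 = trans (+-cong (zeroˡ q) p≈0) (+-identityˡ 0#)

  free⇒LI : ∀ (v : Fin n → V m) Y → Free v Y → LI (cols v Y)
  free⇒LI v []          f = _
  free⇒LI v (true ∷ Y)  f =
    (λ p → let a , e = span⇒sub∑ _ Y p in
       1≉0 (trans (sym (-‿involutive 1#)) (trans (-‿cong (f ((- 1#) Fun.∷ a)
         (λ i → trans (+-congˡ (sym (e i))) (sym (move (sym (trans (+-identityʳ _) (*-identityˡ _))))))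
         zero here)) -0#≈0#))) ,
    free⇒LI _ Y λ a h j p → f (0# Fun.∷ a) (λ i → 0*+ (v zero i) (h i)) (suc j) (there p)
  free⇒LI v (false ∷ Y) f =
    free⇒LI _ Y λ a h j p → f (0# Fun.∷ a) (λ i → trans (+-identityˡ _) (h i)) (suc j) (there p)

  LI⇒free : ∀ (v : Fin n → V m) Y → LI (cols v Y) → Free v Y
  LI⇒free v (false ∷ Y) li a h (suc j) (there p) =
    LI⇒free _ Y li (λ j → a (suc j)) (λ i → trans (sym (+-identityˡ _)) (h i)) j p
  LI⇒free v (true ∷ Y) (¬p , li) a h with a zero ≟ 0#
  ... | yes a≈0 = λ where
    zero    here      → a≈0
    (suc j) (there p) → LI⇒free _ Y li (λ j → a (suc j))
      (λ i → trans (sym (trans (+-congʳ (trans (*-congʳ a≈0) (zeroˡ _))) (+-identityˡ _))) (h i)) j p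
  ... | no a≉0 = let d , ad≈1 = inverse (a zero) a≉0 in
    Empty-elim (¬p (span-scale (- d) (sub∑⇒span _ Y λ j → a (suc j)) λ i → move-inverse d ad≈1 (h i)))
    where
    open ≈R
    move-inverse : ∀ {a p q} d → a * d ≈ 1# → a * p + q ≈ 0# → p ≈ - d * q
    move-inverse {a} {p} {q} d ad≈1 e = begin
      p                         ≈⟨ sym (trans (+-identityʳ _) (*-identityˡ p)) ⟩
      1# * p + 0#               ≈⟨ +-cong (*-congʳ (sym ad≈1)) (sym (trans (*-congʳ (-‿inverseʳ d)) (zeroˡ q))) ⟩
      (a * d) * p + (d + - d) * q ≈⟨ sym (expand d a p q (- d)) ⟩
      d * (a * p + q) + - d * q ≈⟨ +-congʳ (trans (*-congˡ e) (zeroʳ d)) ⟩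
      0# + - d * q              ≈⟨ +-identityˡ _ ⟩
      - d * q                   ∎

  basis : ∀ (v : Fin n → V m) X → ∃[ Y ] (Y ⊆ X × LI (cols v Y) × All (Span (cols v Y)) (cols v X))
  basis v [] = [] , (λ ()) , _ , []
  basis v (false ∷ X) = let Y , Y⊆X , li , sp = basis (λ j → v (suc j)) X in
    false ∷ Y , (λ { (there p) → there (Y⊆X p) }) , li , sp
  basis v (true ∷ X) with basis (λ j → v (suc j)) X
  ... | Y , Y⊆X , li , sp with Span? (cols (λ j → v (suc j)) Y) (v zero)
  ...   | yes p = false ∷ Y , (λ { (there p) → there (Y⊆X p) }) , li , p ∷ sp
  ...   | no ¬p = true ∷ Y , (λ { here → here ; (there p) → there (Y⊆X p) }) , (¬p , li) , span-head _ _ ∷ All.map span-weaken sp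

  col : (Fin m → Fin n → Carrier) → Fin n → V m
  col A j i = A i j

  column-rank : ∀ (A : Fin m → Fin n → Carrier) X → IsColumnRank F A X (rk (cols (col A) X))
  column-rank A X = let Y , Y⊆X , li , sp = basis (col A) X in
    (Y , Y⊆X , LI⇒free (col A) Y li ,
      ≡.trans (≡.sym (≡.trans (rk-LI _ li) (length-cols (col A) Y))) (rk-≡ (cols-⊆ (col A) Y X Y⊆X) sp)) ,
    λ Z Z⊆X free → ℕₚ.≤-trans (ℕₚ.≤-reflexive (≡.sym (≡.trans (rk-LI _ (free⇒LI (col A) Z free)) (length-cols (col A) Z))))
                     (rk-mono (cols-⊆ (col A) Z X Z⊆X))

  column-rank-unique : ∀ (A : Fin m → Fin n → Carrier) X {r s} → IsColumnRank F A X r → IsColumnRank F A X s → r ≡ s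
  column-rank-unique A X ((Y , p , q , e) , f) ((Z , p′ , q′ , e′) , g) =
    ℕₚ.≤-antisym (subst (_≤ _) e (g Y p q)) (subst (_≤ _) e′ (f Z p′ q′))

  rank-cols : ∀ {A : Fin m → Fin n → Carrier} {M} → Represents F A M → ∀ X → rank M X ≡ rk (cols (col A) X)
  rank-cols {A = A} rep X = column-rank-unique A X (rep X) (column-rank A X)

  columnMatroid : (Fin m → Fin n → Carrier) → Matroid n
  columnMatroid A = record
    { rank        = λ X → rk (cols (col A) X)
    ; rank-bound  = λ X → ℕₚ.≤-trans (rk-≤-length (cols (col A) X)) (ℕₚ.≤-reflexive (length-cols (col A) X))
    ; rank-mono   = λ {X} {Y} X⊆Y → rk-mono (cols-⊆ (col A) X Y X⊆Y)
    ; rank-submod = λ X Y → rk-submod _ _ (cols (col A) X) (cols (col A) Y)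
        (cols-All (col A) (X ∪ Y) λ j p → span-elem (union X Y j p))
        (cols-⊆ (col A) (X ∩ Y) X (Subₚ.p∩q⊆p X Y)) (cols-⊆ (col A) (X ∩ Y) Y (Subₚ.p∩q⊆q X Y))
    }
    where
    union : ∀ X Y j → j ∈ X ∪ Y → col A j Mem.∈ (cols (col A) X ++ cols (col A) Y)
    union X Y j p with Subₚ.x∈p∪q⁻ X Y p
    ... | inj₁ q = Memₚ.∈-++⁺ˡ (cols-∈ (col A) q)
    ... | inj₂ q = Memₚ.∈-++⁺ʳ (cols (col A) X) (cols-∈ (col A) q)

  columnMatroid-represents : ∀ (A : Fin m → Fin n → Carrier) → Represents F A (columnMatroid A)
  columnMatroid-represents A X = column-rank A X

  -- A linear map with kernel the span of `S` realises the quotient by that span, so ranks of images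
  -- are ranks relative to `S`. Vector by vector, newness over `xs ++ S` is newness of the image.
  module Quotient (φ : V m → V n)
    (φ-comb : ∀ a (u v : V m) {w} → (∀ i → w i ≈ a * u i + v i) → ∀ i → φ w i ≈ a * φ u i + φ v i)
    (S : List (V m)) (kills : All (λ s → ∀ i → φ s i ≈ 0#) S) (kernel : ∀ v → (∀ i → φ v i ≈ 0#) → Span S v) where

    span-image : ∀ xs {v} → Span (xs ++ S) v → Span (map φ xs) (φ v)
    span-image [] p = nil (go kills p)
      where
      φ0 : ∀ {w} → (∀ i → w i ≈ 0#) → ∀ i → φ w i ≈ 0#
      φ0 {w} h i = trans (φ-comb (- 1#) w w (λ i → trans (h i) (sym (a*0+0 (h i) (h i)))) i)
        (sym (move (sym (trans (+-identityʳ _) (*-identityˡ _)))))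
      go : ∀ {T v} → All (λ s → ∀ i → φ s i ≈ 0#) T → Span T v → ∀ i → φ v i ≈ 0#
      go []       (nil h)      i = φ0 h i
      go (k ∷ ks) (cons a p h) i = trans (φ-comb a _ _ h i) (a*0+0 (k i) (go ks p i))
    span-image (x ∷ xs) (cons {u = u} a p h) = cons a (span-image xs p) (φ-comb a x u h)

    span-preimage : ∀ xs {v} → Span (map φ xs) (φ v) → Span (xs ++ S) v
    span-preimage []       {v} (nil h) = kernel v h
    span-preimage (x ∷ xs) {v} (cons {u = u} a p h) = cons {u = λ i → - a * x i + v i} a
      (span-preimage xs (span-resp (λ i → trans (move (h i)) (sym (φ-comb (- a) x v (λ i → refl) i))) p))
      λ i → trans (move refl) (+-congʳ (*-congʳ (-‿involutive a)))

    rk-quotient : ∀ xs → rk (map φ xs) ℕ.+ rk S ≡ rk (xs ++ S)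
    rk-quotient []       = ≡.refl
    rk-quotient (x ∷ xs) = ≡.trans (ℕₚ.+-assoc (gain (map φ xs) (φ x)) _ _)
      (cong₂ ℕ._+_ (gain-≡ {xs = map φ xs} {φ x} {xs ++ S} {x} (span-preimage xs) (span-image xs)) (rk-quotient xs))

  span-split : ∀ xs → Span (xs ++ ys) v → ∃[ s ] ∃[ t ] (Span xs s × Span ys t × (∀ i → v i ≈ s i + t i))
  span-split {v = v} [] p = (λ _ → 0#) , v , nil (λ i → refl) , p , λ i → sym (+-identityˡ _)
  span-split (x ∷ xs) (cons a p h) = let s , t , q , r , e = span-split xs p in
    (λ i → a * x i + s i) , t , cons a q (λ i → refl) , r , λ i → trans (h i) (trans (+-congˡ (e i)) (sym (+-assoc _ _ _)))

  span-join : ∀ xs {s t} → Span xs s → Span ys t → (∀ i → v i ≈ s i + t i) → Span (xs ++ ys) v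
  span-join xs p q e = span-comb 1# (span-mono Memₚ.∈-++⁺ˡ p) (span-mono (Memₚ.∈-++⁺ʳ xs) q)
    λ i → trans (e i) (+-congʳ (sym (*-identityˡ _)))

  sub-eq : ∀ {p q r} → p ≈ q + r → r ≈ - 1# * q + p
  sub-eq e = move (trans e (+-congʳ (sym (*-identityˡ _))))

  -- dim (U ∩ W) = dim U + dim W − dim (U + W).
  intersection : ∀ (xs ys : List (V m)) → ∃[ bs ] (length bs ℕ.+ rk (xs ++ ys) ≡ rk xs ℕ.+ rk ys ×
    All (Span xs) bs × All (Span ys) bs × (∀ v → Span xs v → Span ys v → Span bs v))
  intersection [] ys = [] , ≡.refl , [] , [] , λ v p _ → p
  intersection (x ∷ xs) ys with intersection xs ys | Span? xs x | Span? (xs ++ ys) x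
  ... | bs , e , ps , qs , f | yes p | yes q = bs , e , All.map span-weaken ps , qs , λ v r → f v (span-trans (p ∷ span-refl xs) r)
  ... | bs , e , ps , qs , f | yes p | no ¬q = Empty-elim (¬q (span-mono Memₚ.∈-++⁺ˡ p))
  ... | bs , e , ps , qs , f | no ¬p | no ¬q = bs , ≡.trans (ℕₚ.+-suc (length bs) _) (cong suc e) , All.map span-weaken ps , qs , sp
    where
    sp : ∀ v → Span (x ∷ xs) v → Span ys v → Span bs v
    sp v r s with Span? xs v
    ... | yes t = f v t s
    ... | no ¬t = Empty-elim (¬q (span-trans (span-mono (Memₚ.∈-++⁺ʳ xs) s ∷ span-all Memₚ.∈-++⁺ˡ) (exchange r ¬t)))
  ... | bs , e , ps , qs , f | no ¬p | yes q with span-split xs q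
  -- Here x = s + t, and `t` is the new vector of the intersection. If a x + u lies in the span of
  -- `ys`, subtracting a t leaves a s + u, which belongs to the intersection already found for `xs`.
  ...   | s , t , s∈ , t∈ , h = t ∷ bs , cong suc e , span-comb (- 1#) (span-weaken s∈) (span-head x xs) (λ i → sub-eq (h i)) ∷ All.map span-weaken ps , t∈ ∷ qs , sp
    where
    sp : ∀ v → Span (x ∷ xs) v → Span ys v → Span (t ∷ bs) v
    sp v (cons {u = u} a p g) r = cons {u = λ i → - a * t i + v i} a
      (f _ (span-comb a s∈ p λ i → begin
              - a * t i + v i                     ≈⟨ +-congˡ (g i) ⟩
              - a * t i + (a * x i + u i)         ≈⟨ +-congˡ (+-congʳ (*-congˡ (h i))) ⟩
              - a * t i + (a * (s i + t i) + u i) ≈⟨ cancel a (t i) (s i) (u i) ⟩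
              a * s i + u i                       ∎)
           (span-comb (- a) t∈ r λ i → refl))
      λ i → trans (move refl) (+-congʳ (*-congʳ (-‿involutive a)))
      where
      open ≈R
      cancel : ∀ a t s u → - a * t + (a * (s + t) + u) ≈ a * s + u
      cancel a t s u = sym (move (regroup a t s u))
        where
        open import Algebra.Solver.Ring.NaturalCoefficients.Default commutativeSemiring
        regroup : ∀ a t s u → a * (s + t) + u ≈ a * t + (a * s + u)
        regroup = solve 4 (λ a t s u → a :* (s :+ t) :+ u := a :* t :+ (a :* s :+ u)) refl

  lin : ∀ {k} → (Fin k → V m) → (Fin k → Carrier) → V m
  lin β a i = ∑ F λ t → a t * β t i

  lin-cong : ∀ {k} (β : Fin k → V m) {a b} → (∀ t → a t ≈ b t) → ∀ i → lin β a i ≈ lin β b i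
  lin-cong β e i = ∑-cong λ t → *-congʳ (e t)

  lin-span : ∀ {k} (β : Fin k → V m) a → (∀ t → Span xs (β t)) → Span xs (lin β a)
  lin-span {xs = xs} {zero}  β a h = span-zero xs λ i → refl
  lin-span {k = suc k} β a h = span-comb (a zero) (h zero) (lin-span (λ t → β (suc t)) (λ t → a (suc t)) λ t → h (suc t)) λ i → refl

  lin-comb : ∀ {k} b (β γ η : Fin k → V m) a → (∀ t i → η t i ≈ b * β t i + γ t i) → ∀ i → lin η a i ≈ b * lin β a i + lin γ a i
  lin-comb b β γ η a h i = ∑-comb b λ t → trans (*-congˡ (h t i)) (prod-dist b (β t i) (a t) (γ t i))

  -- Zero vectors fill up a generating list, so that every boundary is described by the same number
  -- of coordinates.
  pad : List (V m) → ∀ k → Fin k → V m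
  pad []       k t         = λ _ → 0#
  pad (x ∷ xs) (suc k) zero    = x
  pad (x ∷ xs) (suc k) (suc t) = pad xs k t

  pad-span : ∀ bs k → All (Span xs) bs → ∀ t → Span xs (pad {m} bs k t)
  pad-span {xs = xs} [] k _ t = span-zero xs λ i → refl
  pad-span (b ∷ bs) (suc k) (p ∷ ps) zero    = p
  pad-span (b ∷ bs) (suc k) (p ∷ ps) (suc t) = pad-span bs k ps t

  span⇒lin : ∀ bs k → length bs ≤ k → Span bs v → ∃[ a ] (∀ i → v i ≈ lin (pad bs k) a i)
  span⇒lin []       k l       (nil h)      = (λ _ → 0#) , λ i → trans (h i) (sym (∑-zero {k = k} λ t → zeroˡ 0#))
  span⇒lin (b ∷ bs) (suc k) (s≤s l) (cons a p h) = let a′ , e = span⇒lin bs k l p in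
    (a Fun.∷ a′) , λ i → trans (h i) (+-congˡ (e i))

  -- A listing of F^k, possibly with repetitions because `enum` is only onto.
  coefficients : ∀ {k} → Fin (size ℕ.^ k) → Fin k → Carrier
  coefficients i t = enum (finToFun i t)

  coefficients-onto : ∀ {k} (b : Fin k → Carrier) → ∃[ i ] (∀ t → coefficients i t ≈ b t)
  coefficients-onto {k} b = funToFin f , λ t → trans (reflexive (cong enum (Finₚ.finToFun-funToFin f t))) (proj₂ (enum-onto (b t)))
    where
    f : Fin k → Fin size
    f t = proj₁ (enum-onto (b t))

  lin-lin : ∀ {k l} (β : Fin k → V m) (γ : Fin l → Fin k → Carrier) b i → lin (λ s → lin β (γ s)) b i ≈ lin β (lin γ b) i
  lin-lin {k = k} {zero}  β γ b i = sym (∑-zero {k = k} λ t → zeroˡ (β t i))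
  lin-lin {k = k} {suc l} β γ b i = trans (+-congˡ (lin-lin β (λ s → γ (suc s)) (λ s → b (suc s)) i))
    (sym (∑-comb (b zero) λ t → dist-prod (b zero) (γ zero t) (β t i) (lin (λ s → γ (suc s)) (λ s → b (suc s)) t)))

  lin-δ : ∀ {k} (β : Fin k → V m) t i → lin β (δ t) i ≈ β t i
  lin-δ β t i = ∑-δ t λ s → β s i

-- Subsets, layouts as paths of sets, and minors

module Subsets where
  open ≡ using (refl; sym; trans)
  open import Data.Nat using (_+_; _∸_)

  private variable
    k n : ℕ

  ∈-tabulate⁺ : ∀ {f : Fin n → Bool} {j} → f j ≡ true → j ∈ tabulate f
  ∈-tabulate⁺ {f = f} {j} e = Vecₚ.lookup⇒[]= j (tabulate f) (trans (Vecₚ.lookup∘tabulate f j) e)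

  ∈-tabulate⁻ : ∀ {f : Fin n → Bool} {j} → j ∈ tabulate f → f j ≡ true
  ∈-tabulate⁻ {f = f} {j} p = trans (sym (Vecₚ.lookup∘tabulate f j)) (Vecₚ.[]=⇒lookup p)

  does⁻ : ∀ {p} {P : Set p} (d : Dec P) → does d ≡ true → P
  does⁻ (yes p) refl = p

  ∈-image⁺ : ∀ (f : Fin k → Fin n) {X i} → i ∈ X → f i ∈ image f X
  ∈-image⁺ f {X} {i} i∈X = ∈-tabulate⁺ (dec-true (Finₚ.any? _) (i , i∈X , refl))

  ∈-image⁻ : ∀ (f : Fin k → Fin n) {X j} → j ∈ image f X → ∃[ i ] (i ∈ X × f i ≡ j)
  ∈-image⁻ f p = does⁻ (Finₚ.any? _) (∈-tabulate⁻ p)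

  ∈-initial⁺ : ∀ {i} {t : Fin n} → toℕ t < i → t ∈ initial i
  ∈-initial⁺ l = ∈-tabulate⁺ (dec-true (_ ℕₚ.<? _) l)

  ∈-initial⁻ : ∀ {i} {t : Fin n} → t ∈ initial i → toℕ t < i
  ∈-initial⁻ p = does⁻ (_ ℕₚ.<? _) (∈-tabulate⁻ p)

  ∈-∪-elim : ∀ (X Y : Subset n) {j} {P : Set} → (j ∈ X → P) → (j ∈ Y → P) → j ∈ X ∪ Y → P
  ∈-∪-elim X Y f g p with Subₚ.x∈p∪q⁻ X Y p
  ... | inj₁ q = f q
  ... | inj₂ q = g q

  ∈-∪ˡ : ∀ {X Y : Subset n} {j} → j ∈ X → j ∈ X ∪ Y
  ∈-∪ˡ p = Subₚ.x∈p∪q⁺ (inj₁ p)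

  ∈-∪ʳ : ∀ {X Y : Subset n} {j} → j ∈ Y → j ∈ X ∪ Y
  ∈-∪ʳ p = Subₚ.x∈p∪q⁺ (inj₂ p)

  ∈-⁅⁆ : ∀ {i j : Fin n} → i ≡ j → i ∈ ⁅ j ⁆
  ∈-⁅⁆ refl = Subₚ.x∈⁅x⁆ _

  embed : ∀ (X : Subset n) → Fin ∣ X ∣ → Fin n
  embed (true ∷ X)  zero    = zero
  embed (true ∷ X)  (suc i) = suc (embed X i)
  embed (false ∷ X) i       = suc (embed X i)

  embed-∈ : ∀ (X : Subset n) i → embed X i ∈ X
  embed-∈ (true ∷ X)  zero    = here
  embed-∈ (true ∷ X)  (suc i) = there (embed-∈ X i)
  embed-∈ (false ∷ X) i       = there (embed-∈ X i)

  embed-injective : ∀ (X : Subset n) → Injective _≡_ _≡_ (embed X)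
  embed-injective (true ∷ X)  {zero}  {zero}  e = refl
  embed-injective (true ∷ X)  {suc i} {suc j} e = cong suc (embed-injective X (Finₚ.suc-injective e))
  embed-injective (false ∷ X) e = embed-injective X (Finₚ.suc-injective e)

  embed-onto : ∀ (X : Subset n) {j} → j ∈ X → ∃[ i ] (embed X i ≡ j)
  embed-onto (true ∷ X)  here      = zero , refl
  embed-onto (true ∷ X)  (there p) = let i , e = embed-onto X p in suc i , cong suc e
  embed-onto (false ∷ X) (there p) = let i , e = embed-onto X p in i , cong suc e

  image-embed : ∀ (X : Subset n) → image (embed X) ⊤ ≡ X
  image-embed X = Subₚ.⊆-antisym
    (λ p → let i , _ , e = ∈-image⁻ (embed X) p in subst (_∈ X) e (embed-∈ X i))
    (λ p → let i , e = embed-onto X p in subst (_∈ image (embed X) ⊤) e (∈-image⁺ (embed X) Subₚ.∈⊤))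

  ∣image∣≤ : ∀ (f : Fin k → Fin n) X → ∣ image f X ∣ ≤ ∣ X ∣
  ∣image∣≤ f X = Finₚ.injective⇒≤ {f = g} λ {i} {j} e → embed-injective (image f X) (begin
      embed (image f X) i       ≡⟨ sym (proj₂ (proj₂ (pre i))) ⟩
      f (proj₁ (pre i))         ≡⟨ cong f (sym (proj₂ (idx i))) ⟩
      f (embed X (g i))         ≡⟨ cong (f ∘ embed X) e ⟩
      f (embed X (g j))         ≡⟨ cong f (proj₂ (idx j)) ⟩
      f (proj₁ (pre j))         ≡⟨ proj₂ (proj₂ (pre j)) ⟩
      embed (image f X) j       ∎)
    where
    open ≡.≡-Reasoning
    pre : ∀ i → ∃[ t ] (t ∈ X × f t ≡ embed (image f X) i)
    pre i = ∈-image⁻ f (embed-∈ (image f X) i)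
    idx : ∀ i → ∃[ t ] (embed X t ≡ proj₁ (pre i))
    idx i = embed-onto X (proj₁ (proj₂ (pre i)))
    g : Fin ∣ image f X ∣ → Fin ∣ X ∣
    g i = proj₁ (idx i)

  rank-submod-⊆ : ∀ (M : Matroid n) (U I X Y : Subset n) → U ⊆ X ∪ Y → I ⊆ X → I ⊆ Y →
    rank M U + rank M I ≤ rank M X + rank M Y
  rank-submod-⊆ M U I X Y p q r = ℕₚ.≤-trans
    (ℕₚ.+-mono-≤ (rank-mono M p) (rank-mono M λ x → Subₚ.x∈p∩q⁺ (q x , r x))) (rank-submod M X Y)

  -- A layout of the elements of `G` outside the starting set, kept as an increasing chain of sets
  -- instead of a permutation. This is the form in which layouts can be split and glued by
  -- recursion.
  data Path {n} (ok : Subset n → Set) (G : Subset n) : Subset n → Set where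
    done : ok G → Path ok G G
    step : ∀ {X} j → ok X → j ∉ X → Path ok G (X ∪ ⁅ j ⁆) → Path ok G X

  path-⊆ : ∀ {ok : Subset n → Set} {G X} → Path ok G X → X ⊆ G
  path-⊆ (done _)       x∈ = x∈
  path-⊆ (step j _ _ p) x∈ = path-⊆ p (∈-∪ˡ x∈)

  path-map : ∀ {ok ok′ : Subset n → Set} {G X} → (∀ {Y} → Y ⊆ G → ok Y → ok′ Y) → Path ok G X → Path ok′ G X
  path-map f (done o)          = done (f (λ p → p) o)
  path-map f q@(step j o j∉ p) = step j (f (path-⊆ q) o) j∉ (path-map f p)

  image-step : ∀ (f : Fin k → Fin n) X j → image f (X ∪ ⁅ j ⁆) ≡ image f X ∪ ⁅ f j ⁆
  image-step f X j = Subₚ.⊆-antisym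
    (λ p → let i , i∈ , e = ∈-image⁻ f p in
       ∈-∪-elim X ⁅ j ⁆ (λ q → ∈-∪ˡ (subst (_∈ image f X) e (∈-image⁺ f q)))
         (λ q → ∈-∪ʳ {X = image f X} (∈-⁅⁆ (trans (sym e) (cong f (Subₚ.x∈⁅y⁆⇒x≡y j q))))) i∈)
    (∈-∪-elim (image f X) ⁅ f j ⁆
      (λ p → let i , i∈ , e = ∈-image⁻ f p in subst (_∈ image f (X ∪ ⁅ j ⁆)) e (∈-image⁺ f (∈-∪ˡ i∈)))
      (λ p → subst (_∈ image f (X ∪ ⁅ j ⁆)) (sym (Subₚ.x∈⁅y⁆⇒x≡y (f j) p)) (∈-image⁺ f (∈-∪ʳ {X = X} (Subₚ.x∈⁅x⁆ j)))))

  path-image : ∀ {ok′ : Subset k → Set} {ok : Subset n → Set} (f : Fin k → Fin n) → Injective _≡_ _≡_ f →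
    (∀ X → ok′ X → ok (image f X)) → ∀ {G X} → Path ok′ G X → Path ok (image f G) (image f X)
  path-image f inj h (done o) = done (h _ o)
  path-image {ok = ok} f inj h {G} {X} (step j o j∉ p) = step (f j) (h _ o)
    (λ q → let i , i∈ , e = ∈-image⁻ f q in j∉ (subst (_∈ X) (inj e) i∈))
    (subst (Path ok (image f G)) (image-step f X j) (path-image f inj h p))

  ⊔-bound⁻ : ∀ {w} xs → foldr ℕ._⊔_ 0 xs ≤ w → All (_≤ w) xs
  ⊔-bound⁻ []       _ = []
  ⊔-bound⁻ (x ∷ xs) p = ℕₚ.≤-trans (ℕₚ.m≤m⊔n x _) p ∷ ⊔-bound⁻ xs (ℕₚ.≤-trans (ℕₚ.m≤n⊔m x _) p)

  ⊔-bound⁺ : ∀ {w xs} → All (_≤ w) xs → foldr ℕ._⊔_ 0 xs ≤ w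
  ⊔-bound⁺ []       = z≤n
  ⊔-bound⁺ (p ∷ ps) = ℕₚ.⊔-lub p (⊔-bound⁺ ps)

  pw⇒path : ∀ (M : Matroid n) {w} → PwAtMost M w → Path (λ X → conn M X ≤ w) ⊤ ⊥
  pw⇒path {n} M {w} (e , (inj , surj) , wd) =
    subst (Path ok ⊤) prefix0 (build n 0 (ℕₚ.+-identityʳ n))
    where
    ok : Subset n → Set
    ok X = conn M X ≤ w
    stage : ∀ i → i < suc n → ok (prefix e i)
    stage i l = Allₚ.applyUpTo⁻ (λ j → j) (suc n) (Allₚ.map⁻ (⊔-bound⁻ _ wd)) l
    prefix0 : prefix e 0 ≡ ⊥
    prefix0 = Subₚ.⊆-antisym (λ p → let i , i∈ , _ = ∈-image⁻ e p in Empty-elim (ℕₚ.n≮0 (∈-initial⁻ i∈))) (λ p → Empty-elim (Subₚ.∉⊥ p))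
    prefixn : prefix e n ≡ ⊤
    prefixn = Subₚ.⊆-antisym (λ _ → Subₚ.∈⊤) λ {j} _ → let i , f = surj j in
      subst (_∈ prefix e n) (f refl) (∈-image⁺ e (∈-initial⁺ (Finₚ.toℕ<n i)))
    prefix-suc : ∀ i (l : i < n) → initial (suc i) ≡ initial i ∪ ⁅ fromℕ< l ⁆
    prefix-suc i l = Subₚ.⊆-antisym to from
      where
      to : initial (suc i) ⊆ initial i ∪ ⁅ fromℕ< l ⁆
      to {t} p with toℕ t ℕ.≟ i
      ... | yes e = ∈-∪ʳ {X = initial i} (∈-⁅⁆ (Finₚ.toℕ-injective (trans e (sym (Finₚ.toℕ-fromℕ< l)))))
      ... | no ¬e = ∈-∪ˡ (∈-initial⁺ (ℕₚ.≤∧≢⇒< (ℕ.s≤s⁻¹ (∈-initial⁻ p)) ¬e))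
      from : initial i ∪ ⁅ fromℕ< l ⁆ ⊆ initial (suc i)
      from = ∈-∪-elim (initial i) _ (λ p → ∈-initial⁺ (ℕₚ.m<n⇒m<1+n (∈-initial⁻ p)))
        (λ p → ∈-initial⁺ (s≤s (ℕₚ.≤-reflexive (trans (cong toℕ (Subₚ.x∈⁅y⁆⇒x≡y _ p)) (Finₚ.toℕ-fromℕ< l)))))
    build : ∀ d i → d + i ≡ n → Path ok ⊤ (prefix e i)
    build zero i refl = subst (Path ok ⊤) (sym prefixn) (done (subst ok prefixn (stage n ℕₚ.≤-refl)))
    build (suc d) i eq = step (e (fromℕ< l)) (stage i (ℕₚ.m<n⇒m<1+n l))
      (λ p → let t , t∈ , q = ∈-image⁻ e p in
         ℕₚ.<-irrefl (trans (cong toℕ (inj q)) (Finₚ.toℕ-fromℕ< l)) (∈-initial⁻ t∈))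
      (subst (Path ok ⊤) (trans (cong (image e) (prefix-suc i l)) (image-step e (initial i) _))
        (build d (suc i) (trans (ℕₚ.+-suc d i) eq)))
      where
      l : i < n
      l = subst (i <_) eq (s≤s (ℕₚ.m≤n+m i d))

  module _ {ok : Subset n → Set} {G : Subset n} where
    len : ∀ {X} → Path ok G X → ℕ
    len (done _)       = 0
    len (step j _ _ p) = suc (len p)

    elem : ∀ {X} (p : Path ok G X) → Fin (len p) → Fin n
    elem (step j _ _ p) zero    = j
    elem (step j _ _ p) (suc t) = elem p t

    elem-∉ : ∀ {X} (p : Path ok G X) t → elem p t ∉ X
    elem-∉ (step j _ j∉ p) zero    = j∉
    elem-∉ (step j _ j∉ p) (suc t) = elem-∉ p t ∘ ∈-∪ˡ

    elem-injective : ∀ {X} (p : Path ok G X) → Injective _≡_ _≡_ (elem p)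
    elem-injective (step j _ _ p) {zero}  {zero}  e = refl
    elem-injective {X} (step j _ _ p) {zero}  {suc t} e = Empty-elim (elem-∉ p t (∈-∪ʳ {X = X} (∈-⁅⁆ (sym e))))
    elem-injective {X} (step j _ _ p) {suc s} {zero}  e = Empty-elim (elem-∉ p s (∈-∪ʳ {X = X} (∈-⁅⁆ e)))
    elem-injective (step j _ _ p) {suc s} {suc t} e = cong suc (elem-injective p e)

    elem-onto : ∀ {X} (p : Path ok G X) {j} → j ∈ G → j ∉ X → ∃[ t ] (elem p t ≡ j)
    elem-onto (done _) j∈ j∉ = Empty-elim (j∉ j∈)
    elem-onto {X} (step i _ _ p) {j} j∈ j∉ with j Finₚ.≟ i
    ... | yes refl = zero , refl
    ... | no j≢i = let t , e = elem-onto p j∈ (∈-∪-elim X ⁅ i ⁆ j∉ (j≢i ∘ Subₚ.x∈⁅y⁆⇒x≡y i)) in suc t , e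

    Stage : ∀ {X} (p : Path ok G X) → ℕ → Subset n → Set
    Stage {X} p i Y = ∀ {j} → (j ∈ Y → j ∈ X ⊎ ∃[ t ] (toℕ t < i × elem p t ≡ j)) ×
                              (j ∈ X ⊎ ∃[ t ] (toℕ t < i × elem p t ≡ j) → j ∈ Y)

    stage-ok : ∀ {X} (p : Path ok G X) i Y → i ≤ len p → Stage p i Y → ok Y
    stage-ok {X} p zero Y _ s = subst ok (Subₚ.⊆-antisym (λ q → proj₂ s (inj₁ q)) back) (start p)
      where
      start : ∀ {X} → Path ok G X → ok X
      start (done o)       = o
      start (step _ o _ _) = o
      back : Y ⊆ X
      back q with proj₁ s q
      ... | inj₁ r = r
      ... | inj₂ (_ , () , _)
    stage-ok {X} (step i o j∉ p) (suc k) Y (s≤s l) s = stage-ok p k Y l (to , from)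
      where
      to : ∀ {j} → j ∈ Y → j ∈ X ∪ ⁅ i ⁆ ⊎ ∃[ t ] (toℕ t < k × elem p t ≡ j)
      to q with proj₁ s q
      ... | inj₁ r = inj₁ (∈-∪ˡ r)
      ... | inj₂ (zero , _ , e) = inj₁ (∈-∪ʳ {X = X} (∈-⁅⁆ (sym e)))
      ... | inj₂ (suc t , s≤s m , e) = inj₂ (t , m , e)
      from : ∀ {j} → j ∈ X ∪ ⁅ i ⁆ ⊎ ∃[ t ] (toℕ t < k × elem p t ≡ j) → j ∈ Y
      from (inj₁ q) = ∈-∪-elim X ⁅ i ⁆ (λ r → proj₂ s (inj₁ r)) (λ r → proj₂ s (inj₂ (zero , s≤s z≤n , sym (Subₚ.x∈⁅y⁆⇒x≡y i r)))) q
      from (inj₂ (t , m , e)) = proj₂ s (inj₂ (suc t , s≤s m , e))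

  path⇒pw : ∀ (M : Matroid n) {w} → Path (λ X → conn M X ≤ w) ⊤ ⊥ → PwAtMost M w
  path⇒pw {n} M {w} p = layout (len p) (elem p) len≡n (elem-injective p) onto
      (λ i i≤ → stage-ok p i _ (subst (i ≤_) (sym len≡n) i≤) (to , from))
    where
    onto : ∀ j → ∃[ t ] (elem p t ≡ j)
    onto j = elem-onto p Subₚ.∈⊤ Subₚ.∉⊥
    len≡n : len p ≡ n
    len≡n = ℕₚ.≤-antisym (Finₚ.injective⇒≤ (elem-injective p))
      (Finₚ.injective⇒≤ {f = proj₁ ∘ onto} λ {i} {j} e → trans (sym (proj₂ (onto i))) (trans (cong (elem p) e) (proj₂ (onto j))))
    to : ∀ {i j} → j ∈ image (elem p) (initial i) → j ∈ ⊥ ⊎ ∃[ t ] (toℕ t < i × elem p t ≡ j)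
    to q = let t , t∈ , e = ∈-image⁻ (elem p) q in inj₂ (t , ∈-initial⁻ t∈ , e)
    from : ∀ {i j} → j ∈ ⊥ ⊎ ∃[ t ] (toℕ t < i × elem p t ≡ j) → j ∈ image (elem p) (initial i)
    from (inj₁ q) = Empty-elim (Subₚ.∉⊥ q)
    from (inj₂ (t , l , refl)) = ∈-image⁺ (elem p) (∈-initial⁺ l)
    -- With `l` a variable the equation `l ≡ n` can be matched; `len p` itself depends on `n`.
    layout : ∀ l (e : Fin l → Fin n) → l ≡ n → Injective _≡_ _≡_ e → (∀ j → ∃[ t ] (e t ≡ j)) →
      (∀ i → i ≤ n → conn M (image e (initial i)) ≤ w) → PwAtMost M w
    layout l e refl inj onto h = e , (inj , λ j → let t , q = onto j in t , λ { refl → q }) ,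
      ⊔-bound⁺ (Allₚ.map⁺ (Allₚ.applyUpTo⁺₁ (λ j → j) (suc n) λ { (s≤s i≤n) → h _ i≤n }))

  minor : Matroid n → (G C : Subset n) → Matroid ∣ G ∣
  minor M G C = record
    { rank        = ρ
    ; rank-bound  = λ X → ℕₚ.m≤n+o⇒m∸n≤o _ (rank M C) (ℕₚ.≤-trans
        (ℕₚ.≤-trans (ℕₚ.m≤m+n _ _) (rank-submod M (image ι X) C))
        (ℕₚ.≤-trans (ℕₚ.+-monoˡ-≤ _ (ℕₚ.≤-trans (rank-bound M _) (∣image∣≤ ι X))) (ℕₚ.≤-reflexive (ℕₚ.+-comm ∣ X ∣ _))))
    ; rank-mono   = λ {X} {Y} p → ℕₚ.∸-monoˡ-≤ (rank M C) (rank-mono M (mono p))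
    ; rank-submod = λ X Y → begin
        ρ (X ∪ Y) + ρ (X ∩ Y) ≤⟨ cancel (rank M C) (rank-mono M (C⊆ {X ∪ Y})) (rank-mono M (C⊆ {X ∩ Y})) (rank-mono M (λ {j} → C⊆ {X} {j})) (rank-mono M (λ {j} → C⊆ {Y} {j})) (rank-submod-⊆ M (s (X ∪ Y)) (s (X ∩ Y)) (s X) (s Y) (union X Y) (mono (Subₚ.p∩q⊆p X Y)) (mono (Subₚ.p∩q⊆q X Y))) ⟩
        ρ X + ρ Y             ∎
    }
    where
    open ℕₚ.≤-Reasoning
    ι : Fin ∣ G ∣ → Fin _
    ι = embed G
    s : Subset ∣ G ∣ → Subset _
    s X = image ι X ∪ C
    ρ : Subset ∣ G ∣ → ℕ
    ρ X = rank M (s X) ∸ rank M C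
    C⊆ : ∀ {X} → C ⊆ s X
    C⊆ {X} = ∈-∪ʳ {X = image ι X}
    mono : ∀ {X Y} → X ⊆ Y → s X ⊆ s Y
    mono {X} {Y} X⊆Y = ∈-∪-elim (image ι X) C
      (λ p → let i , i∈ , e = ∈-image⁻ ι p in ∈-∪ˡ (subst (_∈ image ι Y) e (∈-image⁺ ι (X⊆Y i∈)))) (λ p → C⊆ {Y} p)
    union : ∀ X Y → s (X ∪ Y) ⊆ s X ∪ s Y
    union X Y = ∈-∪-elim (image ι (X ∪ Y)) C
      (λ p → let i , i∈ , e = ∈-image⁻ ι p in ∈-∪-elim X Y
        (λ q → ∈-∪ˡ (∈-∪ˡ (subst (_∈ image ι X) e (∈-image⁺ ι q))))
        (λ q → ∈-∪ʳ {X = s X} (∈-∪ˡ (subst (_∈ image ι Y) e (∈-image⁺ ι q)))) i∈)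
      (λ p → ∈-∪ˡ (C⊆ {X} p))
    cancel : ∀ {a b x y} c → c ≤ a → c ≤ b → c ≤ x → c ≤ y → a + b ≤ x + y → (a ∸ c) + (b ∸ c) ≤ (x ∸ c) + (y ∸ c)
    cancel {a} {b} {x} {y} c c≤a c≤b c≤x c≤y h = ℕₚ.+-cancelʳ-≤ (c + c) _ _ (begin
        (a ∸ c) + (b ∸ c) + (c + c) ≡⟨ pairs a b c≤a c≤b ⟩
        a + b                       ≤⟨ h ⟩
        x + y                       ≡⟨ sym (pairs x y c≤x c≤y) ⟩
        (x ∸ c) + (y ∸ c) + (c + c) ∎)
      where
      open +-*-Solver
      pairs : ∀ a b → c ≤ a → c ≤ b → (a ∸ c) + (b ∸ c) + (c + c) ≡ a + b
      pairs a b p q = trans (solve 3 (λ a b c → a :+ b :+ (c :+ c) := (a :+ c) :+ (b :+ c)) refl (a ∸ c) (b ∸ c) c)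
        (cong₂ _+_ (ℕₚ.m∸n+n≡m p) (ℕₚ.m∸n+n≡m q))

  -- U has connectivity at most w in (M / C) | G, with the ranks moved so that no subtraction occurs.
  Narrow : Matroid n → (G C : Subset n) → ℕ → Subset n → Set
  Narrow M G C w U = rank M (U ∪ C) + rank M ((G ∩ ∁ U) ∪ C) ≤ w + (rank M (G ∪ C) + rank M C)

  narrow⇒conn : ∀ (M : Matroid n) {w U} → rank M U + rank M (∁ U) ≤ w + rank M ⊤ → conn M U ≤ w
  narrow⇒conn M {w} {U} h = ℕₚ.m≤n+o⇒m∸n≤o _ (rank M ⊤) (ℕₚ.≤-trans h (ℕₚ.≤-reflexive (ℕₚ.+-comm w _)))

  -- `N` may be any matroid with the ranks of the minor: for codes it is the one that accompanies
  -- the width bound of the shortened code.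
  minor-path : ∀ (M : Matroid n) G C (N : Matroid ∣ G ∣) → (∀ X → rank N X ≡ rank M (image (embed G) X ∪ C) ∸ rank M C) →
    ∀ {w} → PwAtMost N w → Path (Narrow M G C w) G ⊥
  minor-path M G C N e {w} pw = subst₂Path (image-embed G) image⊥
      (path-image ι (embed-injective G) narrow (pw⇒path N pw))
    where
    open ℕₚ.≤-Reasoning
    open +-*-Solver
    ι : Fin ∣ G ∣ → Fin _
    ι = embed G
    c : ℕ
    c = rank M C
    image⊥ : image ι ⊥ ≡ ⊥
    image⊥ = Subₚ.⊆-antisym (λ p → let _ , i∈ , _ = ∈-image⁻ ι p in Empty-elim (Subₚ.∉⊥ i∈)) (λ p → Empty-elim (Subₚ.∉⊥ p))
    subst₂Path : ∀ {ok : Subset _ → Set} {A B X Y} → A ≡ B → X ≡ Y → Path ok A X → Path ok B Y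
    subst₂Path refl refl p = p
    image-∁ : ∀ X → image ι (∁ X) ≡ G ∩ ∁ (image ι X)
    image-∁ X = Subₚ.⊆-antisym
      (λ p → let i , i∈ , e = ∈-image⁻ ι p in Subₚ.x∈p∩q⁺
        (subst (_∈ G) e (embed-∈ G i) ,
         Subₚ.x∉p⇒x∈∁p λ q → let k , k∈ , e′ = ∈-image⁻ ι q in
           Subₚ.x∈∁p⇒x∉p i∈ (subst (_∈ X) (embed-injective G (trans e′ (sym e))) k∈)))
      (λ p → let q , r = Subₚ.x∈p∩q⁻ G (∁ (image ι X)) p ; i , e = embed-onto G q in
        subst (_∈ image ι (∁ X)) e (∈-image⁺ ι (Subₚ.x∉p⇒x∈∁p λ i∈ →
          Subₚ.x∈∁p⇒x∉p r (subst (_∈ image ι X) e (∈-image⁺ ι i∈)))))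
    restore : ∀ {U V} → rank N U ≡ rank M (V ∪ C) ∸ c → rank N U + c ≡ rank M (V ∪ C)
    restore {V = V} q = trans (cong (_+ c) q) (ℕₚ.m∸n+n≡m (rank-mono M (∈-∪ʳ {X = V})))
    narrow : ∀ X → conn N X ≤ w → Narrow M G C w (image ι X)
    narrow X h = begin
      rank M (image ι X ∪ C) + rank M ((G ∩ ∁ (image ι X)) ∪ C) ≡⟨ cong₂ _+_ (sym (restore {X} {image ι X} (e X)))
                                                                    (sym (restore {∁ X} {G ∩ ∁ (image ι X)} (trans (e (∁ X)) (cong (λ Z → rank M (Z ∪ C) ∸ c) (image-∁ X))))) ⟩
      (rank N X + c) + (rank N (∁ X) + c)  ≡⟨ solve 3 (λ a b c → (a :+ c) :+ (b :+ c) := (a :+ b) :+ (c :+ c)) refl (rank N X) (rank N (∁ X)) c ⟩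
      (rank N X + rank N (∁ X)) + (c + c)  ≤⟨ ℕₚ.+-monoˡ-≤ (c + c) (ℕₚ.≤-trans (ℕₚ.m≤n+m∸n _ (rank N ⊤)) (ℕₚ.+-monoʳ-≤ (rank N ⊤) h)) ⟩
      (rank N ⊤ + w) + (c + c)             ≡⟨ solve 3 (λ a b c → (a :+ b) :+ (c :+ c) := b :+ ((a :+ c) :+ c)) refl (rank N ⊤) w c ⟩
      w + ((rank N ⊤ + c) + c)             ≡⟨ cong (λ r → w + (r + c)) (restore {⊤} {G} (trans (e ⊤) (cong (λ Z → rank M (Z ∪ C) ∸ c) (image-embed G)))) ⟩
      w + (rank M (G ∪ C) + c)             ∎

-- Deciding inclusions of Boolean combinations of sets

module SetReasoning where
  open ≡ using (refl; sym; trans)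

  infixr 6 _∪ₑ_
  infixr 7 _∩ₑ_

  data SetExpr (k : ℕ) : Set where
    var       : Fin k → SetExpr k
    _∪ₑ_ _∩ₑ_ : SetExpr k → SetExpr k → SetExpr k
    ∁ₑ        : SetExpr k → SetExpr k
    ⊥ₑ ⊤ₑ     : SetExpr k

  ⟦_⟧ : ∀ {n k} → SetExpr k → Vec (Subset n) k → Subset n
  ⟦ var i ⟧  ρ = Vec.lookup ρ i
  ⟦ e ∪ₑ f ⟧ ρ = ⟦ e ⟧ ρ ∪ ⟦ f ⟧ ρ
  ⟦ e ∩ₑ f ⟧ ρ = ⟦ e ⟧ ρ ∩ ⟦ f ⟧ ρ
  ⟦ ∁ₑ e ⟧   ρ = ∁ (⟦ e ⟧ ρ)
  ⟦ ⊥ₑ ⟧     ρ = ⊥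
  ⟦ ⊤ₑ ⟧     ρ = ⊤

  truth : ∀ {k} → SetExpr k → Vec Bool k → Bool
  truth (var i)  b = Vec.lookup b i
  truth (e ∪ₑ f) b = truth e b ∨ truth f b
  truth (e ∩ₑ f) b = truth e b ∧ truth f b
  truth (∁ₑ e)   b = not (truth e b)
  truth ⊥ₑ       b = false
  truth ⊤ₑ       b = true

  truth-sound : ∀ {n k} (e : SetExpr k) (ρ : Vec (Subset n) k) j → Vec.lookup (⟦ e ⟧ ρ) j ≡ truth e (Vec.map (λ X → Vec.lookup X j) ρ)
  truth-sound (var i)  ρ j = sym (Vecₚ.lookup-map i (λ X → Vec.lookup X j) ρ)
  truth-sound (e ∪ₑ f) ρ j = trans (Vecₚ.lookup-zipWith _∨_ j (⟦ e ⟧ ρ) (⟦ f ⟧ ρ)) (cong₂ _∨_ (truth-sound e ρ j) (truth-sound f ρ j))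
  truth-sound (e ∩ₑ f) ρ j = trans (Vecₚ.lookup-zipWith _∧_ j (⟦ e ⟧ ρ) (⟦ f ⟧ ρ)) (cong₂ _∧_ (truth-sound e ρ j) (truth-sound f ρ j))
  truth-sound (∁ₑ e)   ρ j = trans (Vecₚ.lookup-map j not (⟦ e ⟧ ρ)) (cong not (truth-sound e ρ j))
  truth-sound ⊥ₑ       ρ j = Vecₚ.lookup-replicate j false
  truth-sound ⊤ₑ       ρ j = Vecₚ.lookup-replicate j true

  Inclusion : ℕ → Set
  Inclusion k = SetExpr k × SetExpr k

  _⇒ᵇ_ : Bool → Bool → Bool
  true  ⇒ᵇ c = c
  false ⇒ᵇ c = true

  entails : ∀ {k} → List (Inclusion k) → Inclusion k → Vec Bool k → Bool
  entails []             (e , f) b = truth e b ⇒ᵇ truth f b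
  entails ((p , q) ∷ hs) g       b = (truth p b ⇒ᵇ truth q b) ⇒ᵇ entails hs g b

  everywhere : ∀ {k} → (Vec Bool k → Bool) → Bool
  everywhere {zero}  f = f []
  everywhere {suc k} f = everywhere (λ b → f (true ∷ b)) ∧ everywhere (λ b → f (false ∷ b))

  everywhere-sound : ∀ {k} (f : Vec Bool k → Bool) → T (everywhere f) → ∀ b → T (f b)
  everywhere-sound f t []          = t
  everywhere-sound f t (c ∷ b) with everywhere (λ b → f (true ∷ b)) in e₁ | everywhere (λ b → f (false ∷ b)) in e₂
  everywhere-sound f t (true ∷ b)  | true | true = everywhere-sound (λ b → f (true ∷ b)) (subst T (sym e₁) tt) b
  everywhere-sound f t (false ∷ b) | true | true = everywhere-sound (λ b → f (false ∷ b)) (subst T (sym e₂) tt) b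

  ⟦_⟧⊆ : ∀ {n k} → Inclusion k → Vec (Subset n) k → Set
  ⟦ e , f ⟧⊆ ρ = ⟦ e ⟧ ρ ⊆ ⟦ f ⟧ ρ

  -- Inclusions between Boolean combinations of subsets, decided by truth tables.
  tauto : ∀ {n k} (ρ : Vec (Subset n) k) (hs : List (Inclusion k)) (g : Inclusion k) →
    {T (everywhere (entails hs g))} → All (λ h → ⟦ h ⟧⊆ ρ) hs → ⟦ g ⟧⊆ ρ
  tauto {n} ρ hs g {t} hyps {j} j∈ = Vecₚ.lookup⇒[]= j _ (go hs hyps (everywhere-sound (entails hs g) t (Vec.map (λ X → Vec.lookup X j) ρ)))
    where
    ⇒ᵇ-intro : ∀ b c → (b ≡ true → c ≡ true) → (b ⇒ᵇ c) ≡ true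
    ⇒ᵇ-intro true  c h = h refl
    ⇒ᵇ-intro false c h = refl
    ⇒ᵇ-elim : ∀ {b c} → T (b ⇒ᵇ c) → b ≡ true → T c
    ⇒ᵇ-elim {true} t refl = t
    T⇒≡ : ∀ {b} → T b → b ≡ true
    T⇒≡ {true} _ = refl
    go : ∀ hs → All (λ h → ⟦ h ⟧⊆ ρ) hs → T (entails hs g (Vec.map (λ X → Vec.lookup X j) ρ)) → Vec.lookup (⟦ proj₂ g ⟧ ρ) j ≡ true
    go [] [] t = trans (truth-sound (proj₂ g) ρ j) (T⇒≡ (⇒ᵇ-elim t (trans (sym (truth-sound (proj₁ g) ρ j)) (Vecₚ.[]=⇒lookup j∈))))
    go ((p , q) ∷ hs) (h ∷ hyps) t = go hs hyps (⇒ᵇ-elim t (⇒ᵇ-intro _ _ λ e →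
      trans (sym (truth-sound q ρ j)) (Vecₚ.[]=⇒lookup (h (Vecₚ.lookup⇒[]= j (⟦ p ⟧ ρ) (trans (truth-sound p ρ j) e))))))

-- Tutte's linking theorem and linked chains

-- This is (m + 1)^(k + 1): a factor m + 1 for each of the levels k, ..., 0, at which either a block
-- of m + 1 sets is linked or every block gives up one set of lower connectivity.
chainBound : ℕ → ℕ → ℕ
chainBound zero    m = suc m
chainBound (suc k) m = chainBound k m ℕ.* suc m

module MatroidLinking {n} (M : Matroid n) where
  open ≡ using (refl; sym; trans)
  open import Data.Nat using (_+_; _*_)
  open Subsets
  open SetReasoning

  private
    r : Subset n → ℕ
    r = rank M

  -- The connectivity shifted up by r ⊤. Bounds carry r ⊤ on their other side, so that truncated
  -- subtraction does not enter.
  κ : Subset n → ℕ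
  κ X = r X + r (∁ X)

  rank-suc : ∀ X u → r (X ∪ ⁅ u ⁆) ≤ suc (r X)
  rank-suc X u = ℕₚ.≤-trans (ℕₚ.m≤m+n _ _) (ℕₚ.≤-trans (rank-submod M X ⁅ u ⁆)
    (ℕₚ.≤-trans (ℕₚ.+-monoʳ-≤ (r X) (ℕₚ.≤-trans (rank-bound M ⁅ u ⁆) (ℕₚ.≤-reflexive (Subₚ.∣⁅x⁆∣≡1 u))))
      (ℕₚ.≤-reflexive (ℕₚ.+-comm (r X) 1))))

  module Tutte (A Z : Subset n) (k : ℕ) where

    -- With C contracted and U still undecided, A and Z have connectivity at least k.
    Robust : Subset n → Subset n → Set
    Robust C U = ∀ X → X ⊆ U → r (A ∪ U ∪ Z ∪ C) + r C + k ≤ r (A ∪ X ∪ C) + r ((U ∩ ∁ X) ∪ Z ∪ C)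

    -- An uncrossing argument: if deleting and contracting u both break robustness,
    -- the two offending sets X and Y give a contradiction at X ∩ Y and X ∪ Y ∪ u.
    delete-or-contract : ∀ C U u → u ∉ U → Robust C (U ∪ ⁅ u ⁆) → Robust C U ⊎ Robust (C ∪ ⁅ u ⁆) U
    delete-or-contract C U u u∉U rob
      with Subₚ.anySubset? (λ X → (X Subₚ.⊆? U) ×-dec (r (A ∪ X ∪ C) + r ((U ∩ ∁ X) ∪ Z ∪ C) ℕₚ.<? r (A ∪ U ∪ Z ∪ C) + r C + k))
    ... | no ¬bad = inj₁ λ X X⊆U → ℕₚ.≮⇒≥ λ l → ¬bad (X , X⊆U , l)
    -- The two failures are strict and together lose 2, while contracting `u` raises the rank of `C`
    -- by at most 1; against the crossing inequality this leaves 2 B + 2 ≤ 2 B + 1.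
    ... | yes (X , X⊆U , bad) = inj₂ λ Y Y⊆U → ℕₚ.≮⇒≥ λ bad′ → ℕₚ.<-irrefl refl (begin-strict
          suc (B + B) ≤⟨ s≤s (crossing Y Y⊆U) ⟩
          suc (bound X C + bound Y (C ∪ ⁅ u ⁆)) ≡⟨ sym (ℕₚ.+-suc _ _) ⟩
          bound X C + suc (bound Y (C ∪ ⁅ u ⁆)) <⟨ ℕₚ.+-mono-≤ bad bad′ ⟩
          (r (A ∪ U ∪ Z ∪ C) + r C + k) + (r (A ∪ U ∪ Z ∪ (C ∪ ⁅ u ⁆)) + r (C ∪ ⁅ u ⁆) + k)
            ≤⟨ ℕₚ.+-mono-≤
                 (ℕₚ.+-monoˡ-≤ k (ℕₚ.+-monoˡ-≤ (r C) (rank-mono M (tauto (⁅ u ⁆ ∷ U ∷ A ∷ Z ∷ C ∷ []) [] (v₂ ∪ₑ v₁ ∪ₑ v₃ ∪ₑ v₄ , v₂ ∪ₑ (v₁ ∪ₑ v₀) ∪ₑ v₃ ∪ₑ v₄) []))))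
                 (ℕₚ.+-monoˡ-≤ k (ℕₚ.+-mono-≤ (rank-mono M (tauto (⁅ u ⁆ ∷ U ∷ A ∷ Z ∷ C ∷ []) [] (v₂ ∪ₑ v₁ ∪ₑ v₃ ∪ₑ (v₄ ∪ₑ v₀) , v₂ ∪ₑ (v₁ ∪ₑ v₀) ∪ₑ v₃ ∪ₑ v₄) []))
                   (rank-suc C u))) ⟩
          B + (r (A ∪ (U ∪ ⁅ u ⁆) ∪ Z ∪ C) + suc (r C) + k) ≡⟨ cong (λ x → B + (x + k)) (ℕₚ.+-suc _ (r C)) ⟩
          B + suc B ≡⟨ ℕₚ.+-suc B B ⟩
          suc (B + B) ∎)
      where
      open ℕₚ.≤-Reasoning
      open +-*-Solver
      B : ℕ
      B = r (A ∪ (U ∪ ⁅ u ⁆) ∪ Z ∪ C) + r C + k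
      bound : Subset n → Subset n → ℕ
      bound X C = r (A ∪ X ∪ C) + r ((U ∩ ∁ X) ∪ Z ∪ C)
      v₀ v₁ v₂ v₃ : ∀ {k} → SetExpr (4 + k)
      v₀ = var zero
      v₁ = var (suc zero)
      v₂ = var (suc (suc zero))
      v₃ = var (suc (suc (suc zero)))
      v₄ : ∀ {k} → SetExpr (5 + k)
      v₄ = var (suc (suc (suc (suc zero))))
      v₅ v₆ : SetExpr 7
      v₅ = var (# 5)
      v₆ = var (# 6)
      u-disjoint : ⁅ u ⁆ ⊆ ∁ U
      u-disjoint p = Subₚ.x∉p⇒x∈∁p λ q → u∉U (subst (_∈ U) (Subₚ.x∈⁅y⁆⇒x≡y u p) q)
      module _ (Y : Subset n) (Y⊆U : Y ⊆ U) where
        τ : ∀ (g : Inclusion 7) → {T (everywhere (entails ((v₀ , v₂) ∷ (v₁ , v₂) ∷ (v₃ , ∁ₑ v₂) ∷ []) g))} → ⟦ g ⟧⊆ (X ∷ Y ∷ U ∷ ⁅ u ⁆ ∷ A ∷ Z ∷ C ∷ [])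
        τ g {t} = tauto (X ∷ Y ∷ U ∷ ⁅ u ⁆ ∷ A ∷ Z ∷ C ∷ []) ((v₀ , v₂) ∷ (v₁ , v₂) ∷ (v₃ , ∁ₑ v₂) ∷ []) g {t} (X⊆U ∷ Y⊆U ∷ u-disjoint ∷ [])
        P₁ P₂ Q₁ Q₂ : Subset n
        P₁ = A ∪ (X ∪ Y ∪ ⁅ u ⁆) ∪ C
        P₂ = A ∪ (X ∩ Y) ∪ C
        Q₁ = ((U ∪ ⁅ u ⁆) ∩ ∁ (X ∪ Y ∪ ⁅ u ⁆)) ∪ Z ∪ C
        Q₂ = ((U ∪ ⁅ u ⁆) ∩ ∁ (X ∩ Y)) ∪ Z ∪ C
        crossing : B + B ≤ bound X C + bound Y (C ∪ ⁅ u ⁆)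
        crossing = begin
          B + B
            ≤⟨ ℕₚ.+-mono-≤ (rob (X ∪ Y ∪ ⁅ u ⁆) (τ (v₀ ∪ₑ v₁ ∪ₑ v₃ , v₂ ∪ₑ v₃))) (rob (X ∩ Y) (τ (v₀ ∩ₑ v₁ , v₂ ∪ₑ v₃))) ⟩
          (r P₁ + r Q₁) + (r P₂ + r Q₂)
            ≡⟨ solve 4 (λ a b c d → (a :+ b) :+ (c :+ d) := (a :+ c) :+ (d :+ b)) refl (r P₁) (r Q₁) (r P₂) (r Q₂) ⟩
          (r P₁ + r P₂) + (r Q₂ + r Q₁)
            ≤⟨ ℕₚ.+-mono-≤
                 (rank-submod-⊆ M P₁ P₂ (A ∪ X ∪ C) (A ∪ Y ∪ (C ∪ ⁅ u ⁆))
                   (τ (v₄ ∪ₑ (v₀ ∪ₑ v₁ ∪ₑ v₃) ∪ₑ v₆ , (v₄ ∪ₑ v₀ ∪ₑ v₆) ∪ₑ (v₄ ∪ₑ v₁ ∪ₑ (v₆ ∪ₑ v₃))))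
                   (τ (v₄ ∪ₑ (v₀ ∩ₑ v₁) ∪ₑ v₆ , v₄ ∪ₑ v₀ ∪ₑ v₆))
                   (τ (v₄ ∪ₑ (v₀ ∩ₑ v₁) ∪ₑ v₆ , v₄ ∪ₑ v₁ ∪ₑ (v₆ ∪ₑ v₃))))
                 (rank-submod-⊆ M Q₂ Q₁ ((U ∩ ∁ X) ∪ Z ∪ C) ((U ∩ ∁ Y) ∪ Z ∪ (C ∪ ⁅ u ⁆))
                   (τ (((v₂ ∪ₑ v₃) ∩ₑ ∁ₑ (v₀ ∩ₑ v₁)) ∪ₑ v₅ ∪ₑ v₆ , ((v₂ ∩ₑ ∁ₑ v₀) ∪ₑ v₅ ∪ₑ v₆) ∪ₑ ((v₂ ∩ₑ ∁ₑ v₁) ∪ₑ v₅ ∪ₑ (v₆ ∪ₑ v₃))))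
                   (τ (((v₂ ∪ₑ v₃) ∩ₑ ∁ₑ (v₀ ∪ₑ v₁ ∪ₑ v₃)) ∪ₑ v₅ ∪ₑ v₆ , (v₂ ∩ₑ ∁ₑ v₀) ∪ₑ v₅ ∪ₑ v₆))
                   (τ (((v₂ ∪ₑ v₃) ∩ₑ ∁ₑ (v₀ ∪ₑ v₁ ∪ₑ v₃)) ∪ₑ v₅ ∪ₑ v₆ , (v₂ ∩ₑ ∁ₑ v₁) ∪ₑ v₅ ∪ₑ (v₆ ∪ₑ v₃)))) ⟩
          (r (A ∪ X ∪ C) + r (A ∪ Y ∪ (C ∪ ⁅ u ⁆))) + (r ((U ∩ ∁ X) ∪ Z ∪ C) + r ((U ∩ ∁ Y) ∪ Z ∪ (C ∪ ⁅ u ⁆)))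
            ≡⟨ solve 4 (λ a b c d → (a :+ b) :+ (c :+ d) := (a :+ c) :+ (b :+ d)) refl (r (A ∪ X ∪ C)) (r (A ∪ Y ∪ (C ∪ ⁅ u ⁆))) (r ((U ∩ ∁ X) ∪ Z ∪ C)) _ ⟩
          bound X C + bound Y (C ∪ ⁅ u ⁆) ∎

    -- The elements of `U` are deleted or contracted one at a time. Once `U` is empty, robustness at
    -- ⊥ is the linking inequality.
    resolve : ∀ d C U → ∣ U ∣ ≤ d → C ⊆ ∁ U → Robust C U →
      ∃[ C′ ] (C′ ⊆ C ∪ U × r (A ∪ Z ∪ C′) + r C′ + k ≤ r (A ∪ C′) + r (Z ∪ C′))
    resolve d C U size disj rob with Subₚ.nonempty? U
    resolve d C U size disj rob | no empty with refl ← Subₚ.Empty-unique empty =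
      C , tauto (C ∷ []) [] (var zero , var zero ∪ₑ ⊥ₑ) [] , (begin
        r (A ∪ Z ∪ C) + r C + k     ≤⟨ ℕₚ.+-monoˡ-≤ k (ℕₚ.+-monoˡ-≤ (r C) (rank-mono M (τ (a ∪ₑ z ∪ₑ c , a ∪ₑ ⊥ₑ ∪ₑ z ∪ₑ c)))) ⟩
        r (A ∪ ⊥ ∪ Z ∪ C) + r C + k ≤⟨ rob ⊥ (λ p → p) ⟩
        r (A ∪ ⊥ ∪ C) + r ((⊥ ∩ ∁ ⊥) ∪ Z ∪ C) ≤⟨ ℕₚ.+-mono-≤ (rank-mono M (τ (a ∪ₑ ⊥ₑ ∪ₑ c , a ∪ₑ c))) (rank-mono M (τ ((⊥ₑ ∩ₑ ∁ₑ ⊥ₑ) ∪ₑ z ∪ₑ c , z ∪ₑ c))) ⟩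
        r (A ∪ C) + r (Z ∪ C) ∎)
      where
      open ℕₚ.≤-Reasoning
      a z c : SetExpr 3
      a = var (# 0)
      z = var (# 1)
      c = var (# 2)
      τ : ∀ (g : Inclusion 3) → {T (everywhere (entails [] g))} → ⟦ g ⟧⊆ (A ∷ Z ∷ C ∷ [])
      τ g {t} = tauto (A ∷ Z ∷ C ∷ []) [] g {t} []
    resolve zero C U size disj rob | yes (u , u∈) = Empty-elim (ℕₚ.<⇒≱ (ℕₚ.≤-<-trans z≤n (Subₚ.x∈p⇒∣p-x∣<∣p∣ u∈)) size)
    resolve (suc d) C U size disj rob | yes (u , u∈) = recurse (delete-or-contract C U′ u u∉U′ (subst (Robust C) U≡ rob))
      where
      U′ : Subset n
      U′ = U ∩ ∁ ⁅ u ⁆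
      ⁅u⁆⊆U : ⁅ u ⁆ ⊆ U
      ⁅u⁆⊆U p = subst (_∈ U) (sym (Subₚ.x∈⁅y⁆⇒x≡y u p)) u∈
      u∉U′ : u ∉ U′
      u∉U′ p = Subₚ.x∈∁p⇒x∉p (proj₂ (Subₚ.x∈p∩q⁻ U (∁ ⁅ u ⁆) p)) (Subₚ.x∈⁅x⁆ u)
      vU vu vC : SetExpr 3
      vU = var (# 0)
      vu = var (# 1)
      vC = var (# 2)
      τ : ∀ (g : Inclusion 3) → {T (everywhere (entails ((vu , vU) ∷ (vC , ∁ₑ vU) ∷ []) g))} → ⟦ g ⟧⊆ (U ∷ ⁅ u ⁆ ∷ C ∷ [])
      τ g {t} = tauto (U ∷ ⁅ u ⁆ ∷ C ∷ []) ((vu , vU) ∷ (vC , ∁ₑ vU) ∷ []) g {t} (⁅u⁆⊆U ∷ disj ∷ [])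
      U≡ : U ≡ U′ ∪ ⁅ u ⁆
      U≡ = Subₚ.⊆-antisym (τ (vU , (vU ∩ₑ ∁ₑ vu) ∪ₑ vu)) (τ ((vU ∩ₑ ∁ₑ vu) ∪ₑ vu , vU))
      smaller : ∣ U′ ∣ ≤ d
      smaller = ℕ.s≤s⁻¹ (ℕₚ.≤-trans (Subₚ.p⊂q⇒∣p∣<∣q∣ (Subₚ.p∩q⊆p U (∁ ⁅ u ⁆) , u , u∈ , u∉U′)) size)
      recurse : Robust C U′ ⊎ Robust (C ∪ ⁅ u ⁆) U′ →
        ∃[ C′ ] (C′ ⊆ C ∪ U × r (A ∪ Z ∪ C′) + r C′ + k ≤ r (A ∪ C′) + r (Z ∪ C′))
      recurse (inj₁ rob′) with resolve d C U′ smaller (τ (vC , ∁ₑ (vU ∩ₑ ∁ₑ vu))) rob′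
      ... | C′ , sub , h = C′ , (λ p → τ (vC ∪ₑ (vU ∩ₑ ∁ₑ vu) , vC ∪ₑ vU) (sub p)) , h
      recurse (inj₂ rob′) with resolve d (C ∪ ⁅ u ⁆) U′ smaller (τ (vC ∪ₑ vu , ∁ₑ (vU ∩ₑ ∁ₑ vu))) rob′
      ... | C′ , sub , h = C′ , (λ p → τ ((vC ∪ₑ vu) ∪ₑ (vU ∩ₑ ∁ₑ vu) , vC ∪ₑ vU) (sub p)) , h

  -- The last inequality says that `A` and ∁ A′ still have connectivity at least k after contracting
  -- `C` and deleting the rest of the layer. With the whole layer undecided and nothing contracted,
  -- robustness is the hypothesis on the sets between `A` and `A′`.
  tutte : ∀ A A′ k → A ⊆ A′ → (∀ X → A ⊆ X → X ⊆ A′ → r ⊤ + k ≤ κ X) →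
    ∃[ C ] (C ⊆ A′ ∩ ∁ A × r (A ∪ ∁ A′ ∪ C) + r C + k ≤ r (A ∪ C) + r (∁ A′ ∪ C))
  tutte A A′ k A⊆A′ h =
    let C , sub , h′ = Tutte.resolve A (∁ A′) k ∣ A′ ∩ ∁ A ∣ ⊥ (A′ ∩ ∁ A) ℕₚ.≤-refl (λ p → Empty-elim (Subₚ.∉⊥ p)) robust in
    C , (λ p → ∈-∪-elim ⊥ (A′ ∩ ∁ A) (λ q → Empty-elim (Subₚ.∉⊥ q)) (λ q → q) (sub p)) , h′
    where
    rank-⊥ : r ⊥ ≡ 0
    rank-⊥ = ℕₚ.n≤0⇒n≡0 (ℕₚ.≤-trans (rank-bound M ⊥) (ℕₚ.≤-reflexive (Subₚ.∣⊥∣≡0 n)))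
    a a′ x : SetExpr 3
    a = var (# 0)
    a′ = var (# 1)
    x = var (# 2)
    τ : ∀ X → X ⊆ A′ ∩ ∁ A → ∀ (g : Inclusion 3) → {T (everywhere (entails ((a , a′) ∷ (x , a′ ∩ₑ ∁ₑ a) ∷ []) g))} → ⟦ g ⟧⊆ (A ∷ A′ ∷ X ∷ [])
    τ X X⊆U g {t} = tauto (A ∷ A′ ∷ X ∷ []) ((a , a′) ∷ (x , a′ ∩ₑ ∁ₑ a) ∷ []) g {t} (A⊆A′ ∷ X⊆U ∷ [])
    open ℕₚ.≤-Reasoning
    robust : Tutte.Robust A (∁ A′) k ⊥ (A′ ∩ ∁ A)
    robust X X⊆U = begin
        r (A ∪ (A′ ∩ ∁ A) ∪ ∁ A′ ∪ ⊥) + r ⊥ + k ≤⟨ ℕₚ.+-monoˡ-≤ k (ℕₚ.≤-trans (ℕₚ.≤-reflexive (trans (cong (r (A ∪ (A′ ∩ ∁ A) ∪ ∁ A′ ∪ ⊥) +_) rank-⊥) (ℕₚ.+-identityʳ _))) (rank-mono M λ _ → Subₚ.∈⊤)) ⟩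
        r ⊤ + k ≤⟨ h (A ∪ X) ∈-∪ˡ (τ X X⊆U (a ∪ₑ x , a′)) ⟩
        r (A ∪ X) + r (∁ (A ∪ X)) ≤⟨ ℕₚ.+-mono-≤ (rank-mono M (τ X X⊆U (a ∪ₑ x , a ∪ₑ x ∪ₑ ⊥ₑ)))
                                       (rank-mono M (τ X X⊆U (∁ₑ (a ∪ₑ x) , ((a′ ∩ₑ ∁ₑ a) ∩ₑ ∁ₑ x) ∪ₑ ∁ₑ a′ ∪ₑ ⊥ₑ))) ⟩
        r (A ∪ X ∪ ⊥) + r (((A′ ∩ ∁ A) ∩ ∁ X) ∪ ∁ A′ ∪ ⊥) ∎

  -- The ends lie in their own interval, so their connectivity is exactly k: a linkage of order k
  -- then uses up the entire boundary at both ends.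
  Link : ℕ → Subset n → Subset n → Set
  Link k A A′ = A ⊂ A′ × κ A ≤ r ⊤ + k × κ A′ ≤ r ⊤ + k × (∀ X → A ⊆ X → X ⊆ A′ → r ⊤ + k ≤ κ X)

  -- `front` and `rest` are consecutive pieces of `Xs`. The field `head` carries a property of all
  -- of `Xs` over to `first` without exposing the decomposition.
  record Cut (P : Subset n → Set) (m : ℕ) (Xs : List (Subset n)) : Set₁ where
    field
      first last  : Subset n
      front rest  : List (Subset n)
      front-chain : AllPairs _⊂_ (first ∷ front)
      front-P     : All P (first ∷ front)
      front-size  : length (first ∷ front) ≡ suc m
      first≤      : All (first ⊆_) (first ∷ front)
      ≤last       : All (_⊆ last) (first ∷ front)
      rest-chain  : AllPairs _⊂_ rest
      rest-P      : All P rest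
      last<rest   : All (last ⊂_) rest
      rest-size   : suc m + length rest ≡ length Xs
      head        : ∀ {Q : Subset n → Set} → All Q Xs → Q first

  cut : ∀ {P} m Xs → AllPairs _⊂_ Xs → All P Xs → suc m ≤ length Xs → Cut P m Xs
  cut zero (X ∷ Xs) (lt ∷ ch) (p ∷ ps) (s≤s l) = record
    { first = X ; last = X ; front = [] ; rest = Xs ; front-chain = [] ∷ [] ; front-P = p ∷ [] ; front-size = refl
    ; first≤ = (λ q → q) ∷ [] ; ≤last = (λ q → q) ∷ [] ; rest-chain = ch ; rest-P = ps ; last<rest = lt ; rest-size = refl
    ; head = λ { (q ∷ _) → q } }
  cut {P} (suc m) (X ∷ Xs) (lt ∷ ch) (p ∷ ps) (s≤s l) = record
    { first = X ; last = C.last ; front = C.first ∷ C.front ; rest = C.rest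
    ; front-chain = All.map (Subₚ.⊂-⊆-trans X<first) C.first≤ ∷ C.front-chain
    ; front-P = p ∷ C.front-P ; front-size = cong suc C.front-size
    ; first≤ = (λ q → q) ∷ All.map {P = C.first ⊆_} {Q = X ⊆_} (λ {Y} s → proj₁ (Subₚ.⊂-⊆-trans {i = X} {C.first} {Y} X<first s)) C.first≤
    ; ≤last = proj₁ (Subₚ.⊂-⊆-trans X<first (All.head C.≤last)) ∷ C.≤last
    ; rest-chain = C.rest-chain ; rest-P = C.rest-P ; last<rest = C.last<rest ; rest-size = cong suc C.rest-size
    ; head = λ { (q ∷ _) → q } }
    where
    module C = Cut (cut {P} m Xs ch ps l)
    X<first : X ⊂ C.first
    X<first = C.head lt

  link-up : ∀ {k A A′ Xs} → AllPairs _⊂_ Xs → All (λ X → κ X ≤ r ⊤ + k) Xs → All (A ⊆_) Xs → All (_⊆ A′) Xs →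
    (∀ X → A ⊆ X → X ⊆ A′ → r ⊤ + k ≤ κ X) → Linked (Link k) Xs
  link-up [] _ _ _ _ = []
  link-up (_ ∷ []) _ _ _ _ = [-]
  link-up ((lt ∷ _) ∷ ch@(_ ∷ _)) (p ∷ ps@(q ∷ _)) (a ∷ as) (_ ∷ bs@(b ∷ _)) h =
    (lt , p , q , λ X s t → h X (λ x → s (a x)) (λ x → b (t x))) ∷ link-up ch ps as bs h

  -- The chain is cut into g blocks of m + 1 sets: if no block is linked at level k + 1, each
  -- contains a set of connectivity at most k between its ends.
  blocks : ∀ k m g Xs → AllPairs _⊂_ Xs → All (λ X → κ X ≤ r ⊤ + suc k) Xs → g * suc m ≤ length Xs →
    (∃[ Ys ] (length Ys ≡ suc m × Linked (Link (suc k)) Ys)) ⊎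
    (∃[ Ys ] (length Ys ≡ g × AllPairs _⊂_ Ys × All (λ X → κ X ≤ r ⊤ + k) Ys × (∀ B → All (B ⊂_) Xs → All (B ⊂_) Ys)))
  blocks k m zero Xs ch ps l = inj₂ ([] , refl , [] , [] , λ _ _ → [])
  blocks k m (suc g) Xs ch ps l
    with Subₚ.anySubset? (λ X → (C.first Subₚ.⊆? X) ×-dec (X Subₚ.⊆? C.last) ×-dec (κ X ℕₚ.≤? r ⊤ + k))
    where module C = Cut (cut {λ X → κ X ≤ r ⊤ + suc k} m Xs ch ps (ℕₚ.≤-trans (ℕₚ.m≤m+n (suc m) _) l))
  ... | no ¬narrow = inj₁ (C.first ∷ C.front , C.front-size ,
          link-up C.front-chain C.front-P C.first≤ C.≤last λ X s t →
            ℕₚ.≤-trans (ℕₚ.≤-reflexive (ℕₚ.+-suc (r ⊤) k)) (ℕₚ.≰⇒> λ p → ¬narrow (X , s , t , p)))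
    where module C = Cut (cut {λ X → κ X ≤ r ⊤ + suc k} m Xs ch ps (ℕₚ.≤-trans (ℕₚ.m≤m+n (suc m) _) l))
  ... | yes (X , s , t , p) with blocks k m g C.rest C.rest-chain C.rest-P
          (ℕₚ.+-cancelˡ-≤ (suc m) _ _ (ℕₚ.≤-trans l (ℕₚ.≤-reflexive (sym C.rest-size))))
    where module C = Cut (cut {λ X → κ X ≤ r ⊤ + suc k} m Xs ch ps (ℕₚ.≤-trans (ℕₚ.m≤m+n (suc m) _) l))
  ...   | inj₁ found = inj₁ found
  -- `X` lies below `last`, hence strictly below every set of the later blocks; `up` passes such
  -- strict lower bounds on to the sets selected there, so the selection is again a chain.
  ...   | inj₂ (Ys , size , ch′ , ps′ , up) =
          inj₂ (X ∷ Ys , cong suc size , up X (All.map (Subₚ.⊆-⊂-trans t) C.last<rest) ∷ ch′ , p ∷ ps′ ,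
            λ B bs → let B<X = Subₚ.⊂-⊆-trans (C.head bs) s in B<X ∷ up B (All.map (λ q → Subₚ.⊂-⊆-trans B<X (proj₁ (Subₚ.⊆-⊂-trans t q))) C.last<rest))
    where module C = Cut (cut {λ X → κ X ≤ r ⊤ + suc k} m Xs ch ps (ℕₚ.≤-trans (ℕₚ.m≤m+n (suc m) _) l))

  -- Either level k already has a linked block, or a chain of lower connectivity survives. The
  -- descent stops at level 0, where submodularity bounds every set from below and any m + 1 sets
  -- are linked.
  thin : ∀ k m Xs → AllPairs _⊂_ Xs → All (λ X → κ X ≤ r ⊤ + k) Xs → chainBound k m ≤ length Xs →
    ∃[ k′ ] ∃[ Ys ] (k′ ≤ k × length Ys ≡ suc m × Linked (Link k′) Ys)
  thin zero m Xs ch ps l = zero , C.first ∷ C.front , z≤n , C.front-size ,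
      link-up C.front-chain C.front-P C.first≤ C.≤last λ X _ _ → bottom X
    where
    module C = Cut (cut {λ X → κ X ≤ r ⊤ + 0} m Xs ch ps l)
    bottom : ∀ X → r ⊤ + 0 ≤ κ X
    bottom X = ℕₚ.≤-trans (ℕₚ.≤-reflexive (ℕₚ.+-identityʳ _)) (ℕₚ.≤-trans (ℕₚ.m≤m+n _ _)
      (rank-submod-⊆ M ⊤ ⊥ X (∁ X) (tauto (X ∷ []) [] (⊤ₑ , var zero ∪ₑ ∁ₑ (var zero)) []) (λ p → Empty-elim (Subₚ.∉⊥ p)) (λ p → Empty-elim (Subₚ.∉⊥ p))))
  thin (suc k) m Xs ch ps l with blocks k m (chainBound k m) Xs ch ps l
  ... | inj₁ (Ys , size , links) = suc k , Ys , ℕₚ.≤-refl , size , links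
  ... | inj₂ (Ys , size , ch′ , ps′ , _) = let k′ , Zs , k′≤k , size′ , links = thin k m Ys ch′ ps′ (ℕₚ.≤-reflexive (sym size)) in
        k′ , Zs , ℕₚ.m≤n⇒m≤1+n k′≤k , size′ , links

-- Splitting layouts into two sweeps and gluing them back

module Sweeps {n : ℕ} where
  open ≡ using (refl; sym; trans)
  open Subsets
  open SetReasoning

  data Sweep (A : Subset n) : Subset n → List (Subset n) → Set where
    stop : Sweep A A []
    add  : ∀ {X Xs} j → j ∈ A → j ∉ X → Sweep A (X ∪ ⁅ j ⁆) Xs → Sweep A X ((X ∪ ⁅ j ⁆) ∷ Xs)

  add-⊆ : ∀ {A X : Subset n} {j} → X ⊆ A → j ∈ A → X ∪ ⁅ j ⁆ ⊆ A
  add-⊆ {A} {X} {j} X⊆A j∈A = ∈-∪-elim X ⁅ j ⁆ X⊆A (λ p → subst (_∈ A) (sym (Subₚ.x∈⁅y⁆⇒x≡y j p)) j∈A)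

  sweep-above : ∀ {A B X Xs} → Sweep A X Xs → B ⊆ X → All (B ⊆_) (X ∷ Xs)
  sweep-above stop            B⊆X = B⊆X ∷ []
  sweep-above (add j _ _ s) B⊆X = B⊆X ∷ sweep-above s (λ p → ∈-∪ˡ (B⊆X p))

  sweep-chain : ∀ {A X Xs} → Sweep A X Xs → AllPairs _⊆_ (X ∷ Xs)
  sweep-chain stop          = [] ∷ []
  sweep-chain (add j _ _ s) = sweep-above s ∈-∪ˡ ∷ sweep-chain s

  ∩-add-in : ∀ {U A : Subset n} {j} → j ∈ A → (U ∪ ⁅ j ⁆) ∩ A ≡ (U ∩ A) ∪ ⁅ j ⁆
  ∩-add-in {U} {A} {j} j∈ = Subₚ.⊆-antisym (τ ((u ∪ₑ s) ∩ₑ a , (u ∩ₑ a) ∪ₑ s)) (τ ((u ∩ₑ a) ∪ₑ s , (u ∪ₑ s) ∩ₑ a))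
    where
    u a s : SetExpr 3
    u = var (# 0)
    a = var (# 1)
    s = var (# 2)
    τ : ∀ (g : Inclusion 3) → {T (everywhere (entails ((s , a) ∷ []) g))} → ⟦ g ⟧⊆ (U ∷ A ∷ ⁅ j ⁆ ∷ [])
    τ g {t} = tauto (U ∷ A ∷ ⁅ j ⁆ ∷ []) ((s , a) ∷ []) g {t} ((λ p → subst (_∈ A) (sym (Subₚ.x∈⁅y⁆⇒x≡y j p)) j∈) ∷ [])

  ∩-add-out : ∀ {U A : Subset n} {j} → j ∉ A → (U ∪ ⁅ j ⁆) ∩ A ≡ U ∩ A
  ∩-add-out {U} {A} {j} j∉ = Subₚ.⊆-antisym (τ ((u ∪ₑ s) ∩ₑ a , u ∩ₑ a)) (τ (u ∩ₑ a , (u ∪ₑ s) ∩ₑ a))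
    where
    u a s : SetExpr 3
    u = var (# 0)
    a = var (# 1)
    s = var (# 2)
    τ : ∀ (g : Inclusion 3) → {T (everywhere (entails ((s , ∁ₑ a) ∷ []) g))} → ⟦ g ⟧⊆ (U ∷ A ∷ ⁅ j ⁆ ∷ [])
    τ g {t} = tauto (U ∷ A ∷ ⁅ j ⁆ ∷ []) ((s , ∁ₑ a) ∷ []) g {t}
      ((λ p → Subₚ.x∉p⇒x∈∁p λ q → j∉ (subst (_∈ A) (Subₚ.x∈⁅y⁆⇒x≡y j p) q)) ∷ [])

module Gluing (Color : Set) (_≟ᶜ_ : DecidableEquality Color) where
  open ≡ using (refl; sym; trans)
  open WordsOver Color _≟ᶜ_
  open Subsets
  open SetReasoning

  -- Makes the walk end in the far corner of the grid: the word is used up and only the final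
  -- environment is left.
  Last : List Env → Set
  Last []          = Empty
  Last (_ ∷ [])    = Unit₀
  Last (_ ∷ _ ∷ _) = Empty

  module _ {n : ℕ} (A Z : Subset n) (Z⊆∁A : Z ⊆ ∁ A) (st : Subset n → State) (env : Subset n → Env) {ok : Subset n → Set} where
    open Sweeps {n}

    -- Each new element of the layout enlarges its trace on `A` or its trace on `Z`, never both, so
    -- the pairs of traces form a staircase. The last component remembers for every trace on `A` an
    -- outside set it met, from which its connectivity is bounded later.
    split : (∀ {X Y} → X ⊆ A → Y ⊆ Z → ok (X ∪ Y) → proj₁ (env Y) (st X)) → ∀ {U} → Path ok (A ∪ Z) U →
      ∃[ Xs ] ∃[ Ys ] (Sweep A (U ∩ A) Xs × Sweep Z (U ∩ Z) Ys ×
        Run (map st ((U ∩ A) ∷ Xs)) Last (map env ((U ∩ Z) ∷ Ys)) ×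
        All (λ X → ∃[ Y ] (X ⊆ A × Y ⊆ Z × ok (X ∪ Y))) ((U ∩ A) ∷ Xs))
    split h p = go p
      where
      A∩ : (A ∪ Z) ∩ A ≡ A
      A∩ = Subₚ.⊆-antisym (Subₚ.p∩q⊆q _ A) (λ q → Subₚ.x∈p∩q⁺ (∈-∪ˡ q , q))
      Z∩ : (A ∪ Z) ∩ Z ≡ Z
      Z∩ = Subₚ.⊆-antisym (Subₚ.p∩q⊆q _ Z) (λ q → Subₚ.x∈p∩q⁺ (∈-∪ʳ {X = A} q , q))
      parts : ∀ {U} → U ⊆ A ∪ Z → (U ∩ A) ∪ (U ∩ Z) ≡ U
      parts {U} U⊆ = Subₚ.⊆-antisym
        (∈-∪-elim (U ∩ A) (U ∩ Z) (Subₚ.p∩q⊆p U A) (Subₚ.p∩q⊆p U Z))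
        (λ q → ∈-∪-elim A Z (λ a → ∈-∪ˡ (Subₚ.x∈p∩q⁺ (q , a))) (λ z → ∈-∪ʳ {X = U ∩ A} (Subₚ.x∈p∩q⁺ (q , z))) (U⊆ q))
      cell : ∀ {U} → Path ok (A ∪ Z) U → ok U → proj₁ (env (U ∩ Z)) (st (U ∩ A))
      cell {U} p o = h (Subₚ.p∩q⊆q U A) (Subₚ.p∩q⊆q U Z) (subst ok (sym (parts (path-⊆ p))) o)
      seen : ∀ {U} → Path ok (A ∪ Z) U → ok U → ∃[ Y ] (U ∩ A ⊆ A × Y ⊆ Z × ok ((U ∩ A) ∪ Y))
      seen {U} p o = U ∩ Z , Subₚ.p∩q⊆q U A , Subₚ.p∩q⊆q U Z , subst ok (sym (parts (path-⊆ p))) o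
      in-Z : ∀ {U j} → Path ok (A ∪ Z) (U ∪ ⁅ j ⁆) → j ∉ A → j ∈ Z
      in-Z {U} {j} p j∉A = ∈-∪-elim A Z (λ q → Empty-elim (j∉A q)) (λ q → q) (path-⊆ p (∈-∪ʳ {X = U} (Subₚ.x∈⁅x⁆ j)))
      go : ∀ {U} → Path ok (A ∪ Z) U →
        ∃[ Xs ] ∃[ Ys ] (Sweep A (U ∩ A) Xs × Sweep Z (U ∩ Z) Ys ×
          Run (map st ((U ∩ A) ∷ Xs)) Last (map env ((U ∩ Z) ∷ Ys)) ×
          All (λ X → ∃[ Y ] (X ⊆ A × Y ⊆ Z × ok (X ∪ Y))) ((U ∩ A) ∷ Xs))
      go p@(done o) = [] , [] , subst (λ X → Sweep A X []) (sym A∩) stop , subst (λ X → Sweep Z X []) (sym Z∩) stop ,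
        (cell p o , inj₁ tt) , seen p o ∷ []
      go {U} p@(step j o j∉ p′) with go p′ | j Subₚ.∈? A
      ... | Xs , Ys , sX , sY , run , sn | yes j∈A
        rewrite ∩-add-in {U} {A} j∈A | ∩-add-out {U} {Z} (λ j∈Z → Subₚ.x∈∁p⇒x∉p (Z⊆∁A j∈Z) j∈A) =
          ((U ∩ A) ∪ ⁅ j ⁆) ∷ Xs , Ys , add j j∈A (λ q → j∉ (Subₚ.p∩q⊆p U A q)) sX , sY , (cell p o , inj₁ run) , seen p o ∷ sn
      ... | Xs , Ys , sX , sY , run , _ ∷ sn | no j∉A
        rewrite ∩-add-out {U} {A} j∉A | ∩-add-in {U} {Z} (in-Z p′ j∉A) =
          Xs , ((U ∩ Z) ∪ ⁅ j ⁆) ∷ Ys , sX , add j (in-Z p′ j∉A) (λ q → j∉ (Subₚ.p∩q⊆p U Z q)) sY , (cell p o , inj₂ run) , seen p o ∷ sn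

    -- The converse reading of a staircase: a step along the word adds an element of `A`, a step
    -- along the environments adds an element of `Z`.
    glue : (∀ {X Y} → X ⊆ A → Y ⊆ Z → proj₁ (env Y) (st X) → ok (X ∪ Y)) →
      ∀ {X Y Xs Ys} → X ⊆ A → Y ⊆ Z → Sweep A X Xs → Sweep Z Y Ys →
      Run (map st (X ∷ Xs)) Last (map env (Y ∷ Ys)) → Path ok (A ∪ Z) (X ∪ Y)
    glue h X⊆A Y⊆Z stop stop (e , inj₁ _) = done (h X⊆A Y⊆Z e)
    glue h X⊆A Y⊆Z stop (add j j∈ j∉ sY) (e , inj₁ ())
    glue h X⊆A Y⊆Z stop stop (e , inj₂ ())
    glue h {X} {Y} X⊆A Y⊆Z (add j j∈ j∉ sX) sY (e , inj₁ run) = step j (h X⊆A Y⊆Z e)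
      (∈-∪-elim X Y j∉ (λ q → Subₚ.x∈∁p⇒x∉p (Z⊆∁A (Y⊆Z q)) j∈))
      (subst (Path ok (A ∪ Z)) eq (glue h (add-⊆ X⊆A j∈) Y⊆Z sX sY run))
      where
      x y s : SetExpr 3
      x = var (# 0)
      y = var (# 1)
      s = var (# 2)
      eq : (X ∪ ⁅ j ⁆) ∪ Y ≡ (X ∪ Y) ∪ ⁅ j ⁆
      eq = Subₚ.⊆-antisym (tauto (X ∷ Y ∷ ⁅ j ⁆ ∷ []) [] ((x ∪ₑ s) ∪ₑ y , (x ∪ₑ y) ∪ₑ s) []) (tauto (X ∷ Y ∷ ⁅ j ⁆ ∷ []) [] ((x ∪ₑ y) ∪ₑ s , (x ∪ₑ s) ∪ₑ y) [])
    glue h {X} {Y} X⊆A Y⊆Z sX (add j j∈ j∉ sY) (e , inj₂ run) = step j (h X⊆A Y⊆Z e)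
      (∈-∪-elim X Y (λ q → Subₚ.x∈∁p⇒x∉p (Z⊆∁A j∈) (X⊆A q)) j∉)
      (subst (Path ok (A ∪ Z)) (sym (Subₚ.∪-assoc X Y ⁅ j ⁆)) (glue h X⊆A (add-⊆ Y⊆Z j∈) sX sY run))
    glue h X⊆A Y⊆Z (add _ _ _ _) stop (e , inj₂ ())

-- Coordinates on boundaries and exchange of sides

module Boundaries {a ℓ} (F : FiniteField a ℓ) {m n} (A : Fin m → Fin n → FiniteField.Carrier F) (M : Matroid n) (rep : Represents F A M) (K : ℕ) where
  open LinearAlgebra F
  open FiniteField F hiding (zero)
  open import Algebra.Properties.Ring ring using (-‿involutive)
  open Subsets
  open SetReasoning
  open MatroidLinking M

  v : Fin n → V m
  v = col A

  r : Subset n → ℕ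
  r = rank M

  r-cols : ∀ X → r X ≡ rk (cols v X)
  r-cols = rank-cols {A = A} {M} rep

  Sp : Subset n → V m → Set (a ⊔ ℓ)
  Sp X = Span (cols v X)

  cols-∪ : ∀ X Y → All (Span (cols v X ++ cols v Y)) (cols v (X ∪ Y))
  cols-∪ X Y = cols-All v (X ∪ Y) λ j p → span-elem (locate p)
    where
    locate : ∀ {j} → j ∈ X ∪ Y → v j Mem.∈ cols v X ++ cols v Y
    locate p with Subₚ.x∈p∪q⁻ X Y p
    ... | inj₁ q = Memₚ.∈-++⁺ˡ (cols-∈ v q)
    ... | inj₂ q = Memₚ.∈-++⁺ʳ (cols v X) (cols-∈ v q)

  cols-∪⁻ : ∀ X Y → All (Sp (X ∪ Y)) (cols v X ++ cols v Y)
  cols-∪⁻ X Y = Allₚ.++⁺ (cols-⊆ v X (X ∪ Y) ∈-∪ˡ) (cols-⊆ v Y (X ∪ Y) (∈-∪ʳ {X = X}))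

  r-∪ : ∀ X Y → r (X ∪ Y) ≡ rk (cols v X ++ cols v Y)
  r-∪ X Y = ≡.trans (r-cols (X ∪ Y)) (rk-≡ (cols-∪ X Y) (cols-∪⁻ X Y))

  sp-split : ∀ X Y {u} → Sp (X ∪ Y) u → ∃[ s ] ∃[ t ] (Sp X s × Sp Y t × (∀ i → u i ≈ s i + t i))
  sp-split X Y p = span-split (cols v X) (span-trans (cols-∪ X Y) p)

  _⊖_ : V m → V m → V m
  (u ⊖ w) i = - 1# * w i + u i

  sp-⊖ : ∀ {xs : List (V m)} {u w} → Span xs u → Span xs w → Span xs (u ⊖ w)
  sp-⊖ p q = span-comb (- 1#) q p λ i → refl

  ⊖-+ : ∀ (u w : V m) i → u i ≈ w i + (u ⊖ w) i
  ⊖-+ u w i = trans (move refl) (+-congʳ (trans (*-congʳ (-‿involutive 1#)) (*-identityˡ _)))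

  +-⊖ : ∀ {u s t : V m} → (∀ i → u i ≈ s i + t i) → ∀ i → t i ≈ (u ⊖ s) i
  +-⊖ e i = sub-eq (e i)

  +-swap : ∀ {u s t : V m} → (∀ i → u i ≈ s i + t i) → ∀ i → u i ≈ t i + s i
  +-swap e i = trans (e i) (+-comm _ _)

  ⊖-⊖ : ∀ (a b d : V m) i → (a ⊖ d) i ≈ 1# * (a ⊖ b) i + (b ⊖ d) i
  ⊖-⊖ a b d i = trans (+-congˡ (⊖-+ a b i)) (trans (regroup (- 1# * d i) (b i) ((a ⊖ b) i)) (+-congʳ (sym (*-identityˡ _))))
    where
    open import Algebra.Solver.Ring.NaturalCoefficients.Default commutativeSemiring
    regroup : ∀ p q w → p + (q + w) ≈ w + (p + q)
    regroup = solve 3 (λ p q w → p :+ (q :+ w) := w :+ (p :+ q)) refl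

  -- The hypothesis says that span X meets span Y and span Y′ in the same dimension.
  meet-stable : ∀ X Y Y′ → r Y′ ℕ.+ r (X ∪ Y) ≤ r Y ℕ.+ r (X ∪ Y′) → ∀ {u} → Y ⊆ Y′ → Sp X u → Sp Y′ u → Sp Y u
  meet-stable X Y Y′ h {u} Y⊆Y′ p q with Span? (cols v Y) u
  ... | yes s = s
  ... | no ¬s = Empty-elim (ℕₚ.<⇒≱ (s≤s h) (begin
      suc (r Y ℕ.+ r (X ∪ Y′)) ≡⟨ cong₂ (λ a b → suc (a ℕ.+ b)) (r-cols Y) (r-cols (X ∪ Y′)) ⟩
      suc (rk (cols v Y) ℕ.+ rk (cols v (X ∪ Y′))) ≡⟨ ℕₚ.+-comm (suc (rk (cols v Y))) _ ⟩
      rk (cols v (X ∪ Y′)) ℕ.+ suc (rk (cols v Y)) ≡⟨ cong (λ g → rk (cols v (X ∪ Y′)) ℕ.+ (g ℕ.+ rk (cols v Y))) (≡.sym (gain-out {xs = cols v Y} ¬s)) ⟩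
      rk (cols v (X ∪ Y′)) ℕ.+ rk (u ∷ cols v Y)
        ≤⟨ rk-submod (cols v (X ∪ Y′)) (u ∷ cols v Y) (cols v (X ∪ Y)) (cols v Y′)
             (All.map (span-trans (Allₚ.++⁺ (All.map (span-mono Memₚ.∈-++⁺ˡ) (cols-⊆ v X (X ∪ Y) ∈-∪ˡ)) (span-all (Memₚ.∈-++⁺ʳ (cols v (X ∪ Y)))))) (cols-∪ X Y′))
             (span-⊆ v X (X ∪ Y) ∈-∪ˡ p ∷ cols-⊆ v Y (X ∪ Y) (∈-∪ʳ {X = X})) (q ∷ cols-⊆ v Y Y′ Y⊆Y′) ⟩
      rk (cols v (X ∪ Y)) ℕ.+ rk (cols v Y′) ≡⟨ cong₂ ℕ._+_ (≡.sym (r-cols (X ∪ Y))) (≡.sym (r-cols Y′)) ⟩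
      r (X ∪ Y) ℕ.+ r Y′ ≡⟨ ℕₚ.+-comm (r (X ∪ Y)) _ ⟩
      r Y′ ℕ.+ r (X ∪ Y) ∎))
    where open ℕₚ.≤-Reasoning

  Skew : Subset n → Subset n → Set (a ⊔ ℓ)
  Skew X Y = ∀ {u} → Sp X u → Sp Y u → ∀ i → u i ≈ 0#

  skew : ∀ X Y → r X ℕ.+ r Y ≤ r (X ∪ Y) → Skew X Y
  skew X Y h {u} p q with Span? [] u
  ... | yes (nil z) = z
  ... | no ¬z = Empty-elim (ℕₚ.<⇒≱ (ℕₚ.≤-refl {suc (r X ℕ.+ r Y)}) (begin
      suc (r X ℕ.+ r Y) ≤⟨ s≤s h ⟩
      suc (r (X ∪ Y)) ≡⟨ ≡.trans (cong suc (r-cols (X ∪ Y))) (ℕₚ.+-comm 1 _) ⟩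
      rk (cols v (X ∪ Y)) ℕ.+ 1 ≡⟨ cong (rk (cols v (X ∪ Y)) ℕ.+_) (≡.sym (≡.trans (ℕₚ.+-identityʳ _) (gain-out {xs = []} ¬z))) ⟩
      rk (cols v (X ∪ Y)) ℕ.+ rk (u ∷ []) ≤⟨ rk-submod (cols v (X ∪ Y)) (u ∷ []) (cols v X) (cols v Y) (cols-∪ X Y) (p ∷ []) (q ∷ []) ⟩
      rk (cols v X) ℕ.+ rk (cols v Y) ≡⟨ cong₂ ℕ._+_ (≡.sym (r-cols X)) (≡.sym (r-cols Y)) ⟩
      r X ℕ.+ r Y ∎))
    where open ℕₚ.≤-Reasoning

  -- Since the two spans share only 0, a column of `X` is new over `Y` and earlier columns exactly
  -- when it is new over the earlier columns alone.
  skew-rank : ∀ X Y → Skew X Y → r X ℕ.+ r Y ≡ r (X ∪ Y)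
  skew-rank X Y sk = ≡.trans (≡.trans (cong₂ ℕ._+_ (r-cols X) (r-cols Y)) (≡.sym eq)) (≡.sym (r-∪ X Y))
    where
    eq : rk (cols v X ++ cols v Y) ≡ rk (cols v X) ℕ.+ rk (cols v Y)
    eq = ≡.trans (≡.sym (ℕₚ.+-identityʳ _)) (≡.trans
      (rk-same-gain {xs = cols v Y} {ys = []} (cols v X) λ ws w sub →
        (λ p → let s , t , ps , pt , e = span-split ws p
                   ws⊆ : ∀ {x} → Span ws x → Sp X x
                   ws⊆ = span-mono (λ q → sub (there q))
                   t≈0 = sk (span-resp (λ i → sym (+-⊖ e i)) (sp-⊖ (span-elem (sub (here ≡.refl))) (ws⊆ ps))) pt in
               span-mono Memₚ.∈-++⁺ˡ (span-resp (λ i → sym (trans (e i) (trans (+-congˡ (t≈0 i)) (+-identityʳ _)))) ps)) ,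
        (λ p → span-trans (Allₚ.++⁺ (span-all Memₚ.∈-++⁺ˡ) []) p))
      (cong (ℕ._+ rk (cols v Y)) (rk-≡ {ys = cols v X} (Allₚ.++⁺ (span-refl _) []) (span-all Memₚ.∈-++⁺ˡ))))

  -- The family `β` gives a linear map from F^K onto the boundary of `side`. It need not be
  -- injective, so boundaries of smaller dimension fit the same coordinates.
  record Node : Set (a ⊔ ℓ) where
    field
      side    : Subset n
      β       : Fin K → V m
      β-in    : ∀ t → Sp side (β t)
      β-out   : ∀ t → Sp (∁ side) (β t)
      β-spans : ∀ {u} → Sp side u → Sp (∁ side) u → ∃[ a ] (∀ i → u i ≈ lin β a i)
  open Node public

  initialNode : ∀ S → κ S ≤ r ⊤ ℕ.+ K → ∃[ N ] (side N ≡ S)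
  initialNode S h = record
    { side = S ; β = pad bs K ; β-in = pad-span bs K in-S ; β-out = pad-span bs K out-S
    ; β-spans = λ p q → span⇒lin bs K short (spans _ p q) } , ≡.refl
    where
    I = intersection (cols v S) (cols v (∁ S))
    bs = proj₁ I
    in-S = proj₁ (proj₂ (proj₂ I))
    out-S = proj₁ (proj₂ (proj₂ (proj₂ I)))
    spans = proj₂ (proj₂ (proj₂ (proj₂ I)))
    open ℕₚ.≤-Reasoning
    short : length bs ≤ K
    short = ℕₚ.+-cancelʳ-≤ (r ⊤) _ _ (begin
      length bs ℕ.+ r ⊤ ≤⟨ ℕₚ.+-monoʳ-≤ (length bs) (ℕₚ.≤-trans (rank-mono M (λ {j} _ → cover j)) (ℕₚ.≤-reflexive (r-∪ S (∁ S)))) ⟩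
      length bs ℕ.+ rk (cols v S ++ cols v (∁ S)) ≡⟨ proj₁ (proj₂ I) ⟩
      rk (cols v S) ℕ.+ rk (cols v (∁ S)) ≡⟨ cong₂ ℕ._+_ (≡.sym (r-cols S)) (≡.sym (r-cols (∁ S))) ⟩
      κ S ≤⟨ h ⟩
      r ⊤ ℕ.+ K ≡⟨ ℕₚ.+-comm (r ⊤) K ⟩
      K ℕ.+ r ⊤ ∎)
      where
      cover : ∀ j → j ∈ S ∪ ∁ S
      cover j = subst (j ∈_) (≡.sym (Subₚ.p∪∁p≡⊤ S)) Subₚ.∈⊤

  -- Contracting C and deleting the rest of side y − side x identifies the two boundaries.
  record _⟶_ (x y : Node) : Set (a ⊔ ℓ) where
    field
      C      : Subset n
      grows  : side x ⊂ side y
      C⊆     : C ⊆ side y ∩ ∁ (side x)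
      C-skew : Skew (side x) C
      β-mod  : ∀ t → Sp C (β x t ⊖ β y t)

  -- The two contracted sets lie in successive layers. If a vector of the span of `side x` is a sum
  -- over both, its `Q.C` part lies in the span of `side y` and so vanishes; `P.C` is then skew as
  -- before. The differences of coordinates telescope.
  ⟶-trans : ∀ {x y z} → x ⟶ y → y ⟶ z → x ⟶ z
  ⟶-trans {x} {y} {z} p q = record
    { C = P.C ∪ Q.C
    ; grows = Subₚ.⊂-trans P.grows Q.grows
    ; C⊆ = ∈-∪-elim P.C Q.C
        (λ s → let a , b = Subₚ.x∈p∩q⁻ (side y) _ (P.C⊆ s) in Subₚ.x∈p∩q⁺ (proj₁ Q.grows a , b))
        (λ s → let a , b = Subₚ.x∈p∩q⁻ (side z) _ (Q.C⊆ s) in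
          Subₚ.x∈p∩q⁺ (a , Subₚ.x∉p⇒x∈∁p λ t → Subₚ.x∈∁p⇒x∉p b (proj₁ P.grows t)))
    ; C-skew = λ {u} a b → let s , t , ps , pt , e = sp-split P.C Q.C b
                               t≈0 = Q.C-skew (span-resp (λ i → sym (+-⊖ e i)) (sp-⊖ (span-⊆ v (side x) (side y) (proj₁ P.grows) a) (span-⊆ v P.C (side y) (λ j∈ → Subₚ.p∩q⊆p (side y) _ (P.C⊆ j∈)) ps))) pt in
                           P.C-skew a (span-resp (λ i → sym (trans (e i) (trans (+-congˡ (t≈0 i)) (+-identityʳ _)))) ps)
    ; β-mod = λ t → span-comb 1# (span-⊆ v P.C (P.C ∪ Q.C) ∈-∪ˡ (P.β-mod t)) (span-⊆ v Q.C (P.C ∪ Q.C) (∈-∪ʳ {X = P.C}) (Q.β-mod t))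
        (⊖-⊖ (β x t) (β y t) (β z t))
    }
    where
    module P = _⟶_ p
    module Q = _⟶_ q

  lin-mod : ∀ {x y} (p : x ⟶ y) a → Sp (_⟶_.C p) (lin (β x) a ⊖ lin (β y) a)
  lin-mod {x} {y} p a = span-resp (lin-comb (- 1#) (β y) (β x) _ a λ t i → refl) (lin-span _ a (_⟶_.β-mod p))

  -- Connectivity is k at `S`, at `S′`, and at least k after the contraction. Submodularity then
  -- forces `C` to be skew to `S` and to ∁ S′, and puts the boundary of `S` into the span of ∁ S′ ∪
  -- C and that of `S′` into the span of S ∪ C.
  module Step (x : Node) (S′ : Subset n) (k : ℕ) (link : Link k (side x) S′) where
    open ℕₚ.≤-Reasoning
    open +-*-Solver

    S : Subset n
    S = side x

    S⊆S′ : S ⊆ S′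
    S⊆S′ = proj₁ (proj₁ link)

    linked = tutte S S′ k S⊆S′ (proj₂ (proj₂ (proj₂ link)))

    C : Subset n
    C = proj₁ linked

    C⊆ : C ⊆ S′ ∩ ∁ S
    C⊆ = proj₁ (proj₂ linked)

    τ : ∀ (g : Inclusion 3) → {T (everywhere (entails ((var (# 0) , var (# 1)) ∷ (var (# 2) , var (# 1) ∩ₑ ∁ₑ (var (# 0))) ∷ []) g))} → ⟦ g ⟧⊆ (S ∷ S′ ∷ C ∷ [])
    τ g {t} = tauto (S ∷ S′ ∷ C ∷ []) ((var (# 0) , var (# 1)) ∷ (var (# 2) , var (# 1) ∩ₑ ∁ₑ (var (# 0))) ∷ []) g {t} (S⊆S′ ∷ C⊆ ∷ [])

    s s′ c : SetExpr 3
    s = var (# 0)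
    s′ = var (# 1)
    c = var (# 2)

    t rA rZ rA′ rZ′ rC x₀ p q : ℕ
    t = r ⊤
    rA = r S
    rZ = r (∁ S)
    rA′ = r S′
    rZ′ = r (∁ S′)
    rC = r C
    x₀ = r (S ∪ ∁ S′ ∪ C)
    p = r (S ∪ C)
    q = r (∁ S′ ∪ C)

    κS : rA ℕ.+ rZ ≤ t ℕ.+ k
    κS = proj₁ (proj₂ link)

    κS′ : rA′ ℕ.+ rZ′ ≤ t ℕ.+ k
    κS′ = proj₁ (proj₂ (proj₂ link))

    linking : x₀ ℕ.+ rC ℕ.+ k ≤ p ℕ.+ q
    linking = proj₂ (proj₂ linked)

    S-skew-C : rA ℕ.+ rC ≤ p
    S-skew-C = ℕₚ.+-cancelʳ-≤ (t ℕ.+ q ℕ.+ rZ ℕ.+ x₀ ℕ.+ k) _ _ (begin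
      rA ℕ.+ rC ℕ.+ (t ℕ.+ q ℕ.+ rZ ℕ.+ x₀ ℕ.+ k)
        ≡⟨ solve 7 (λ rA rC t q rZ x k → rA :+ rC :+ (t :+ q :+ rZ :+ x :+ k) := (t :+ q) :+ ((rA :+ rZ) :+ (x :+ rC :+ k))) ≡.refl rA rC t q rZ x₀ k ⟩
      (t ℕ.+ q) ℕ.+ ((rA ℕ.+ rZ) ℕ.+ (x₀ ℕ.+ rC ℕ.+ k))
        ≤⟨ ℕₚ.+-mono-≤ (rank-submod-⊆ M ⊤ (∁ S′ ∪ C) (∁ S) (S ∪ ∁ S′ ∪ C)
             (τ (⊤ₑ , ∁ₑ s ∪ₑ (s ∪ₑ ∁ₑ s′ ∪ₑ c))) (τ (∁ₑ s′ ∪ₑ c , ∁ₑ s)) (τ (∁ₑ s′ ∪ₑ c , s ∪ₑ ∁ₑ s′ ∪ₑ c)))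
             (ℕₚ.+-mono-≤ κS linking) ⟩
      (rZ ℕ.+ x₀) ℕ.+ ((t ℕ.+ k) ℕ.+ (p ℕ.+ q))
        ≡⟨ solve 6 (λ rZ x t k p q → (rZ :+ x) :+ ((t :+ k) :+ (p :+ q)) := p :+ (t :+ q :+ rZ :+ x :+ k)) ≡.refl rZ x₀ t k p q ⟩
      p ℕ.+ (t ℕ.+ q ℕ.+ rZ ℕ.+ x₀ ℕ.+ k) ∎)

    ∁S′-skew-C : rZ′ ℕ.+ rC ≤ q
    ∁S′-skew-C = ℕₚ.+-cancelʳ-≤ (t ℕ.+ p ℕ.+ rA′ ℕ.+ x₀ ℕ.+ k) _ _ (begin
      rZ′ ℕ.+ rC ℕ.+ (t ℕ.+ p ℕ.+ rA′ ℕ.+ x₀ ℕ.+ k)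
        ≡⟨ solve 7 (λ rZ rC t p rA x k → rZ :+ rC :+ (t :+ p :+ rA :+ x :+ k) := (t :+ p) :+ ((rA :+ rZ) :+ (x :+ rC :+ k))) ≡.refl rZ′ rC t p rA′ x₀ k ⟩
      (t ℕ.+ p) ℕ.+ ((rA′ ℕ.+ rZ′) ℕ.+ (x₀ ℕ.+ rC ℕ.+ k))
        ≤⟨ ℕₚ.+-mono-≤ (rank-submod-⊆ M ⊤ (S ∪ C) S′ (S ∪ ∁ S′ ∪ C)
             (τ (⊤ₑ , s′ ∪ₑ (s ∪ₑ ∁ₑ s′ ∪ₑ c))) (τ (s ∪ₑ c , s′)) (τ (s ∪ₑ c , s ∪ₑ ∁ₑ s′ ∪ₑ c)))
             (ℕₚ.+-mono-≤ κS′ linking) ⟩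
      (rA′ ℕ.+ x₀) ℕ.+ ((t ℕ.+ k) ℕ.+ (p ℕ.+ q))
        ≡⟨ solve 6 (λ rZ x t k p q → (rZ :+ x) :+ ((t :+ k) :+ (p :+ q)) := q :+ (t :+ p :+ rZ :+ x :+ k)) ≡.refl rA′ x₀ t k p q ⟩
      q ℕ.+ (t ℕ.+ p ℕ.+ rA′ ℕ.+ x₀ ℕ.+ k) ∎)

    -- A comparison of dimensions: the span of `S` meets that of ∁ S′ ∪ C in dimension rA + q - x₀,
    -- and that of ∁ S in dimension rA + rZ - t. Hence passing to the smaller set loses nothing.
    forward-rank : rZ ℕ.+ x₀ ≤ q ℕ.+ t
    forward-rank = ℕₚ.+-cancelʳ-≤ (rC ℕ.+ k ℕ.+ rA ℕ.+ p) _ _ (begin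
      rZ ℕ.+ x₀ ℕ.+ (rC ℕ.+ k ℕ.+ rA ℕ.+ p)
        ≡⟨ solve 6 (λ rZ x rC k rA p → rZ :+ x :+ (rC :+ k :+ rA :+ p) := (rA :+ rZ) :+ ((x :+ rC :+ k) :+ p)) ≡.refl rZ x₀ rC k rA p ⟩
      (rA ℕ.+ rZ) ℕ.+ ((x₀ ℕ.+ rC ℕ.+ k) ℕ.+ p)
        ≤⟨ ℕₚ.+-mono-≤ κS (ℕₚ.+-mono-≤ linking (ℕₚ.≤-trans (ℕₚ.m≤m+n _ _) (rank-submod M S C))) ⟩
      (t ℕ.+ k) ℕ.+ ((p ℕ.+ q) ℕ.+ (rA ℕ.+ rC))
        ≡⟨ solve 6 (λ t k p q rA rC → (t :+ k) :+ ((p :+ q) :+ (rA :+ rC)) := q :+ t :+ (rC :+ k :+ rA :+ p)) ≡.refl t k p q rA rC ⟩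
      q ℕ.+ t ℕ.+ (rC ℕ.+ k ℕ.+ rA ℕ.+ p) ∎)

    backward-rank : rA′ ℕ.+ x₀ ≤ p ℕ.+ t
    backward-rank = ℕₚ.+-cancelʳ-≤ (rC ℕ.+ k ℕ.+ rZ′ ℕ.+ q) _ _ (begin
      rA′ ℕ.+ x₀ ℕ.+ (rC ℕ.+ k ℕ.+ rZ′ ℕ.+ q)
        ≡⟨ solve 6 (λ rA x rC k rZ q → rA :+ x :+ (rC :+ k :+ rZ :+ q) := (rA :+ rZ) :+ ((x :+ rC :+ k) :+ q)) ≡.refl rA′ x₀ rC k rZ′ q ⟩
      (rA′ ℕ.+ rZ′) ℕ.+ ((x₀ ℕ.+ rC ℕ.+ k) ℕ.+ q)
        ≤⟨ ℕₚ.+-mono-≤ κS′ (ℕₚ.+-mono-≤ linking (ℕₚ.≤-trans (ℕₚ.m≤m+n _ _) (rank-submod M (∁ S′) C))) ⟩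
      (t ℕ.+ k) ℕ.+ ((p ℕ.+ q) ℕ.+ (rZ′ ℕ.+ rC))
        ≡⟨ solve 6 (λ t k p q rZ rC → (t :+ k) :+ ((p :+ q) :+ (rZ :+ rC)) := p :+ t :+ (rC :+ k :+ rZ :+ q)) ≡.refl t k p q rZ′ rC ⟩
      p ℕ.+ t ℕ.+ (rC ℕ.+ k ℕ.+ rZ′ ℕ.+ q) ∎)

    forward : ∀ {u} → Sp S u → Sp (∁ S) u → Sp (∁ S′ ∪ C) u
    forward = meet-stable S (∁ S′ ∪ C) (∁ S)
      (ℕₚ.≤-trans forward-rank (ℕₚ.+-monoʳ-≤ q (rank-mono M (τ (⊤ₑ , s ∪ₑ ∁ₑ s))))) (τ (∁ₑ s′ ∪ₑ c , ∁ₑ s))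

    backward : ∀ {u} → Sp S′ u → Sp (∁ S′) u → Sp (S ∪ C) u
    backward a b = meet-stable (∁ S′) (S ∪ C) S′
      (ℕₚ.≤-trans (ℕₚ.+-monoʳ-≤ rA′ (rank-mono M (τ (∁ₑ s′ ∪ₑ (s ∪ₑ c) , s ∪ₑ ∁ₑ s′ ∪ₑ c))))
        (ℕₚ.≤-trans backward-rank (ℕₚ.+-monoʳ-≤ p (rank-mono M (τ (⊤ₑ , ∁ₑ s′ ∪ₑ s′)))))) (τ (s ∪ₑ c , s′)) b a

    halves : ∀ j → ∃[ z ] ∃[ w ] (Sp (∁ S′) z × Sp C w × (∀ i → β x j i ≈ z i + w i))
    halves j = sp-split (∁ S′) C (forward (β-in x j) (β-out x j))

    -- The old boundary vectors are projected along the span of `C` into the span of ∁ S′.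
    β′ : Fin K → V m
    β′ j = proj₁ (halves j)

    β-mod′ : ∀ j → Sp C (β x j ⊖ β′ j)
    β-mod′ j = let z , w , _ , w∈ , e = halves j in span-resp (+-⊖ e) w∈

    node : Node
    node = record
      { side = S′ ; β = β′
      ; β-in = λ j → let z , w , _ , w∈ , e = halves j in
          span-resp (λ i → sym (+-⊖ (+-swap e) i)) (sp-⊖ (span-⊆ v S S′ S⊆S′ (β-in x j)) (span-⊆ v C S′ (τ (c , s′)) w∈))
      ; β-out = λ j → proj₁ (proj₂ (proj₂ (halves j)))
      ; β-spans = spans }
      where
      spans : ∀ {u} → Sp S′ u → Sp (∁ S′) u → ∃[ a ] (∀ i → u i ≈ lin β′ a i)
      -- Write u = y + w over S ∪ C. Then `y` lies in the boundary of `S` and has coordinates `α`;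
      -- the same coordinates serve `u`, because the difference lies in the spans of both `C` and ∁
      -- S′, which are skew.
      spans {u} b d = α , λ i → trans (⊖-+ u (lin β′ α) i) (trans (+-congˡ (vanish i)) (+-identityʳ _))
        where
        pieces = sp-split S C (backward b d)
        y w : V m
        y = proj₁ pieces
        w = proj₁ (proj₂ pieces)
        y∈ : Sp S y
        y∈ = proj₁ (proj₂ (proj₂ pieces))
        w∈ : Sp C w
        w∈ = proj₁ (proj₂ (proj₂ (proj₂ pieces)))
        e : ∀ i → u i ≈ y i + w i
        e = proj₂ (proj₂ (proj₂ (proj₂ pieces)))
        y∈′ : Sp (∁ S) y
        y∈′ = span-resp (λ i → sym (+-⊖ (+-swap e) i))
          (sp-⊖ (span-⊆ v (∁ S′) (∁ S) (τ (∁ₑ s′ , ∁ₑ s)) d) (span-⊆ v C (∁ S) (τ (c , ∁ₑ s)) w∈))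
        α = proj₁ (β-spans x y∈ y∈′)
        f : ∀ i → y i ≈ lin (β x) α i
        f = proj₂ (β-spans x y∈ y∈′)
        diff : Sp C (lin (β x) α ⊖ lin β′ α)
        diff = span-resp (lin-comb (- 1#) β′ (β x) (λ j → β x j ⊖ β′ j) α λ j i → refl) (lin-span (λ j → β x j ⊖ β′ j) α β-mod′)
        gap : Sp C (u ⊖ lin β′ α)
        gap = span-comb {u = w} {v = lin (β x) α ⊖ lin β′ α} 1# w∈ diff λ i → trans (⊖-⊖ u (lin (β x) α) (lin β′ α) i)
                (+-congʳ (*-congˡ (trans (+-congʳ (*-congˡ (sym (f i)))) (sym (+-⊖ e i)))))
        vanish : ∀ i → (u ⊖ lin β′ α) i ≈ 0#
        vanish = skew (∁ S′) C ∁S′-skew-C {u ⊖ lin β′ α}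
          (sp-⊖ d (lin-span β′ α λ j → proj₁ (proj₂ (proj₂ (halves j))))) gap

    edge : x ⟶ node
    edge = record { C = C ; grows = proj₁ link ; C⊆ = C⊆ ; C-skew = skew S C S-skew-C ; β-mod = β-mod′ }

  nodes : ∀ k S Ss x → side x ≡ S → Linked (Link k) (S ∷ Ss) → ∃[ Ns ] (length Ns ≡ length Ss × Linked _⟶_ (x ∷ Ns))
  nodes k S []        x e [-] = [] , ≡.refl , [-]
  nodes k S (S′ ∷ Ss) x ≡.refl (l ∷ ls) =
    let module X = Step x S′ k l
        Ns , size , links = nodes k S′ Ss X.node ≡.refl ls in
    X.node ∷ Ns , cong suc size , X.edge ∷ links

  N : ℕ
  N = size ℕ.^ K

  -- The preimage of the span of `X` under the coordinate map from F^K. Living in coordinates, it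
  -- can be compared between different nodes.
  profile : Node → Subset n → Subset N
  profile x X = tabulate λ i → does (Span? (cols v X) (lin (β x) (coefficients i)))

  profile⁻ : ∀ x X {i} → i ∈ profile x X → Sp X (lin (β x) (coefficients i))
  profile⁻ x X p = does⁻ (Span? _ _) (∈-tabulate⁻ p)

  profile⁺ : ∀ x X {i} → Sp X (lin (β x) (coefficients i)) → i ∈ profile x X
  profile⁺ x X p = ∈-tabulate⁺ (dec-true (Span? _ _) p)

  profile-mono : ∀ x {X Y} → X ⊆ Y → profile x X ⊆ profile x Y
  profile-mono x {X} {Y} X⊆Y p = profile⁺ x Y (span-⊆ v X Y X⊆Y (profile⁻ x X p))

  transfer : ∀ x y X Y → profile x X ≡ profile y Y → ∀ b → Sp X (lin (β x) b) → Sp Y (lin (β y) b)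
  transfer x y X Y e b p = let i , i≈ = coefficients-onto b in
    span-resp (lin-cong (β y) i≈)
      (profile⁻ y Y (subst (i ∈_) e (profile⁺ x X (span-resp (λ j → sym (lin-cong (β x) i≈ j)) p))))

  module Exchange (x y : Node) (x⟶y : x ⟶ y) where
    open _⟶_ x⟶y public
    open ℕₚ.≤-Reasoning
    open +-*-Solver

    Z : Subset n
    Z = ∁ (side y)

    C⊆y : C ⊆ side y
    C⊆y p = Subₚ.p∩q⊆p (side y) _ (C⊆ p)

    module _ (X X′ Y : Subset n) (X⊆ : X ⊆ side x) (X′⊆ : X′ ⊆ side y) (Y⊆ : Y ⊆ Z) (eq : profile x X ≡ profile y X′) where

      module _ (ws : List (V m)) (w : V m) (sub : ∀ {z} → z Mem.∈ (w ∷ ws) → z Mem.∈ cols v Y) where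

        in-Z : ∀ {s q : V m} → Span ws s → (∀ i → w i ≈ s i + q i) → Sp Z q
        in-Z {s} {q} ps e = span-⊆ v Y Z Y⊆ (span-resp (λ i → sym (+-⊖ {w} {s} {q} e i))
          (sp-⊖ {xs = cols v Y} {w} {s} (span-elem (sub (here ≡.refl))) (span-mono (λ p → sub (there p)) ps)))

        -- The part `q` of `w` over X ∪ C lies in the boundary of `side y`, with coordinates `b`.
        -- Its component `ξ` over `X` agrees with the vector of coordinates `b` at `x`, as their
        -- difference lies in the span of `C`, which is skew to `side x`. Equal profiles then put
        -- `q` into the span of `X′`.
        replace : Span (ws ++ cols v (X ∪ C)) w → Span (ws ++ cols v X′) w
        replace p with span-split {ys = cols v (X ∪ C)} ws p
        ... | s , q , ps , pq , e with sp-split X C pq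
        ...   | ξ , γ , pξ , pγ , e′ = span-join {ys = cols v X′} ws ps (span-resp (λ i → sym (f i)) q∈X′) e
          where
          q∈y : Sp (side y) q
          q∈y = span-⊆ v (X ∪ C) (side y) (∈-∪-elim X C (λ p → proj₁ grows (X⊆ p)) C⊆y) pq
          b = proj₁ (β-spans y q∈y (in-Z ps e))
          f : ∀ i → q i ≈ lin (β y) b i
          f = proj₂ (β-spans y q∈y (in-Z ps e))
          near : Sp C (ξ ⊖ lin (β y) b)
          near = span-comb {u = γ} {v = λ _ → 0#} (- 1#) pγ (span-zero (cols v C) λ i → refl) λ i →
            trans (+-congˡ (+-⊖ (+-swap e′) i)) (trans (cancel (lin (β y) b i) (γ i) (q i) (sym (f i))) (sym (+-identityʳ _)))
            where
            cancel : ∀ l g q → l ≈ q → - 1# * l + (- 1# * g + q) ≈ - 1# * g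
            cancel l g q e = trans (+-congʳ (*-congˡ e)) (sym (move (trans (+-comm _ _) (+-congʳ (sym (*-identityˡ _))))))
          gap : Sp C (ξ ⊖ lin (β x) b)
          gap = span-comb {u = lin (β x) b ⊖ lin (β y) b} {v = ξ ⊖ lin (β y) b} (- 1#) (lin-mod x⟶y b) near λ i →
            +-⊖ (λ j → trans (⊖-⊖ ξ (lin (β x) b) (lin (β y) b) j) (trans (+-comm _ _) (+-congˡ (*-identityˡ _)))) i
          ξ≈ : ∀ i → ξ i ≈ lin (β x) b i
          ξ≈ i = trans (⊖-+ ξ (lin (β x) b) i) (trans (+-congˡ (C-skew {ξ ⊖ lin (β x) b}
            (sp-⊖ (span-⊆ v X (side x) X⊆ pξ) (lin-span (β x) b (β-in x))) gap i)) (+-identityʳ _))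
          q∈X′ : Sp X′ (lin (β y) b)
          q∈X′ = transfer x y X X′ eq b (span-resp ξ≈ pξ)

        restore : Span (ws ++ cols v X′) w → Span (ws ++ cols v (X ∪ C)) w
        restore p with span-split {ys = cols v X′} ws p
        ... | s , q , ps , pq , e = span-join {ys = cols v (X ∪ C)} ws ps q∈ e
          where
          q∈y : Sp (side y) q
          q∈y = span-⊆ v X′ (side y) X′⊆ pq
          b = proj₁ (β-spans y q∈y (in-Z ps e))
          f : ∀ i → q i ≈ lin (β y) b i
          f = proj₂ (β-spans y q∈y (in-Z ps e))
          x∈ : Sp X (lin (β x) b)
          x∈ = transfer y x X′ X (≡.sym eq) b (span-resp f pq)
          q∈ : Sp (X ∪ C) q
          q∈ = span-comb {u = lin (β x) b ⊖ lin (β y) b} {v = lin (β x) b} (- 1#)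
            (span-⊆ v C (X ∪ C) (∈-∪ʳ {X = X}) (lin-mod x⟶y b)) (span-⊆ v X (X ∪ C) ∈-∪ˡ x∈) λ i →
            trans (f i) (+-⊖ (+-swap (⊖-+ (lin (β x) b) (lin (β y) b))) i)

      -- `Y` sees X ∪ C and `X′` only through the boundary of `side y`, where their traces agree, so
      -- it adds the same rank to both. Skewness splits the rank of X ∪ C.
      exchange-rank : r ((X ∪ Y) ∪ C) ℕ.+ r X′ ≡ r (X′ ∪ Y) ℕ.+ (r X ℕ.+ r C)
      exchange-rank = ≡.trans (cong₂ ℕ._+_ (≡.trans (cong r e₁) (r-∪ Y (X ∪ C))) (r-cols X′)) (≡.trans
        (rk-same-gain {xs = cols v (X ∪ C)} {cols v X′} (cols v Y) (λ ws w sub → replace ws w sub , restore ws w sub))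
        (cong₂ ℕ._+_ (≡.trans (≡.sym (r-∪ Y X′)) (cong r (Subₚ.∪-comm Y X′)))
          (≡.trans (≡.sym (r-cols (X ∪ C))) (≡.sym (skew-rank X C λ p → C-skew (span-⊆ v X (side x) X⊆ p))))))
        where
        e₁ : (X ∪ Y) ∪ C ≡ Y ∪ (X ∪ C)
        e₁ = ≡.trans (cong (_∪ C) (Subₚ.∪-comm X Y)) (Subₚ.∪-assoc Y X C)

    X₀ : Subset n → Subset n
    X₀ X = side x ∩ ∁ X

    module _ (X Y : Subset n) (X⊆ : X ⊆ side x) (Y⊆ : Y ⊆ Z) where

      private
        ex ey eX eY eC : SetExpr 5
        ex = var (# 0)
        ey = var (# 1)
        eX = var (# 2)
        eY = var (# 3)
        eC = var (# 4)

      facts : List (Inclusion 5)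
      facts = (ex , ey) ∷ (eX , ex) ∷ (eY , ∁ₑ ey) ∷ []

      τ : ∀ (g : Inclusion 5) → {T (everywhere (entails facts g))} → ⟦ g ⟧⊆ (side x ∷ side y ∷ X ∷ Y ∷ C ∷ [])
      τ g {t} = tauto (side x ∷ side y ∷ X ∷ Y ∷ C ∷ []) facts g {t} (proj₁ grows ∷ X⊆ ∷ Y⊆ ∷ [])

      narrow-split : ∀ {w} → Narrow M (side x ∪ Z) C w (X ∪ Y) →
        r ((X ∪ Y) ∪ C) ℕ.+ r ((X₀ X ∪ (Z ∩ ∁ Y)) ∪ C) ≤ w ℕ.+ (r ((side x ∪ Z) ∪ C) ℕ.+ r C)
      narrow-split h = ℕₚ.≤-trans (ℕₚ.+-monoʳ-≤ (r ((X ∪ Y) ∪ C)) (rank-mono M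
        (τ (((ex ∩ₑ ∁ₑ eX) ∪ₑ (∁ₑ ey ∩ₑ ∁ₑ eY)) ∪ₑ eC , ((ex ∪ₑ ∁ₑ ey) ∩ₑ ∁ₑ (eX ∪ₑ eY)) ∪ₑ eC)))) h

      -- Connectivity does not grow under restriction to `side x`, and contracting `C`, skew to that
      -- side, leaves the ranks there unchanged. This bounds the number stored in a state.
      excess-bound : ∀ {w} → Narrow M (side x ∪ Z) C w (X ∪ Y) → r X ℕ.+ r (X₀ X) ≤ r (side x) ℕ.+ w
      excess-bound {w} h = ℕₚ.+-cancelʳ-≤ (p ℕ.+ q ℕ.+ r C) _ _ (begin
        r X ℕ.+ r (X₀ X) ℕ.+ (p ℕ.+ q ℕ.+ r C)
          ≡⟨ solve 5 (λ a b p q c → a :+ b :+ (p :+ q :+ c) := (p :+ a) :+ (q :+ (b :+ c))) ≡.refl (r X) (r (X₀ X)) p q (r C) ⟩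
        (p ℕ.+ r X) ℕ.+ (q ℕ.+ (r (X₀ X) ℕ.+ r C))
          ≡⟨ cong (λ z → (p ℕ.+ r X) ℕ.+ (q ℕ.+ z)) (skew-rank (X₀ X) C λ s → C-skew (span-⊆ v (X₀ X) (side x) (Subₚ.p∩q⊆p _ _) s)) ⟩
        (p ℕ.+ r X) ℕ.+ (q ℕ.+ r (X₀ X ∪ C))
          ≤⟨ ℕₚ.+-mono-≤
               (rank-submod-⊆ M ((side x ∪ Y) ∪ C) X ((X ∪ Y) ∪ C) (side x)
                 (τ ((ex ∪ₑ eY) ∪ₑ eC , ((eX ∪ₑ eY) ∪ₑ eC) ∪ₑ ex)) (τ (eX , (eX ∪ₑ eY) ∪ₑ eC)) X⊆)
               (rank-submod-⊆ M ((side x ∪ Z) ∪ C) (X₀ X ∪ C) ((X₀ X ∪ (Z ∩ ∁ Y)) ∪ C) ((side x ∪ Y) ∪ C)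
                 (τ ((ex ∪ₑ ∁ₑ ey) ∪ₑ eC , (((ex ∩ₑ ∁ₑ eX) ∪ₑ (∁ₑ ey ∩ₑ ∁ₑ eY)) ∪ₑ eC) ∪ₑ ((ex ∪ₑ eY) ∪ₑ eC)))
                 (τ ((ex ∩ₑ ∁ₑ eX) ∪ₑ eC , ((ex ∩ₑ ∁ₑ eX) ∪ₑ (∁ₑ ey ∩ₑ ∁ₑ eY)) ∪ₑ eC))
                 (τ ((ex ∩ₑ ∁ₑ eX) ∪ₑ eC , (ex ∪ₑ eY) ∪ₑ eC))) ⟩
        (s ℕ.+ r (side x)) ℕ.+ (t ℕ.+ p)
          ≡⟨ solve 4 (λ s a t p → (s :+ a) :+ (t :+ p) := (s :+ t) :+ (a :+ p)) ≡.refl s (r (side x)) t p ⟩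
        (s ℕ.+ t) ℕ.+ (r (side x) ℕ.+ p)
          ≤⟨ ℕₚ.+-monoˡ-≤ (r (side x) ℕ.+ p) (narrow-split {w} h) ⟩
        w ℕ.+ (q ℕ.+ r C) ℕ.+ (r (side x) ℕ.+ p)
          ≡⟨ solve 5 (λ w q c a p → w :+ (q :+ c) :+ (a :+ p) := a :+ w :+ (p :+ q :+ c)) ≡.refl w q (r C) (r (side x)) p ⟩
        r (side x) ℕ.+ w ℕ.+ (p ℕ.+ q ℕ.+ r C) ∎)
        where
        p q s t : ℕ
        p = r ((side x ∪ Y) ∪ C)
        q = r ((side x ∪ Z) ∪ C)
        s = r ((X ∪ Y) ∪ C)
        t = r ((X₀ X ∪ (Z ∩ ∁ Y)) ∪ C)

      profile-full : ∀ z → profile z (side z) ≡ ⊤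
      profile-full z = Subₚ.⊆-antisym (λ _ → Subₚ.∈⊤) (λ _ → profile⁺ z (side z) (lin-span (β z) _ (β-in z)))

      -- `exchange-rank` is applied three times: to each of the two parts of the cut and to the
      -- whole sides. The remaining comparison, of the connectivities of `X` and `X′` within their
      -- sides, is the inequality assumed on ranks.
      narrow-transfer : ∀ {w} X′ → X′ ⊆ side y → profile x X ≡ profile y X′ → profile x (X₀ X) ≡ profile y (side y ∩ ∁ X′) →
        r X′ ℕ.+ r (side y ∩ ∁ X′) ℕ.+ r (side x) ≤ r X ℕ.+ r (X₀ X) ℕ.+ r (side y) →
        Narrow M (side x ∪ Z) C w (X ∪ Y) → r (X′ ∪ Y) ℕ.+ r (∁ (X′ ∪ Y)) ≤ w ℕ.+ r ⊤
      narrow-transfer {w} X′ X′⊆ e₁ e₂ le h = ℕₚ.+-cancelʳ-≤ (r X ℕ.+ r (X₀ X) ℕ.+ 2c ℕ.+ (r (side x) ℕ.+ r (side y))) _ _ (begin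
        r (X′ ∪ Y) ℕ.+ r (∁ (X′ ∪ Y)) ℕ.+ (r X ℕ.+ r (X₀ X) ℕ.+ 2c ℕ.+ (r (side x) ℕ.+ r (side y)))
          ≤⟨ ℕₚ.+-monoˡ-≤ _ (ℕₚ.+-monoʳ-≤ (r (X′ ∪ Y)) (rank-mono M outside)) ⟩
        r (X′ ∪ Y) ℕ.+ r (X₁ ∪ Y₀) ℕ.+ (r X ℕ.+ r (X₀ X) ℕ.+ 2c ℕ.+ (r (side x) ℕ.+ r (side y)))
          ≡⟨ solve 7 (λ a b c d e f g → a :+ b :+ (c :+ d :+ (e :+ e) :+ (f :+ g)) := (a :+ (c :+ e)) :+ (b :+ (d :+ e)) :+ (f :+ g)) ≡.refl
               (r (X′ ∪ Y)) (r (X₁ ∪ Y₀)) (r X) (r (X₀ X)) (r C) (r (side x)) (r (side y)) ⟩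
        (r (X′ ∪ Y) ℕ.+ (r X ℕ.+ r C)) ℕ.+ (r (X₁ ∪ Y₀) ℕ.+ (r (X₀ X) ℕ.+ r C)) ℕ.+ (r (side x) ℕ.+ r (side y))
          ≡⟨ cong₂ (λ a b → a ℕ.+ b ℕ.+ (r (side x) ℕ.+ r (side y)))
               (≡.sym (exchange-rank X X′ Y X⊆ X′⊆ Y⊆ e₁))
               (≡.sym (exchange-rank (X₀ X) X₁ Y₀ (Subₚ.p∩q⊆p _ _) (Subₚ.p∩q⊆p _ _) (Subₚ.p∩q⊆p _ _) e₂)) ⟩
        (s ℕ.+ r X′) ℕ.+ (t ℕ.+ r X₁) ℕ.+ (r (side x) ℕ.+ r (side y))
          ≡⟨ solve 6 (λ s a t b f g → (s :+ a) :+ (t :+ b) :+ (f :+ g) := (s :+ t) :+ (a :+ b :+ f) :+ g) ≡.refl s (r X′) t (r X₁) (r (side x)) (r (side y)) ⟩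
        (s ℕ.+ t) ℕ.+ (r X′ ℕ.+ r X₁ ℕ.+ r (side x)) ℕ.+ r (side y)
          ≤⟨ ℕₚ.+-monoˡ-≤ (r (side y)) (ℕₚ.+-mono-≤ (narrow-split {w} h) le) ⟩
        w ℕ.+ (q ℕ.+ r C) ℕ.+ (r X ℕ.+ r (X₀ X) ℕ.+ r (side y)) ℕ.+ r (side y)
          ≡⟨ solve 6 (λ w q c a b g → w :+ (q :+ c) :+ (a :+ b :+ g) :+ g := w :+ (q :+ g) :+ (c :+ (a :+ b :+ g))) ≡.refl w q (r C) (r X) (r (X₀ X)) (r (side y)) ⟩
        w ℕ.+ (q ℕ.+ r (side y)) ℕ.+ (r C ℕ.+ (r X ℕ.+ r (X₀ X) ℕ.+ r (side y)))
          ≡⟨ cong (λ a → w ℕ.+ a ℕ.+ (r C ℕ.+ (r X ℕ.+ r (X₀ X) ℕ.+ r (side y))))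
               (exchange-rank (side x) (side y) Z (λ p → p) (λ p → p) (λ p → p) (≡.trans (profile-full x) (≡.sym (profile-full y)))) ⟩
        w ℕ.+ (r (side y ∪ Z) ℕ.+ (r (side x) ℕ.+ r C)) ℕ.+ (r C ℕ.+ (r X ℕ.+ r (X₀ X) ℕ.+ r (side y)))
          ≡⟨ cong (λ U → w ℕ.+ (r U ℕ.+ (r (side x) ℕ.+ r C)) ℕ.+ (r C ℕ.+ (r X ℕ.+ r (X₀ X) ℕ.+ r (side y)))) (Subₚ.p∪∁p≡⊤ (side y)) ⟩
        w ℕ.+ (r ⊤ ℕ.+ (r (side x) ℕ.+ r C)) ℕ.+ (r C ℕ.+ (r X ℕ.+ r (X₀ X) ℕ.+ r (side y)))
          ≡⟨ solve 7 (λ w t f c a b g → w :+ (t :+ (f :+ c)) :+ (c :+ (a :+ b :+ g)) := w :+ t :+ (a :+ b :+ (c :+ c) :+ (f :+ g))) ≡.refl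
               w (r ⊤) (r (side x)) (r C) (r X) (r (X₀ X)) (r (side y)) ⟩
        w ℕ.+ r ⊤ ℕ.+ (r X ℕ.+ r (X₀ X) ℕ.+ 2c ℕ.+ (r (side x) ℕ.+ r (side y))) ∎)
        where
        X₁ Y₀ : Subset n
        X₁ = side y ∩ ∁ X′
        Y₀ = Z ∩ ∁ Y
        2c s t q : ℕ
        2c = r C ℕ.+ r C
        s = r ((X ∪ Y) ∪ C)
        t = r ((X₀ X ∪ Y₀) ∪ C)
        q = r ((side x ∪ Z) ∪ C)
        outside : ∁ (X′ ∪ Y) ⊆ X₁ ∪ Y₀
        outside = tauto (side y ∷ X′ ∷ Y ∷ []) [] (∁ₑ (var (# 1) ∪ₑ var (# 2)) , (var (# 0) ∩ₑ ∁ₑ (var (# 1))) ∪ₑ (∁ₑ (var (# 0)) ∩ₑ ∁ₑ (var (# 2)))) []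

-- Finite enumerations

module Enumeration where
  open ≡ using (refl; sym; trans)
  allSubsets : ∀ n → List (Subset n)
  allSubsets zero    = [] ∷ []
  allSubsets (suc n) = cartesianProductWith _∷_ (true ∷ false ∷ []) (allSubsets n)

  ∈-allSubsets : ∀ {n} (X : Subset n) → X Mem.∈ allSubsets n
  ∈-allSubsets []          = here refl
  ∈-allSubsets (true ∷ X)  = Memₚ.∈-cartesianProductWith⁺ _∷_ {xs = true ∷ false ∷ []} (here refl) (∈-allSubsets X)
  ∈-allSubsets (false ∷ X) = Memₚ.∈-cartesianProductWith⁺ _∷_ {xs = true ∷ false ∷ []} (there (here refl)) (∈-allSubsets X)

  wordsUpTo : ∀ {S : Set} → ℕ → List S → List (List S)
  wordsUpTo zero    xs = [] ∷ []
  wordsUpTo (suc k) xs = [] ∷ cartesianProductWith _∷_ xs (wordsUpTo k xs)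

  ∈-wordsUpTo : ∀ {S : Set} k (xs : List S) σ → length σ ≤ k → All (Mem._∈ xs) σ → σ Mem.∈ wordsUpTo k xs
  ∈-wordsUpTo zero    xs []      _       []       = here refl
  ∈-wordsUpTo (suc k) xs []      _       []       = here refl
  ∈-wordsUpTo (suc k) xs (x ∷ σ) (s≤s l) (p ∷ ps) =
    there (Memₚ.∈-cartesianProductWith⁺ _∷_ p (∈-wordsUpTo k xs σ l ps))

  AllPairs-lookup : ∀ {a r} {S : Set a} {R : S → S → Set r} {xs} → AllPairs R xs → ∀ {i j} → i Fin.< j → R (List.lookup xs i) (List.lookup xs j)
  AllPairs-lookup (p ∷ ps) {zero}  {suc j} _       = All.lookup p (Memₚ.∈-lookup j)
  AllPairs-lookup (p ∷ ps) {suc i} {suc j} (s≤s l) = AllPairs-lookup ps l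

  -- Double negation commutes with finite conjunctions, so finitely many undecided questions can be
  -- decided at once under one double negation.
  ¬¬-∀ : ∀ {p} k {P : Fin k → Set p} → (∀ i → ¬ ¬ P i) → ¬ ¬ (∀ i → P i)
  ¬¬-∀ zero    h k = k λ ()
  ¬¬-∀ (suc n) h k = h zero λ p → ¬¬-∀ n (λ i → h (suc i)) λ ps → k λ { zero → p ; (suc i) → ps i }

-- The explicit bound on the size of an excluded minor

module Bound {a ℓ} (F : FiniteField a ℓ) (w : ℕ) where
  open ≡ using (refl; sym; trans)
  open FiniteField F using (size; Carrier)
  open Enumeration
  open Subsets
  open import Data.Nat using (_+_; _*_; _^_; _∸_)

  K N : ℕ
  K = suc w
  N = size ^ K

  Color : Set
  Color = Subset N × Subset N

  _≟ᶜ_ : DecidableEquality Color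
  _≟ᶜ_ = Productₚ.≡-dec (Vecₚ.≡-dec Boolₚ._≟_) (Vecₚ.≡-dec Boolₚ._≟_)

  open WordsOver Color _≟ᶜ_

  -- Along a layout P grows and Q shrinks, so μ detects every change of colour.
  μ : Color → ℕ
  μ (P , Q) = ∣ P ∣ + ∣ ∁ Q ∣

  open Chains μ
  open Gluing Color _≟ᶜ_

  -- `μ` is at most N + N, which leaves `top` possible values; a shortened word has at most one
  -- block for each, over the numbers 0 to w.
  top wordLength : ℕ
  top = suc (N + N)
  wordLength = top * blockBound (suc w)

  states : List State
  states = cartesianProduct (cartesianProduct (allSubsets N) (allSubsets N)) (upTo (suc w))

  ∈-states : ∀ s → Small (suc w) s → s Mem.∈ states
  ∈-states ((P , Q) , n) l = Memₚ.∈-cartesianProduct⁺ (Memₚ.∈-cartesianProduct⁺ (∈-allSubsets P) (∈-allSubsets Q)) (Memₚ.∈-upTo⁺ l)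

  abstract
    words : List (List State)
    words = wordsUpTo wordLength states

    ∈-words : ∀ {σ} → length σ ≤ wordLength → All (Small (suc w)) σ → σ Mem.∈ words
    ∈-words {σ} short small = ∈-wordsUpTo wordLength states σ short (All.map (λ {s} → ∈-states s) small)

    -- Nodes are classified by the set of short words they realise, that is, by a subset of `words`.
    types : ℕ
    types = 2 ^ length words

    types>0 : 0 < types
    types>0 = ℕₚ.m^n>0 2 (length words)

    encode : (Fin (length words) → Fin 2) → Fin types
    encode = funToFin

    encode-injective : ∀ f g → encode f ≡ encode g → ∀ p → f p ≡ g p
    encode-injective f g e p = trans (sym (Finₚ.finToFun-funToFin f p))
      (trans (cong (λ k → finToFun k p) e) (Finₚ.finToFun-funToFin g p))

    -- One element is spent on deletion; the layout of the others must be long enough for a linked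
    -- chain of `types` + 1 sets, one more than there are classes.
    bound : ℕ
    bound = suc (chainBound K types)

    bound-suc : ∀ {n} → bound ≤ n → ∃[ n′ ] (n ≡ suc n′ × chainBound K types ≤ n′)
    bound-suc {suc n′} (s≤s h) = n′ , refl , h

  μ<top : ∀ C → μ C < top
  μ<top (P , Q) = s≤s (ℕₚ.+-mono-≤ (Subₚ.∣p∣≤n P) (Subₚ.∣p∣≤n (∁ Q)))

  ⊆-≡-or-< : ∀ {n} {P Q : Subset n} → P ⊆ Q → P ≡ Q ⊎ ∣ P ∣ < ∣ Q ∣
  ⊆-≡-or-< {P = P} {Q} P⊆Q with P Subₚ.⊂? Q
  ... | yes P⊂Q = inj₂ (Subₚ.p⊂q⇒∣p∣<∣q∣ P⊂Q)
  ... | no ¬P⊂Q = inj₁ (Subₚ.⊆-antisym P⊆Q back)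
    where
    back : Q ⊆ P
    back {j} j∈ with j Subₚ.∈? P
    ... | yes q = q
    ... | no ¬q = Empty-elim (¬P⊂Q (P⊆Q , j , j∈ , ¬q))

  color-step : ∀ {P P′ Q Q′ k k′} → P ⊆ P′ → Q′ ⊆ Q → ((P , Q) , k) ⊲ ((P′ , Q′) , k′)
  color-step {P} {P′} {Q} {Q′} p q with ⊆-≡-or-< p | ⊆-≡-or-< q
  ... | inj₁ refl | inj₁ refl = inj₁ refl
  ... | inj₂ l    | _         = inj₂ (ℕₚ.+-mono-<-≤ l (Subₚ.p⊆q⇒∣p∣≤∣q∣ (Subₚ.p⊆q⇒∁p⊇∁q q)))
  ... | inj₁ refl | inj₂ l    = inj₂ (ℕₚ.+-monoʳ-< ∣ P ∣ (ℕₚ.≤-<-trans (ℕₚ.≤-reflexive (Subₚ.∣∁p∣≡n∸∣p∣ Q))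
        (ℕₚ.<-≤-trans (ℕₚ.∸-monoʳ-< l (Subₚ.∣p∣≤n Q)) (ℕₚ.≤-reflexive (sym (Subₚ.∣∁p∣≡n∸∣p∣ Q′))))))

  module Matroids {m n} (A : Fin m → Fin n → Carrier) (M : Matroid n) (rep : Represents F A M) where
    open Boundaries F A M rep K hiding (N; _⊖_)
    open MatroidLinking M
    open Subsets
    open Sweeps {n}
    open _⟶_ using (C)

    rest : Node → Subset n → Subset n
    rest x X = side x ∩ ∁ X

    -- By exchange-rank, for Y ⊆ ∁ (side x) the connectivity of X ∪ Y depends on X only through
    -- its state, and monotonically on the last component.
    state : Node → Subset n → State
    state x X = (profile x X , profile x (rest x X)) , (r X + r (rest x X)) ∸ r (side x)

    Type : Node → List State → Set₁
    Type x σ = ∃[ Xs ] (Sweep (side x) ⊥ Xs × map (state x) (⊥ ∷ Xs) ≃ σ)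

    states-chain : ∀ x {Xs} → AllPairs _⊆_ Xs → AllPairs _⊲_ (map (state x) Xs)
    states-chain x ps = AllPairsₚ.map⁺ (AllPairs.map {R = _⊆_} (λ {X} {Y} X⊆Y → color-step {k = proj₂ (state x X)} {k′ = proj₂ (state x Y)} (profile-mono x X⊆Y)
      (profile-mono x λ p → Subₚ.x∈p∩q⁺ (Subₚ.p∩q⊆p _ _ p , Subₚ.p⊆q⇒∁p⊇∁q X⊆Y (Subₚ.p∩q⊆q (side x) _ p)))) ps)

    -- A layout of the minor on side x ∪ ∁ (side y) becomes a layout of M: its trace on
    -- side x is replaced by a sweep of side y of the same type.
    module Transfer (x y : Node) (e : x ⟶ y) (types-⊆ : ∀ σ → σ Mem.∈ words → Type x σ → Type y σ) where
      open Exchange x y e using (narrow-transfer; excess-bound; Z)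

      Wide : Subset n → Set
      Wide U = r U + r (∁ U) ≤ w + r ⊤

      Tight : Subset n → Set
      Tight = Narrow M (side x ∪ Z) (C e) w

      -- Quantifying over all `X′` with a state below `s` builds the downward closure into the
      -- environment, and lets `glue` read off its hypothesis by reflexivity.
      env : Subset n → Env
      env Y = (λ s → ∀ X′ → X′ ⊆ side y → state y X′ ⊑ s → Wide (X′ ∪ Y)) ,
        (λ { (refl , k≤) f X′ X′⊆ (eq , l) → f X′ X′⊆ (eq , ℕₚ.≤-trans l k≤) })

      Z⊆∁x : Z ⊆ ∁ (side x)
      Z⊆∁x = Subₚ.p⊆q⇒∁p⊇∁q (proj₁ (_⟶_.grows e))

      cell : ∀ {X Y} → X ⊆ side x → Y ⊆ Z → Tight (X ∪ Y) → proj₁ (env Y) (state x X)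
      cell {X} {Y} X⊆ Y⊆ h X′ X′⊆ (eq , l) = narrow-transfer X Y X⊆ Y⊆ {w} X′ X′⊆
          (sym (cong proj₁ eq)) (sym (cong proj₂ eq)) le h
        where
        open ℕₚ.≤-Reasoning
        open +-*-Solver
        p p′ : ℕ
        p = r X + r (rest x X)
        p′ = r X′ + r (rest y X′)
        whole : r (side x) ≤ p
        whole = ℕₚ.≤-trans (ℕₚ.≤-trans (rank-mono M cover) (ℕₚ.m≤m+n _ _)) (rank-submod M X (rest x X))
          where
          cover : side x ⊆ X ∪ rest x X
          cover {j} q with j Subₚ.∈? X
          ... | yes j∈ = ∈-∪ˡ j∈
          ... | no j∉ = ∈-∪ʳ {X = X} (Subₚ.x∈p∩q⁺ (q , Subₚ.x∉p⇒x∈∁p j∉))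
        le : p′ + r (side x) ≤ p + r (side y)
        le = begin
          p′ + r (side x)                             ≤⟨ ℕₚ.+-monoˡ-≤ (r (side x)) (ℕₚ.m≤n+m∸n p′ (r (side y))) ⟩
          r (side y) + (p′ ∸ r (side y)) + r (side x) ≤⟨ ℕₚ.+-monoˡ-≤ (r (side x)) (ℕₚ.+-monoʳ-≤ (r (side y)) l) ⟩
          r (side y) + (p ∸ r (side x)) + r (side x)  ≡⟨ solve 3 (λ a b c → a :+ b :+ c := (b :+ c) :+ a) refl (r (side y)) (p ∸ r (side x)) (r (side x)) ⟩
          (p ∸ r (side x)) + r (side x) + r (side y)  ≡⟨ cong (_+ r (side y)) (ℕₚ.m∸n+n≡m whole) ⟩
          p + r (side y)                              ∎

      transfer-path : Path Tight (side x ∪ Z) ⊥ → Path Wide ⊤ ⊥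
      transfer-path path =
        let Xs , Ys , sX , sY , run , seen = split (side x) Z Z⊆∁x (state x) env {Tight} cell path
            -- Every set of the sweep was met together with some outside set in a tight union, so
            -- `excess-bound` keeps all numbers of the word at most w.
            small = All.map (λ { {X} (Y , X⊆ , Y⊆ , h) → s≤s (ℕₚ.m≤n+o⇒m∸n≤o _ (r (side x)) (excess-bound X Y X⊆ Y⊆ {w} h)) }) seen
            σ , short , small′ , eqv = shorten (suc w) top _ (states-chain x (sweep-chain sX)) (All.tabulate λ {s} _ → μ<top (proj₁ s)) (Allₚ.map⁺ small)
            Xs′ , sX′ , eqv′ = types-⊆ σ (∈-words short small′) (Xs , subst (λ X → Sweep (side x) X Xs) ⊥∩ sX ,
                                 subst (λ X → map (state x) (X ∷ Xs) ≃ σ) ⊥∩ eqv)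
            run′ = from eqv′ Last _ (to eqv Last _ run)
        in ≡.subst₂ (Path Wide) (Subₚ.p∪∁p≡⊤ (side y)) (Subₚ.∪-identityˡ ⊥)
             (glue (side y) Z (λ p → p) (state y) env {Wide} (λ {X} X⊆ _ f → f X X⊆ (refl , ℕₚ.≤-refl))
               (λ p → Empty-elim (Subₚ.∉⊥ p)) (λ p → Empty-elim (Subₚ.∉⊥ p)) sX′
               (subst (λ Y → Sweep Z Y Ys) ⊥∩ sY) (subst (λ Y → Run (map (state y) (⊥ ∷ Xs′)) Last (map env (Y ∷ Ys))) ⊥∩ run′))
        where
        ⊥∩ : ∀ {X : Subset n} → ⊥ ∩ X ≡ ⊥
        ⊥∩ {X} = Subₚ.∩-zeroˡ X

    path-chain : ∀ {ok : Subset n → Set} {G X} (p : Path ok G X) → ∃[ Xs ] (length Xs ≡ suc (len p) × AllPairs _⊂_ Xs ×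
      All (λ Y → ok Y × Y ⊆ G) Xs × (∀ B → B ⊂ X → All (B ⊂_) Xs))
    path-chain {G = G} (done o) = G ∷ [] , refl , [] ∷ [] , (o , λ q → q) ∷ [] , λ B B⊂ → B⊂ ∷ []
    path-chain {X = X} q@(step j o j∉ p) = let Xs , size , chain , oks , up = path-chain p in
      X ∷ Xs , cong suc size , up X X⊂ ∷ chain , (o , path-⊆ q) ∷ oks , λ B B⊂ → B⊂ ∷ up B (Subₚ.⊂-trans B⊂ X⊂)
      where
      X⊂ : X ⊂ X ∪ ⁅ j ⁆
      X⊂ = ∈-∪ˡ , j , ∈-∪ʳ {X = X} (Subₚ.x∈⁅x⁆ j) , j∉

    path-long : ∀ {ok : Subset n → Set} {G} (p : Path ok G ⊥) → ∣ G ∣ ≤ len p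
    path-long {G = G} p = Finₚ.injective⇒≤ {f = λ i → proj₁ (find i)} λ {i} {j} e →
        embed-injective G (trans (sym (proj₂ (find i))) (trans (cong (elem p) e) (proj₂ (find j))))
      where
      find : ∀ i → ∃[ t ] (elem p t ≡ embed G i)
      find i = elem-onto p (embed-∈ G i) Subₚ.∉⊥

    Minors : Set
    Minors = ∀ G C → C ∩ G ≡ ⊥ → ∣ G ∣ < n → Path (Narrow M G C w) G ⊥

    module Pigeonhole (minors : Minors) (x : Node) (Ns : List Node) (links : Linked _⟶_ (x ∷ Ns)) (size : length (x ∷ Ns) ≡ suc types) where

      node : Fin (length (x ∷ Ns)) → Node
      node = List.lookup (x ∷ Ns)

      bit : ∀ {p} {P : Set p} → Dec P → Fin 2
      bit (yes _) = suc zero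
      bit (no _)  = zero

      bit-transfer : ∀ {p q} {P : Set p} {Q : Set q} (d : Dec P) (e : Dec Q) → bit d ≡ bit e → P → Q
      bit-transfer (yes _) (yes q) _ _ = q
      bit-transfer (no ¬p) (no _)  _ p = Empty-elim (¬p p)

      finish : ∀ {i j} → i Fin.< j → (∀ σ → σ Mem.∈ words → Type (node i) σ → Type (node j) σ) →
        Path (λ U → r U + r (∁ U) ≤ w + r ⊤) ⊤ ⊥
      finish {i} {j} i<j h = Transfer.transfer-path (node i) (node j) e h
          (minors (side (node i) ∪ ∁ (side (node j))) (C e) disjoint small)
        where
        e : node i ⟶ node j
        e = AllPairs-lookup (Linked⇒AllPairs ⟶-trans links) i<j
        disjoint : C e ∩ (side (node i) ∪ ∁ (side (node j))) ≡ ⊥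
        disjoint = Subₚ.⊆-antisym (λ p → let c , g = Subₚ.x∈p∩q⁻ (C e) _ p ; y∈ , x∈ = Subₚ.x∈p∩q⁻ (side (node j)) _ (_⟶_.C⊆ e c) in
          Empty-elim (∈-∪-elim (side (node i)) _ (Subₚ.x∈∁p⇒x∉p x∈) (λ q → Subₚ.x∈∁p⇒x∉p q y∈) g))
          (λ p → Empty-elim (Subₚ.∉⊥ p))
        small : ∣ side (node i) ∪ ∁ (side (node j)) ∣ < n
        small = let _ , t , t∈ , t∉ = _⟶_.grows e in ℕₚ.<-≤-trans
          (Subₚ.p⊂q⇒∣p∣<∣q∣ {q = ⊤} ((λ _ → Subₚ.∈⊤) , t , Subₚ.∈⊤ , ∈-∪-elim (side (node i)) _ t∉ (λ q → Subₚ.x∈∁p⇒x∉p q t∈)))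
          (ℕₚ.≤-reflexive (Subₚ.∣⊤∣≡n n))

      collide : (∀ i p → Dec (Type (node i) (List.lookup words p))) → Path (λ U → r U + r (∁ U) ≤ w + r ⊤) ⊤ ⊥
      collide decide = let i , j , i<j , same = Finₚ.pigeonhole (ℕₚ.≤-reflexive (sym size)) code in
          finish i<j λ σ σ∈ t → subst (Type (node j)) (sym (Anyₚ.lookup-index σ∈))
            (bit-transfer (decide i (Any.index σ∈)) (decide j (Any.index σ∈))
              (encode-injective (bits i) (bits j) same (Any.index σ∈))
              (subst (Type (node i)) (Anyₚ.lookup-index σ∈) t))
        where
        bits : ∀ i → Fin (length words) → Fin 2
        bits i p = bit (decide i p)
        code : Fin (length (x ∷ Ns)) → Fin types
        code i = encode (bits i)

      -- Which words a node realises is not decided, since `Type` involves equivalence under all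
      -- continuations; excluded middle is assumed under the double negation for the finitely many
      -- pairs of node and word.
      conclusion : ¬ ¬ Path (λ U → r U + r (∁ U) ≤ w + r ⊤) ⊤ ⊥
      conclusion k = ¬¬-∀ _ (λ i → ¬¬-∀ _ (λ p → ¬¬-excluded-middle)) λ decide → k (collide decide)

    extend : ∀ k S Ss → k ≤ K → Linked (Link k) (S ∷ Ss) → length (S ∷ Ss) ≡ suc types →
      ∃[ x ] ∃[ Ns ] (Linked _⟶_ (x ∷ Ns) × length (x ∷ Ns) ≡ suc types)
    -- The bound on the connectivity of `S` is read off the first link, so a second set is required;
    -- `types>0` guarantees one.
    extend k S [] k≤K links size = Empty-elim (ℕₚ.<⇒≢ types>0 (ℕₚ.suc-injective size))
    extend k S (S′ ∷ Ss) k≤K links@((_ , κS , _) ∷ _) size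
      with initialNode S (ℕₚ.≤-trans κS (ℕₚ.+-monoʳ-≤ (r ⊤) k≤K))
    ... | x , side≡ with nodes k S (S′ ∷ Ss) x side≡ links
    ...   | Ns , len≡ , links′ = x , Ns , links′ , trans (cong suc len≡) size

  large-layout : ∀ {m n′} (A : Fin m → Fin (suc n′) → Carrier) (M : Matroid (suc n′)) (rep : Represents F A M) →
    Matroids.Minors A M rep → chainBound K types ≤ n′ → ¬ ¬ Path (λ U → rank M U + rank M (∁ U) ≤ w + rank M ⊤) ⊤ ⊥
  large-layout {n′ = n′} A M rep minors long = case-of-chain (thin K types Xs chain κ-bound enough)
    where
    open Matroids A M rep
    open MatroidLinking M
    open Subsets
    open SetReasoning
    G : Subset (suc n′)
    G = ∁ ⁅ zero ⁆
    ∣G∣≡ : ∣ G ∣ ≡ n′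
    ∣G∣≡ = trans (Subₚ.∣∁p∣≡n∸∣p∣ {suc n′} ⁅ zero ⁆) (cong (suc n′ ∸_) (Subₚ.∣⁅x⁆∣≡1 {suc n′} zero))
    path : Path (Narrow M G ⊥ w) G ⊥
    path = minors G ⊥ (Subₚ.∩-zeroˡ G) (s≤s (ℕₚ.≤-reflexive ∣G∣≡))
    listed = path-chain path
    Xs : List (Subset (suc n′))
    Xs = proj₁ listed
    chain : AllPairs _⊂_ Xs
    chain = proj₁ (proj₂ (proj₂ listed))
    enough : chainBound K types ≤ length Xs
    enough = ℕₚ.≤-trans long (ℕₚ.≤-trans (ℕₚ.≤-reflexive (sym ∣G∣≡)) (ℕₚ.≤-trans (path-long path)
      (ℕₚ.≤-trans (ℕₚ.n≤1+n _) (ℕₚ.≤-reflexive (sym (proj₁ (proj₂ listed)))))))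
    -- The sets of the layout are narrow with element zero deleted. Restoring it to the complement
    -- costs at most one, whence K = w + 1.
    widen : ∀ X → Narrow M G ⊥ w X → κ X ≤ rank M ⊤ + K
    widen X h = begin
      rank M X + rank M (∁ X)
        ≤⟨ ℕₚ.+-mono-≤ (rank-mono M ∈-∪ˡ) (ℕₚ.≤-trans (rank-mono M (tauto (X ∷ ⁅ zero ⁆ ∷ []) []
             (∁ₑ (var (# 0)) , ((∁ₑ (var (# 1)) ∩ₑ ∁ₑ (var (# 0))) ∪ₑ ⊥ₑ) ∪ₑ var (# 1)) [])) (rank-suc ((G ∩ ∁ X) ∪ ⊥) zero)) ⟩
      rank M (X ∪ ⊥) + suc (rank M ((G ∩ ∁ X) ∪ ⊥)) ≡⟨ ℕₚ.+-suc _ _ ⟩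
      suc (rank M (X ∪ ⊥) + rank M ((G ∩ ∁ X) ∪ ⊥)) ≤⟨ s≤s h ⟩
      suc (w + (rank M (G ∪ ⊥) + rank M ⊥)) ≤⟨ s≤s (ℕₚ.+-monoʳ-≤ w (ℕₚ.≤-trans (ℕₚ.+-mono-≤ (rank-mono M λ _ → Subₚ.∈⊤)
                                                 (ℕₚ.≤-trans (rank-bound M ⊥) (ℕₚ.≤-reflexive (Subₚ.∣⊥∣≡0 (suc n′))))) (ℕₚ.≤-reflexive (ℕₚ.+-identityʳ _)))) ⟩
      suc (w + rank M ⊤) ≡⟨ ℕₚ.+-comm (suc w) _ ⟩
      rank M ⊤ + K ∎
      where open ℕₚ.≤-Reasoning
    κ-bound : All (λ X → κ X ≤ rank M ⊤ + K) Xs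
    κ-bound = All.map (λ { {X} (h , _) → widen X h }) (proj₁ (proj₂ (proj₂ (proj₂ listed))))
    case-of-chain : (∃[ k ] ∃[ Ys ] (k ≤ K × length Ys ≡ suc types × Linked (Link k) Ys)) →
      ¬ ¬ Path (λ U → rank M U + rank M (∁ U) ≤ w + rank M ⊤) ⊤ ⊥
    case-of-chain (k , S ∷ Ss , k≤K , size , links) =
      let x , Ns , links′ , size′ = extend k S Ss k≤K links size in Pigeonhole.conclusion minors x Ns links′ size′

  wide-layout : ∀ {m n} (A : Fin m → Fin n → Carrier) (M : Matroid n) (rep : Represents F A M) →
    Matroids.Minors A M rep → bound ≤ n → ¬ ¬ Path (λ U → rank M U + rank M (∁ U) ≤ w + rank M ⊤) ⊤ ⊥
  wide-layout A M rep minors large with bound-suc large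
  ... | n′ , refl , long = large-layout A M rep minors long

-- Listing all matroids of bounded size

module MatroidEnumeration where
  open ≡ using (refl; sym; trans)
  open Subsets
  open Enumeration

  allSubsets? : ∀ {n p} {P : Subset n → Set p} → Decidable P → Dec (∀ X → P X)
  allSubsets? P? with Subₚ.anySubset? (λ X → ¬? (P? X))
  ... | yes (X , ¬p) = no λ h → ¬p (h X)
  ... | no ¬∃¬       = yes λ X → decidable-stable (P? X) λ ¬p → ¬∃¬ (X , ¬p)

  branch : ∀ {n} → (Subset n → ℕ) → (Subset n → ℕ) → Subset (suc n) → ℕ
  branch f g (true ∷ X)  = f X
  branch f g (false ∷ X) = g X

  -- All bounded functions up to pointwise equality, which is the way `Iso` compares ranks.
  tables : ℕ → ∀ n → List (Subset n → ℕ)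
  tables b zero    = map (λ k _ → k) (upTo (suc b))
  tables b (suc n) = cartesianProductWith branch (tables b n) (tables b n)

  tables-complete : ∀ b n (f : Subset n → ℕ) → (∀ X → f X ≤ b) → Any (λ g → ∀ X → f X ≡ g X) (tables b n)
  tables-complete b zero f h = Anyₚ.map⁺ (Any.map (λ { e [] → e }) (Memₚ.∈-upTo⁺ (s≤s (h []))))
  tables-complete b (suc n) f h = Anyₚ.cartesianProductWith⁺ branch
    (λ { p q (true ∷ X) → p X ; p q (false ∷ X) → q X })
    (tables-complete b n (λ X → f (true ∷ X)) λ X → h (true ∷ X))
    (tables-complete b n (λ X → f (false ∷ X)) λ X → h (false ∷ X))

  IsRank : ∀ {n} → (Subset n → ℕ) → Set
  IsRank f = (∀ X → f X ≤ ∣ X ∣) × (∀ X Y → X ⊆ Y → f X ≤ f Y) × (∀ X Y → f (X ∪ Y) ℕ.+ f (X ∩ Y) ≤ f X ℕ.+ f Y)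

  isRank? : ∀ {n} (f : Subset n → ℕ) → Dec (IsRank f)
  isRank? f = allSubsets? (λ X → f X ℕₚ.≤? ∣ X ∣) ×-dec
    allSubsets? (λ X → allSubsets? λ Y → (X Subₚ.⊆? Y) →-dec (f X ℕₚ.≤? f Y)) ×-dec
    allSubsets? (λ X → allSubsets? λ Y → f (X ∪ Y) ℕ.+ f (X ∩ Y) ℕₚ.≤? f X ℕ.+ f Y)

  matroidsAmong : ∀ {n} → List (Subset n → ℕ) → List (Matroid n)
  matroidsAmong [] = []
  matroidsAmong (f ∷ fs) with isRank? f
  ... | no _            = matroidsAmong fs
  ... | yes (b , m , s) = record { rank = f ; rank-bound = b ; rank-mono = λ {X} {Y} → m X Y ; rank-submod = s } ∷ matroidsAmong fs

  matroidsAmong-complete : ∀ {n} (M : Matroid n) fs → Any (λ f → ∀ X → rank M X ≡ f X) fs →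
    Any (λ N → ∀ X → rank M X ≡ rank N X) (matroidsAmong fs)
  matroidsAmong-complete M (f ∷ fs) p with isRank? f
  matroidsAmong-complete M (f ∷ fs) (here e)  | yes _ = here e
  matroidsAmong-complete M (f ∷ fs) (there p) | yes _ = there (matroidsAmong-complete M fs p)
  matroidsAmong-complete M (f ∷ fs) (there p) | no _  = matroidsAmong-complete M fs p
  matroidsAmong-complete M (f ∷ fs) (here e)  | no ¬r = Empty-elim (¬r
    ((λ X → subst (_≤ _) (e X) (rank-bound M X)) ,
     (λ X Y s → ≡.subst₂ _≤_ (e X) (e Y) (rank-mono M s)) ,
     λ X Y → ≡.subst₂ _≤_ (cong₂ ℕ._+_ (e (X ∪ Y)) (e (X ∩ Y))) (cong₂ ℕ._+_ (e X) (e Y)) (rank-submod M X Y)))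

  matroids : ∀ n → List (Matroid n)
  matroids n = matroidsAmong (tables n n)

  sized : ∀ {p} {P : ℕ → Set p} → (∀ n → List (P n)) → ℕ → List (Σ ℕ P)
  sized xs zero    = []
  sized xs (suc b) = sized xs b ++ map (b ,_) (xs b)

  sized-complete : ∀ {p q} {P : ℕ → Set p} {Q : Σ ℕ P → Set q} (xs : ∀ n → List (P n)) b {n} → n < b →
    Any (λ x → Q (n , x)) (xs n) → Any Q (sized xs b)
  sized-complete xs (suc b) {n} (s≤s n≤b) p with n ℕₚ.≟ b
  ... | yes refl = Anyₚ.++⁺ʳ (sized xs b) (Anyₚ.map⁺ p)
  ... | no n≢b   = Anyₚ.++⁺ˡ (sized-complete xs b (ℕₚ.≤∧≢⇒< n≤b n≢b) p)

  same-rank⇒iso : ∀ {n} {M N : Matroid n} → (∀ X → rank M X ≡ rank N X) → Iso M N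
  same-rank⇒iso {N = N} e = (λ j → j) , ((λ p → p) , λ j → j , λ p → p) , λ X → trans (cong (rank N) (image-id X)) (sym (e X))
    where
    image-id : ∀ X → image (λ j → j) X ≡ X
    image-id X = Subₚ.⊆-antisym (λ p → let _ , i∈ , e = ∈-image⁻ (λ j → j) p in subst (_∈ X) e i∈) (∈-image⁺ (λ j → j))

-- Finiteness for matroids and for codes

module Finiteness {a ℓ} (F : FiniteField a ℓ) (w : ℕ) where
  open ≡ using (refl; sym; trans)
  open Subsets
  open MatroidEnumeration
  open Bound F w
  open Enumeration
  open LinearAlgebra F
  module 𝔽 = FiniteField F
  open 𝔽 using (Carrier; _≈_; 0#; 1#; _*_; size)
  open Code

  -- The common core of both halves: matroids and codes differ only in how they supply layouts of
  -- proper minors. The double negation disappears here because the goal is a contradiction.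
  not-large : ∀ {m n} (A : Fin m → Fin n → Carrier) (M : Matroid n) (rep : Represents F A M) →
    Matroids.Minors A M rep → ¬ PwAtMost M w → n < bound
  not-large A M rep minors ¬pw = ℕₚ.≰⇒> λ large →
    wide-layout A M rep minors large λ path → ¬pw (path⇒pw M (path-map (λ {Y} _ h → narrow⇒conn M {w} {Y} h) path))

  matroid-bound : ∀ {n} (M : Matroid n) → ExcludedMinorP F w M → n < bound
  matroid-bound M (R@(m , A , rep) , ¬in , minors) = not-large A M rep
    (λ G C disj small → minor-path M G C (minor M G C) (λ _ → refl)
      (proj₂ (minors (minor M G C) (embed G , embed-injective G , C , trans (cong (C ∩_) (image-embed G)) disj , λ _ → refl) small)))
    λ pw → ¬in (R , pw)

  module ShortenedCode {n} (C : Code F n) (G S : Subset n) where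
    ι : Fin ∣ G ∣ → Fin n
    ι = embed G

    M : Matroid n
    M = columnMatroid (gen C)

    v : Fin n → V (dim C)
    v = col (gen C)

    Vanishes : (Fin (dim C) → Carrier) → Set ℓ
    Vanishes u = ∀ j → j ∈ S → dot u (v j) ≈ 0#

    vanishes? : Decidable Vanishes
    vanishes? u = Finₚ.all? λ j → (j Subₚ.∈? S) →-dec (dot u (v j) 𝔽.≟ 0#)

    -- All messages encoded by words vanishing on S; the others are replaced by 0.
    message : Fin (size ℕ.^ dim C) → Fin (dim C) → Carrier
    message i with vanishes? (coefficients i)
    ... | yes _ = coefficients i
    ... | no _  = λ _ → 0#

    message-vanishes : ∀ i → Vanishes (message i)
    message-vanishes i with vanishes? (coefficients i)
    ... | yes h = h
    ... | no _  = λ j _ → ∑-zero {k = dim C} λ t → 𝔽.zeroˡ (v j t)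

    message-onto : ∀ u → Vanishes u → ∃[ i ] (∀ t → message i t ≈ u t)
    message-onto u h with coefficients-onto u
    ... | i , e = i , found
      where
      found : ∀ t → message i t ≈ u t
      found with vanishes? (coefficients i)
      ... | yes _ = e
      ... | no ¬h = Empty-elim (¬h λ j j∈ → 𝔽.trans (∑-cong λ t → 𝔽.*-congʳ (e t)) (h j j∈))

    code : Code F ∣ G ∣
    code = record { dim = size ℕ.^ dim C ; gen = λ i t → dot (message i) (v (ι t)) }

    isMinor : S ∩ G ≡ ⊥ → IsCodeMinor F code C
    isMinor disj = ι , embed-injective G , S , trans (cong (S ∩_) (image-embed G)) disj , (λ _ → 1#) , (λ _ → 𝔽.1≉0) ,
      λ y → mk⇔
        (λ { (b , e) → lin (gen C) (lin message b) , (lin message b , λ j → 𝔽.refl) ,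
               (λ j j∈ → 𝔽.trans (𝔽.sym (lin-lin (gen C) message b j))
                           (∑-zero λ i → 𝔽.trans (𝔽.*-congˡ (message-vanishes i j j∈)) (𝔽.zeroʳ (b i)))) ,
               λ t → 𝔽.trans (e t) (𝔽.trans (lin-lin (gen C) message b (ι t)) (𝔽.sym (𝔽.*-identityˡ _))) })
        (λ { (x , (u , e) , x≈0 , f) →
               let i , g = message-onto u (λ j j∈ → 𝔽.trans (𝔽.sym (e j)) (x≈0 j j∈)) in
               δ i , λ t → 𝔽.trans (f t) (𝔽.trans (𝔽.*-identityˡ _) (𝔽.trans (e (ι t)) (𝔽.trans
                 (∑-cong λ s → 𝔽.*-congʳ (𝔽.sym (g s))) (𝔽.sym (lin-δ (gen code) i t))))) })

    φ : V (dim C) → V (size ℕ.^ dim C)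
    φ u i = dot (message i) u

    -- A vector outside the span of the columns in `S` would be separated from it by some
    -- functional; that functional vanishes on `S`, hence is one of the messages, and `φ` would
    -- detect it.
    kernel : ∀ u → (∀ i → φ u i ≈ 0#) → Span (cols v S) u
    kernel u h with separate (cols v S) u
    ... | inj₁ p = p
    ... | inj₂ (z , z⊥ , zu≉0) = let i , e = message-onto z (λ j j∈ → All.lookup z⊥ (cols-∈ v j∈)) in
          Empty-elim (zu≉0 (𝔽.trans (∑-cong λ t → 𝔽.*-congʳ (𝔽.sym (e t))) (h i)))

    open Quotient φ (λ c p q e i → dot-combʳ c p q (message i) e) (cols v S)
      (cols-All v S λ j j∈ i → message-vanishes i j j∈) kernel

    map-cols : ∀ {k} (f : Fin k → V (dim C)) X → cols (λ t → φ (f t)) X ≡ map φ (cols f X)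
    map-cols f []          = refl
    map-cols f (true ∷ X)  = cong (φ (f zero) ∷_) (map-cols (λ t → f (suc t)) X)
    map-cols f (false ∷ X) = map-cols (λ t → f (suc t)) X

    -- The columns of the shortened code are images under `φ` of the old columns, so their ranks are
    -- those of the quotient by the span of the columns in `S`.
    rank-code : ∀ {N : Matroid ∣ G ∣} → Represents F (gen code) N → ∀ X → rank N X ≡ rank M (image ι X ∪ S) ℕ.∸ rank M S
    rank-code {N} rep X = sym (begin
        rank M (image ι X ∪ S) ℕ.∸ rank M S                            ≡⟨ cong (ℕ._∸ rank M S) (rk-≡ to from) ⟩
        rk (cols (λ t → v (ι t)) X ++ cols v S) ℕ.∸ rank M S           ≡⟨ cong (ℕ._∸ rank M S) (sym (rk-quotient (cols (λ t → v (ι t)) X))) ⟩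
        rk (map φ (cols (λ t → v (ι t)) X)) ℕ.+ rank M S ℕ.∸ rank M S  ≡⟨ ℕₚ.m+n∸n≡m _ (rank M S) ⟩
        rk (map φ (cols (λ t → v (ι t)) X))                            ≡⟨ cong rk (sym (map-cols (λ t → v (ι t)) X)) ⟩
        rk (cols (col (gen code)) X)                                   ≡⟨ sym (rank-cols {A = gen code} {N} rep X) ⟩
        rank N X                                                       ∎)
      where
      open ≡.≡-Reasoning
      to : All (Span (cols (λ t → v (ι t)) X ++ cols v S)) (cols v (image ι X ∪ S))
      to = cols-All v (image ι X ∪ S) λ j p → span-elem (locate j p)
        where
        locate : ∀ j → j ∈ image ι X ∪ S → v j Mem.∈ (cols (λ t → v (ι t)) X ++ cols v S)
        locate j p with Subₚ.x∈p∪q⁻ (image ι X) S p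
        ... | inj₂ q = Memₚ.∈-++⁺ʳ (cols (λ t → v (ι t)) X) (cols-∈ v q)
        ... | inj₁ q with ∈-image⁻ ι q
        ...   | t , t∈ , refl = Memₚ.∈-++⁺ˡ (cols-∈ (λ t → v (ι t)) t∈)
      from : All (Span (cols v (image ι X ∪ S))) (cols (λ t → v (ι t)) X ++ cols v S)
      from = Allₚ.++⁺ (cols-All (λ t → v (ι t)) X λ t t∈ → span-elem (cols-∈ v (∈-∪ˡ (∈-image⁺ ι t∈))))
                      (cols-⊆ v S (image ι X ∪ S) (∈-∪ʳ {X = image ι X}))

  code-bound : ∀ {n} (C : Code F n) → ExcludedMinorCode F w C → n < bound
  code-bound C (¬tw , minors) = not-large (gen C) (columnMatroid (gen C)) (columnMatroid-represents (gen C))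
    (λ G S disj small → let open ShortenedCode C G S
                            N , rep , pw = minors code (isMinor disj) small in
      minor-path M G S N (rank-code {N} rep) pw)
    λ pw → ¬tw (columnMatroid (gen C) , columnMatroid-represents (gen C) , pw)

  module _ {n : ℕ} where
    -- Rows are indexed by all of F^n and set to zero outside `T`. A code is recovered from the set
    -- of its words, so finitely many generator matrices cover all codes of length n.
    spannedBy : Subset (size ℕ.^ n) → Code F n
    spannedBy T = record { dim = size ℕ.^ n ; gen = generator }
      where
      generator : Fin (size ℕ.^ n) → Fin n → Carrier
      generator i with i Subₚ.∈? T
      ... | yes _ = coefficients i
      ... | no _  = λ _ → 0#

    codeword? : ∀ (C : Code F n) x → Dec (Codeword F C x)
    codeword? C x with Finₚ.any? (λ i → Finₚ.all? λ j → x j 𝔽.≟ lin (gen C) (coefficients i) j)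
    ... | yes (i , h) = yes (coefficients i , h)
    ... | no ¬h = no λ { (u , h) → let i , e = coefficients-onto u in
          ¬h (i , λ j → 𝔽.trans (h j) (𝔽.sym (lin-cong (gen C) e j))) }

    codewords : Code F n → Subset (size ℕ.^ n)
    codewords C = tabulate λ i → does (codeword? C (coefficients i))

    spannedBy-codewords : ∀ C → SameCode F C (n , spannedBy (codewords C))
    spannedBy-codewords C = refl , λ y → mk⇔
        (λ p → let i , e = coefficients-onto y in
          δ i , λ j → 𝔽.sym (𝔽.trans (lin-δ (gen D) i j) (𝔽.trans (listed i (codeword-resp (λ j → 𝔽.sym (e j)) p) j) (e j))))
        (λ { (b , e) → lin (λ i → proj₁ (member i)) b , λ j → 𝔽.trans (e j) (𝔽.trans
          (∑-cong λ i → 𝔽.*-congˡ (proj₂ (member i) j)) (lin-lin (gen C) (λ i → proj₁ (member i)) b j)) })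
      where
      D : Code F n
      D = spannedBy (codewords C)
      codeword-resp : ∀ {x y} → (∀ j → x j ≈ y j) → Codeword F C x → Codeword F C y
      codeword-resp e (u , h) = u , λ j → 𝔽.trans (𝔽.sym (e j)) (h j)
      listed : ∀ i → Codeword F C (coefficients i) → ∀ j → gen D i j ≈ coefficients i j
      listed i p j with i Subₚ.∈? codewords C
      ... | yes _ = 𝔽.refl
      ... | no ¬p = Empty-elim (¬p (∈-tabulate⁺ (dec-true (codeword? C _) p)))
      member : ∀ i → Codeword F C (gen D i)
      member i with i Subₚ.∈? codewords C
      ... | yes p = does⁻ (codeword? C _) (∈-tabulate⁻ p)
      ... | no _  = (λ _ → 0#) , λ j → 𝔽.sym (∑-zero {k = dim C} λ t → 𝔽.zeroˡ (gen C t j))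

  codes : ∀ n → List (Code F n)
  codes n = map spannedBy (allSubsets (size ℕ.^ n))

  finitely-many-matroids : ∃[ L ] ((n : ℕ) (M : Matroid n) → ExcludedMinorP F w M → Any (λ (N : Σ ℕ Matroid) → Iso M (proj₂ N)) L)
  finitely-many-matroids = sized matroids bound , λ n M ex → sized-complete matroids bound (matroid-bound M ex)
    (Any.map (λ {N} → same-rank⇒iso {M = M} {N})
      (matroidsAmong-complete M (tables n n) (tables-complete n n (rank M) λ X → ℕₚ.≤-trans (rank-bound M X) (Subₚ.∣p∣≤n X))))

  finitely-many-codes : ∃[ L ] ((n : ℕ) (C : Code F n) → ExcludedMinorCode F w C → Any (SameCode F C) L)
  finitely-many-codes = sized codes bound , λ n C ex → sized-complete codes bound (code-bound C ex)
    (Anyₚ.map⁺ (Any.map (λ { refl → spannedBy-codewords C }) (∈-allSubsets (codewords C))))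

theorem4p1 : ∀ {c ℓ : Level} (F : FiniteField c ℓ) (w : ℕ) → 0 < w →
    (∃[ L ] ((n : ℕ) (M : Matroid n) → ExcludedMinorP F w M →
    Any (λ (N : Σ ℕ Matroid) → Iso M (proj₂ N)) L))
    ×
    (∃[ L ] ((n : ℕ) (C : Code F n) → ExcludedMinorCode F w C →
    Any (SameCode F C) L))
theorem4p1 F w _ = Finiteness.finitely-many-matroids F w , Finiteness.finitely-many-codes F w
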